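{- There is a fixed polynomial $\mathrm{poly}$ such that the following holds. Let $n\in\mathbb{N}$ and for $1\le i\le\ell$ let $G_i$ be the Zariski closure of $\langle S_i\rangle$ for some $S_i\subseteq\mathrm{GL}_n(\mathbb{Q})$, such that $G_1\subsetneq G_2\subsetneq\cdots\subsetneq G_\ell$. Then $\ell\le\exp^4(\mathrm{poly}(n))$.
   Context: $\exp^k$ denotes iterated exponentiation in base 2: $\exp^0(x)=x$, $\exp^{k+1}(x)=2^{\exp^k(x)}$. $\mathrm{GL}_n(\overline{\mathbb{Q}})$ is identified with the algebraic set $\{(M,y)\in\overline{\mathbb{Q}}^{n^2+1}:\det(M)y=1\}$ with the Zariski topology. -}

module Defs where

open import Level using (0ℓ)
open import Data.Nat as ℕ using (ℕ; zero; suc)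
open import Data.Fin using (Fin; zero; suc)
open import Data.Vec using (Vec; []; _∷_; lookup; tabulate; foldr; map; zipWith; allFin; removeAt)
open import Data.Product using (_×_; _,_; proj₁; proj₂; Σ; ∃)
open import Data.Sum using (_⊎_; inj₁; inj₂)
open import Data.Unit using (⊤; tt)
open import Data.List using (List; []; _∷_)
open import Data.Rational as ℚ using (ℚ)
open import Relation.Binary.PropositionalEquality using (_≡_)
open import Relation.Nullary using (¬_)
open import Algebra.Bundles using (CommutativeRing)

exp : ℕ → ℕ → ℕ
exp zero    x = x
exp (suc k) x = 2 ℕ.^ exp k x

evalℕPoly : List ℕ → ℕ → ℕ
evalℕPoly []       x = 0
evalℕPoly (a ∷ as) x = a ℕ.+ x ℕ.* evalℕPoly as x

Mat : ℕ → Set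
Mat n = Vec (Vec ℚ n) n

sumℚ : ∀ {m} → Vec ℚ m → ℚ
sumℚ = foldr _ ℚ._+_ ℚ.0ℚ

signℚ : ℕ → ℚ
signℚ zero          = ℚ.1ℚ
signℚ (suc zero)    = ℚ.-_ ℚ.1ℚ
signℚ (suc (suc k)) = signℚ k

det : ∀ {n} → Mat n → ℚ
det {zero}  []         = ℚ.1ℚ
det {suc n} (r ∷ rows) =
  sumℚ (tabulate λ j → signℚ (Data.Fin.toℕ j) ℚ.* (lookup r j ℚ.* det (map (λ row → removeAt row j) rows)))

_⊗_ : ∀ {n} → Mat n → Mat n → Mat n
A ⊗ B = tabulate λ i → tabulate λ j →
  sumℚ (tabulate λ k → lookup (lookup A i) k ℚ.* lookup (lookup B k) j)

idMat : ∀ {n} → Mat n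
idMat = tabulate λ i → tabulate λ j → δ i j
  where
  δ : ∀ {n} → Fin n → Fin n → ℚ
  δ zero    zero    = ℚ.1ℚ
  δ zero    (suc _) = ℚ.0ℚ
  δ (suc _) zero    = ℚ.0ℚ
  δ (suc i) (suc j) = δ i j

-- GL_n(ℚ) as the set {(M , y) : det(M) y = 1} ⊆ ℚ^{n²+1}

Pt : ℕ → Set
Pt n = Mat n × ℚ

InGL : ∀ {n} → Pt n → Set
InGL (M , y) = det M ℚ.* y ≡ ℚ.1ℚ

data ⟨_⟩ {n : ℕ} (S : Pt n → Set) : Pt n → Set where
  gen : ∀ {p} → S p → ⟨ S ⟩ p
  one : ⟨ S ⟩ (idMat , ℚ.1ℚ)
  mul : ∀ {M y N z} → ⟨ S ⟩ (M , y) → ⟨ S ⟩ (N , z) → ⟨ S ⟩ (M ⊗ N , y ℚ.* z)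
  inv : ∀ {M y N z} → ⟨ S ⟩ (M , y) → N ⊗ M ≡ idMat → z ℚ.* y ≡ ℚ.1ℚ → ⟨ S ⟩ (N , z)

-- An algebraic closure of ℚ (any two are isomorphic; we quantify over all)

module _ (K : CommutativeRing 0ℓ 0ℓ) where
  open CommutativeRing K

  evalMonic : ∀ {d} → Vec Carrier (suc d) → Carrier → Carrier
  evalMonic cs x = go cs
    where
    go : ∀ {m} → Vec Carrier m → Carrier
    go []       = x
    go (c ∷ cs) = c + x * go cs

  evalMonicℚ : ∀ {d} → (ℚ → Carrier) → Vec ℚ (suc d) → Carrier → Carrier
  evalMonicℚ ι cs x = evalMonic (map ι cs) x

  record IsAlgebraicClosureOfℚ : Set where
    field
      1≉0      : ¬ (1# ≈ 0#)
      inverse  : ∀ x → ¬ (x ≈ 0#) → ∃ λ y → x * y ≈ 1#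
      ι        : ℚ → Carrier
      ι-+      : ∀ a b → ι (a ℚ.+ b) ≈ ι a + ι b
      ι-*      : ∀ a b → ι (a ℚ.* b) ≈ ι a * ι b
      ι-1      : ι ℚ.1ℚ ≈ 1#
      closed   : ∀ {d} (cs : Vec Carrier (suc d)) → ∃ λ x → evalMonic cs x ≈ 0#
      algebraic : ∀ x → ∃ λ d → Σ (Vec ℚ (suc d)) λ cs → evalMonicℚ ι cs x ≈ 0#

  Var : ℕ → Set
  Var n = (Fin n × Fin n) ⊎ ⊤

  data Poly (V : Set) : Set where
    con : Carrier → Poly V
    var : V → Poly V
    _⊕_ : Poly V → Poly V → Poly V
    _⊛_ : Poly V → Poly V → Poly V

  eval : ∀ {V} → Poly V → (V → Carrier) → Carrier
  eval (con c) x = c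
  eval (var v) x = x v
  eval (p ⊕ q) x = eval p x + eval q x
  eval (p ⊛ q) x = eval p x * eval q x

  embed : ∀ {n} → (ℚ → Carrier) → Pt n → (Var n → Carrier)
  embed ι (M , y) (inj₁ (i , j)) = ι (lookup (lookup M i) j)
  embed ι (M , y) (inj₂ tt)      = ι y

  ZariskiClosure : ∀ {n} → (ℚ → Carrier) → (Pt n → Set) → (Var n → Carrier) → Set
  ZariskiClosure ι X x =
    ∀ (f : Poly (Var _)) → (∀ p → X p → eval f (embed ι p) ≈ 0#) → eval f x ≈ 0#

{-# OPTIONS --safe #-}
module Submission where

-- A strict chain of closures yields invertible rational matrices g₀, g₁, … and polynomials fᵢ that vanish on
-- ⟨g₀ … gᵢ₋₁⟩ but not at gᵢ; everything involved has coefficients in ℤ[1/D].  Fix a prime p ∤ D.  The elements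
-- 1 + pᵗX + … of the groups, with X modulo p, span subspaces of 𝔽ₚ^(N²) that grow with t and along the chain, so
-- their limit dimension jumps at most N² times.  Between two groups Γ ⊆ Δ of equal dimension, every element of Δ
-- that is congruent to 1 modulo a high power of p is a p-adic limit of elements of Γ, so it lies in the Zariski
-- closure of Γ, and the index k of that closure in Δ is finite.  Now let p vary: for p > k the elements of Δ that
-- are 1 modulo p lie in the closure of Γ, hence k divides |GL_N(𝔽ₚ)| for all large p ∤ D.  As such primes generate
-- all residues prime to D, this bounds k in terms of N alone (Minkowski's argument), and with it the number of
-- steps between Γ and Δ.
--
-- Equality in K need not be ¬¬-stable, so passing from K-polynomials to rational ones requires actual linear
-- combinations: they come from finitely generated dense subgroups, for which spans can be computed.

-- p-adic limits are expressed inside one ring as congruences modulo every power of `p`; a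
-- polynomial takes congruent values at congruent matrices, and only 0 is divisible by all these
-- powers. Inversion is not polynomial in the entries, so a closure is at first only a monoid;
-- finitely many residues modulo a power of `p` make its part in Δ a group. Every step between Γ and
-- Δ doubles the number of known cosets, so the index is at least 2 to the number of steps. It
-- divides the order of GL_N over the field with `p` elements because Δ acts on bases, freely up to
-- that group. In Minkowski's argument the primes are factors of two explicit integers coprime to
-- `D` and k!, with residues 2 and 3; hence the constant 6. Dense finitely generated subgroups come
-- from the chain bound itself: as long as a subgroup is not dense, a chain of generators can be
-- prolonged. Ranks, orbits and maximal coset systems exist only up to double negation; this
-- suffices, as what is concluded from them is an inequality or a divisibility of natural numbers,
-- both decidable.

-- Divisibility and Minkowski's bound.

module Arithmetic where

  open import Data.Nat
  open import Data.Nat.Properties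
  open import Data.Nat.Divisibility
  open import Data.Nat.GCD using (gcd; gcd[m,n]∣m; gcd[m,n]∣n; gcd-greatest; GCD; gcd-GCD; GCD-*; gcd[m,n]≢0)
  open import Data.Nat.Coprimality using (Coprime; coprime-divisor; coprime-factors; coprime-Bézout; GCD≡1⇒coprime; prime⇒coprime)
    renaming (sym to coprime-sym)
  open import Data.Nat.GCD using (module Bézout)
  open import Data.Nat.Primality
    using (Prime; prime[2]; euclidsLemma; prime⇒nonZero; prime⇒irreducible; ¬prime[1])
  open import Data.Nat.Primality.Factorisation using (PrimeFactorisation; factorise)
  open import Data.Nat.ListAction using (product)
  open import Data.Nat.Induction using (<-rec)
  open import Data.Nat.Tactic.RingSolver using (solve-∀)
  open import Data.List using (List; []; _∷_; _++_)
  open import Data.List.Relation.Unary.All as All using (All; []; _∷_)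
  open import Data.List.Relation.Unary.All.Properties using (++⁺; ++⁻ˡ; ++⁻ʳ)
  open import Data.Product using (∃; _×_; _,_; proj₁; proj₂)
  open import Data.Sum using (inj₁; inj₂)
  open import Relation.Nullary using (¬_; yes; no; contradiction)
  open import Relation.Binary.PropositionalEquality
    using (_≡_; refl; sym; trans; cong; cong₂; subst; module ≡-Reasoning)

  -- |GL_n(𝔽_p)| is tupleCount p n n.
  tupleCount : ℕ → ℕ → ℕ → ℕ
  tupleCount p n zero    = 1
  tupleCount p n (suc m) = tupleCount p n m * (p ^ n ∸ p ^ m)

  infix 4 _≡1mod_
  _≡1mod_ : ℕ → ℕ → Set
  x ≡1mod d = ∃ λ r → x ≡ 1 + r * d

  ≡1mod-* : ∀ {x y d} → x ≡1mod d → y ≡1mod d → x * y ≡1mod d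
  ≡1mod-* {d = d} (r , refl) (s , refl) = r + s + r * d * s , lem r s d
    where
    lem : ∀ r s d → (1 + r * d) * (1 + s * d) ≡ 1 + (r + s + r * d * s) * d
    lem = solve-∀

  ≡1mod-^ : ∀ {x d} → x ≡1mod d → ∀ n → x ^ n ≡1mod d
  ≡1mod-^ h zero    = 0 , refl
  ≡1mod-^ h (suc n) = ≡1mod-* h (≡1mod-^ h n)

  ≡1mod-weaken : ∀ {x d d′} → d′ ∣ d → x ≡1mod d → x ≡1mod d′
  ≡1mod-weaken {d′ = d′} (divides q refl) (r , eq) = r * q , trans eq (cong suc (sym (*-assoc r q d′)))

  ≡1mod⇒∣ : ∀ {x d} → x ≡1mod d → d ∣ x ∸ 1
  ≡1mod⇒∣ (r , refl) = divides r refl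

  ∣⇒≡1mod : ∀ {x d} → 1 ≤ x → d ∣ x ∸ 1 → x ≡1mod d
  ∣⇒≡1mod {suc x} _ (divides q eq) = q , cong suc eq

  +*-^ : ∀ a b c n → ∃ λ r → (a + c * b) ^ n ≡ a ^ n + r * b
  +*-^ a b c zero = 0 , refl
  +*-^ a b c (suc n) with +*-^ a b c n
  ... | r , eq = a * r + c * a ^ n + c * b * r , trans (cong ((a + c * b) *_) eq) (lem a b c r (a ^ n))
    where
    lem : ∀ a b c r x → (a + c * b) * (x + r * b) ≡ a * x + (a * r + c * x + c * b * r) * b
    lem = solve-∀

  coprime-*ʳ : ∀ {a b c} → Coprime a b → Coprime a c → Coprime a (b * c)
  coprime-*ʳ ab ac (d∣a , d∣bc) =
    ac (d∣a , coprime-divisor (λ (e∣d , e∣b) → ab (∣-trans e∣d d∣a , e∣b)) d∣bc)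

  coprime-^ʳ : ∀ {a b} → Coprime a b → ∀ n → Coprime a (b ^ n)
  coprime-^ʳ ab zero    (_ , d∣1) = ∣1⇒≡1 d∣1
  coprime-^ʳ ab (suc n) = coprime-*ʳ ab (coprime-^ʳ ab n)

  coprime-^ : ∀ {a b} → Coprime a b → ∀ n → Coprime (a ^ n) (b ^ n)
  coprime-^ ab n = coprime-sym (coprime-^ʳ (coprime-sym (coprime-^ʳ ab n)) n)

  ^-distrib-* : ∀ a b n → (a * b) ^ n ≡ a ^ n * b ^ n
  ^-distrib-* a b zero = refl
  ^-distrib-* a b (suc n) = trans (cong (a * b *_) (^-distrib-* a b n)) (lem a b (a ^ n) (b ^ n))
    where
    lem : ∀ a b x y → a * b * (x * y) ≡ a * x * (b * y)
    lem = solve-∀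

  gcd-decompose : ∀ a b .{{_ : NonZero a}} →
    ∃ λ a′ → ∃ λ b′ → a ≡ a′ * gcd a b × b ≡ b′ * gcd a b × Coprime a′ b′
  gcd-decompose a b with gcd[m,n]∣m a b | gcd[m,n]∣n a b
  ... | divides a′ eqa | divides b′ eqb = a′ , b′ , eqa , eqb , GCD≡1⇒coprime (GCD-* {{nz}} g)
    where
    nz : NonZero (gcd a b)
    nz = ≢-nonZero (gcd[m,n]≢0 a b (inj₁ (≢-nonZero⁻¹ a)))
    g : GCD (a′ * gcd a b) (b′ * gcd a b) (1 * gcd a b)
    g = subst (GCD _ _) (sym (*-identityˡ _))
          (subst (λ x → GCD x (b′ * gcd a b) (gcd a b)) eqa (subst (λ x → GCD a x (gcd a b)) eqb (gcd-GCD a b)))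

  -- Divide both numbers by their gcd: `k` divides `a′ ^ n` and `b′ ^ n` times `gcd a b ^ n`. The
  -- powers of the coprime `a′` and `b′` stay coprime, so the common factor must absorb `k`.
  ∣gcd^ : ∀ {k} a b n .{{_ : NonZero a}} → k ∣ a ^ n → k ∣ b ^ n → k ∣ gcd a b ^ n
  ∣gcd^ a b n ka kb with gcd-decompose a b
  ... | a′ , b′ , eqa , eqb , cop = coprime-factors (coprime-^ cop n) (split eqa ka , split eqb kb)
    where
    split : ∀ {k x x′} → x ≡ x′ * gcd a b → k ∣ x ^ n → k ∣ x′ ^ n * gcd a b ^ n
    split {x′ = x′} eq = subst (_ ∣_) (trans (cong (_^ n) eq) (^-distrib-* x′ (gcd a b) n))

  ∣gcd*gcd : ∀ d a b .{{_ : NonZero d}} → d ∣ a * b → d ∣ gcd d a * gcd d b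
  ∣gcd*gcd d a b d∣ab with gcd-decompose d a
  ... | d′ , a′ , eqd , eqa , cop =
    subst (_∣ gcd d a * gcd d b) (trans (*-comm (gcd d a) d′) (sym eqd))
      (*-monoʳ-∣ (gcd d a) (gcd-greatest (subst (d′ ∣_) (sym eqd) (m∣m*n (gcd d a))) (coprime-divisor cop d′∣a′b)))
    where
    instance
      nz : NonZero (gcd d a)
      nz = ≢-nonZero (gcd[m,n]≢0 d a (inj₁ (≢-nonZero⁻¹ d)))
    lem : ∀ x g y → x * g * y ≡ g * (x * y)
    lem = solve-∀
    d′∣a′b : d′ ∣ a′ * b
    d′∣a′b = *-cancelˡ-∣ (gcd d a)
      (subst (_∣ gcd d a * (a′ * b)) (trans eqd (*-comm d′ (gcd d a)))
        (subst (d ∣_) (trans (cong (_* b) eqa) (lem a′ (gcd d a) b)) d∣ab))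

  ∣1≤ : ∀ {a b} → 1 ≤ b → a ∣ b → a ≤ b
  ∣1≤ 1≤b a∣b = ∣⇒≤ {{>-nonZero 1≤b}} a∣b

  1≤-* : ∀ {a b} → 1 ≤ a → 1 ≤ b → 1 ≤ a * b
  1≤-* = *-mono-≤

  1≤^ : ∀ {a} → 1 ≤ a → ∀ n → 1 ≤ a ^ n
  1≤^ h zero    = ≤-refl
  1≤^ h (suc n) = 1≤-* h (1≤^ h n)

  1≤! : ∀ n → 1 ≤ n !
  1≤! zero    = ≤-refl
  1≤! (suc n) = 1≤-* {suc n} (s≤s z≤n) (1≤! n)

  ∣! : ∀ {i n} → 1 ≤ i → i ≤ n → i ∣ n !
  ∣! {suc i} {n} (s≤s _) le = ∣-trans (m∣m*n (i !)) (m≤n⇒m!∣n! le)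

  odd-part : ∀ n → 1 ≤ n → ∃ λ c → ∃ λ o → n ≡ 2 ^ c * o × ¬ 2 ∣ o
  odd-part = <-rec _ step
    where
    step : ∀ n → (∀ {m} → m < n → 1 ≤ m → ∃ λ c → ∃ λ o → m ≡ 2 ^ c * o × ¬ 2 ∣ o) →
           1 ≤ n → ∃ λ c → ∃ λ o → n ≡ 2 ^ c * o × ¬ 2 ∣ o
    step n rec 1≤n with 2 ∣? n
    ... | no ¬2∣n = 0 , n , sym (*-identityˡ n) , ¬2∣n
    ... | yes (divides zero refl) = contradiction 1≤n λ ()
    ... | yes (divides (suc m) refl) with rec (lt m) (s≤s z≤n)
      where
      lt : ∀ m → suc m < suc m * 2
      lt m = subst (suc m <_) (*-comm 2 (suc m)) (m<m+n (suc m) (s≤s z≤n))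
    ... | c , o , eq , odd = suc c , o , trans (cong (_* 2) eq) (lem (2 ^ c) o) , odd
      where
      lem : ∀ x o → x * o * 2 ≡ 2 * x * o
      lem = solve-∀

  prime∣prime : ∀ {p q} → Prime p → Prime q → p ∣ q → p ≡ q
  prime∣prime pp pq p∣q with prime⇒irreducible pq p∣q
  ... | inj₁ refl = contradiction pp ¬prime[1]
  ... | inj₂ eq   = eq

  prime∣^ : ∀ {p a} n → Prime p → p ∣ a ^ n → p ∣ a
  prime∣^ zero pp d = contradiction (subst Prime (∣1⇒≡1 d) pp) ¬prime[1]
  prime∣^ {a = a} (suc n) pp d with euclidsLemma a (a ^ n) pp d
  ... | inj₁ h = h
  ... | inj₂ h = prime∣^ n pp h

  inverse-mod : ∀ {a m} → 2 ≤ m → Coprime a m → ∃ λ w → w * a ≡1mod m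
  inverse-mod {a} {suc (suc u)} (s≤s (s≤s _)) c with coprime-Bézout c
  ... | Bézout.Identity.+- x y eq = x , y , sym eq
  -- Here 1 + x a is a multiple of m, so -x inverts a; -1 is represented by m - 1, which is `suc u`.
  ... | Bézout.Identity.-+ x (suc y) eq = x * suc u , suc u * y + u ,
    trans (lem x u a) (trans (cong (suc u *_) (suc-injective eq)) (lem′ u y))
    where
    lem : ∀ x u a → x * suc u * a ≡ suc u * (x * a)
    lem = solve-∀
    lem′ : ∀ u y → suc u * (suc u + y * suc (suc u)) ≡ 1 + (suc u * y + u) * suc (suc u)
    lem′ = solve-∀

  -- The factor `p ^ n ∸ p ^ m` is `p ^ m` times `p ^ (n ∸ m) ∸ 1`, which divides `p ^ e ∸ 1`
  -- because `e` is a multiple of all numbers from 1 to `n`. The powers of `p` drop out later, where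
  -- `k < p` makes them coprime to `k`.
  ∣p^*tupleCount : ∀ p n e → 1 ≤ p → (∀ {i} → 1 ≤ i → i ≤ n → i ∣ e) →
                   ∀ m → m ≤ n → ∃ λ s → tupleCount p n m ∣ p ^ s * (p ^ e ∸ 1) ^ m
  ∣p^*tupleCount p n e 1≤p div zero m≤n = 0 , ∣-refl
  ∣p^*tupleCount p n e 1≤p div (suc m) m<n with ∣p^*tupleCount p n e 1≤p div m (<⇒≤ m<n)
  ... | s , h = s + m , subst (tupleCount p n (suc m) ∣_) assemble (*-pres-∣ h factor)
    where
    open ≡-Reasoning
    rest = n ∸ m
    factor-eq : p ^ n ∸ p ^ m ≡ p ^ m * (p ^ rest ∸ 1)
    factor-eq = begin
      p ^ n ∸ p ^ m                ≡⟨ cong₂ _∸_ (trans (cong (p ^_) (sym (m+[n∸m]≡n (<⇒≤ m<n)))) (^-distribˡ-+-* p m rest)) (sym (*-identityʳ (p ^ m))) ⟩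
      p ^ m * p ^ rest ∸ p ^ m * 1 ≡⟨ *-distribˡ-∸ (p ^ m) (p ^ rest) 1 ⟨
      p ^ m * (p ^ rest ∸ 1)       ∎
    divides-e : p ^ rest ∸ 1 ∣ p ^ e ∸ 1
    divides-e with div {rest} (m<n⇒0<n∸m m<n) (m∸n≤m n m)
    ... | divides q e≡ = ≡1mod⇒∣ (subst (_≡1mod (p ^ rest ∸ 1)) (trans (^-*-assoc p rest q) (cong (p ^_) (trans (*-comm rest q) (sym e≡))))
                           (≡1mod-^ (∣⇒≡1mod (1≤^ 1≤p rest) ∣-refl) q))
    factor : p ^ n ∸ p ^ m ∣ p ^ m * (p ^ e ∸ 1)
    factor = subst (_∣ p ^ m * (p ^ e ∸ 1)) (sym factor-eq) (*-monoʳ-∣ (p ^ m) divides-e)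
    lem : ∀ a b y z → a * y * (b * z) ≡ a * b * (z * y)
    lem = solve-∀
    assemble : p ^ s * (p ^ e ∸ 1) ^ m * (p ^ m * (p ^ e ∸ 1)) ≡ p ^ (s + m) * (p ^ e ∸ 1) ^ suc m
    assemble = trans (lem (p ^ s) (p ^ m) _ (p ^ e ∸ 1)) (cong (_* (p ^ e ∸ 1) ^ suc m) (sym (^-distribˡ-+-* p s m)))

  -- To pass from primes to their products, divisibility of `(p ^ e ∸ 1) ^ n` by `k` is traded for
  -- the multiplicative condition `p ^ e ≡1mod d`. Here `d` is the gcd of `k` with all the
  -- `p ^ e ∸ 1`, and `∣gcd^` keeps `k ∣ d ^ n` at each new prime.
  common-root : ∀ {k n e} → 1 ≤ k → 1 ≤ n → ∀ ps → All (λ p → 1 ≤ p × k ∣ (p ^ e ∸ 1) ^ n) ps →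
    ∃ λ d → 1 ≤ d × d ∣ k × k ∣ d ^ n × All (λ p → p ^ e ≡1mod d) ps
  common-root {k} {suc n} 1≤k _ [] [] = k , 1≤k , ∣-refl , m∣m*n (k ^ n) , []
  common-root {k} {n} {e} 1≤k 1≤n (p ∷ ps) ((1≤p , hp) ∷ hps) with common-root {e = e} 1≤k 1≤n ps hps
  ... | d , 1≤d , d∣k , k∣d^n , one =
    gcd d y , n≢0⇒n>0 (gcd[m,n]≢0 d y (inj₁ (>⇒≢ 1≤d))) , ∣-trans (gcd[m,n]∣m d y) d∣k ,
    ∣gcd^ d y n {{>-nonZero 1≤d}} k∣d^n hp ,
    ∣⇒≡1mod (1≤^ 1≤p e) (gcd[m,n]∣n d y) ∷ All.map (≡1mod-weaken (gcd[m,n]∣m d y)) one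
    where
    y = p ^ e ∸ 1

  ≡1mod-product : ∀ {d e} ps → All (λ p → p ^ e ≡1mod d) ps → product ps ^ e ≡1mod d
  ≡1mod-product {d} {e} [] [] = subst (_≡1mod d) (sym (^-zeroˡ e)) (0 , refl)
  ≡1mod-product {d} {e} (p ∷ ps) (h ∷ hs) =
    subst (_≡1mod d) (sym (^-distrib-* p (product ps) e)) (≡1mod-* h (≡1mod-product {e = e} ps hs))

  module _ {k n e D : ℕ} (1≤k : 1 ≤ k) (1≤n : 1 ≤ n) (1≤D : 1 ≤ D) (1≤e : 1 ≤ e)
    (div-e : ∀ {i} → 1 ≤ i → i ≤ n → i ∣ e)
    (count : ∀ p → Prime p → ¬ p ∣ D → k < p → k ∣ tupleCount p n n) where

    private
      count′ : ∀ p → Prime p → ¬ p ∣ D → k < p → k ∣ (p ^ e ∸ 1) ^ n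
      count′ p pp p∤D k<p with ∣p^*tupleCount p n e (>-nonZero⁻¹ p {{prime⇒nonZero pp}}) div-e n ≤-refl
      ... | s , h = coprime-divisor
                      (coprime-^ʳ (coprime-sym (prime⇒coprime pp {{>-nonZero 1≤k}} k<p)) s)
                      (∣-trans (count p pp p∤D k<p) h)

      odd-coprime : ∀ {o} → ¬ 2 ∣ o → ∀ c → Coprime o (2 ^ c)
      odd-coprime {o} o-odd c = coprime-^ʳ (λ {d} → cop {d}) c
        where
        cop : Coprime o 2
        cop {zero} (d∣o , d∣2) = contradiction (0∣⇒≡0 d∣2) λ ()
        cop {suc zero} (d∣o , d∣2) = refl
        cop {suc (suc zero)} (d∣o , d∣2) = contradiction d∣o o-odd
        cop {suc (suc (suc d))} (d∣o , d∣2) = contradiction (∣⇒≤ d∣2) λ { (s≤s (s≤s ())) }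


      -- A prime not dividing `D * k !` satisfies both conditions of `count`, as all primes up to
      -- `k` divide `k !`. Since `d ∣ k` also divides this number, its 2-part and odd part split `d`
      -- into two factors that are bounded separately.
      module WithUnits (c o : ℕ) (D′≡ : D * k ! ≡ 2 ^ c * o) (o-odd : ¬ 2 ∣ o)
                       (w v : ℕ) (wo≡ : w * o ≡ 1 + v * 2 ^ suc c) where

        good : ∀ {p} → Prime p → ¬ p ∣ 2 → ¬ p ∣ o → 1 ≤ p × k ∣ (p ^ e ∸ 1) ^ n
        good {p} pp p∤2 p∤o = 1≤p , count′ p pp (λ h → p∤D′ (∣m⇒∣m*n (k !) h))
                                      (≰⇒> (λ p≤k → p∤D′ (∣n⇒∣m*n D (∣! 1≤p p≤k))))
          where
          1≤p = >-nonZero⁻¹ p {{prime⇒nonZero pp}}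
          p∤D′ : ¬ p ∣ D * k !
          p∤D′ h with euclidsLemma (2 ^ c) o pp (subst (p ∣_) D′≡ h)
          ... | inj₁ h₂ = p∤2 (prime∣^ c pp h₂)
          ... | inj₂ ho = p∤o ho

        good-factors : ∀ x → (∀ {p} → Prime p → p ∣ x → ¬ p ∣ 2 × ¬ p ∣ o) → ∀ ps → product ps ∣ x → All Prime ps →
                       All (λ p → 1 ≤ p × k ∣ (p ^ e ∸ 1) ^ n) ps
        good-factors x h [] _ [] = []
        good-factors x h (p ∷ ps) d (pp ∷ pps) =
          (let (a , b) = h pp (∣-trans (m∣m*n (product ps)) d) in good pp a b)
          ∷ good-factors x h ps (∣-trans (n∣m*n p) d) pps

        -- x₁ ≡ 2 modulo the odd part and x₂ ≡ 3 modulo the 2-part, both coprime to D k!.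
        x₁ = 2 + 1 * o

        x₁-good : ∀ {p} → Prime p → p ∣ x₁ → ¬ p ∣ 2 × ¬ p ∣ o
        x₁-good {p} pp h = p∤2 , λ p∣o → p∤2 (∣m+n∣m⇒∣n (subst (p ∣_) (+-comm 2 (1 * o)) h) (∣n⇒∣m*n 1 p∣o))
          where
          p∤2 : ¬ p ∣ 2
          p∤2 p∣2 = o-odd (subst (2 ∣_) (*-identityˡ o)
            (∣m+n∣m⇒∣n {2} {2} (subst (_∣ x₁) (prime∣prime pp prime[2] p∣2) h) ∣-refl))

        x₂ = 1 + 2 * (w * o)

        x₂-good : ∀ {p} → Prime p → p ∣ x₂ → ¬ p ∣ 2 × ¬ p ∣ o
        x₂-good {p} pp h = (λ p∣2 → absurd (∣m⇒∣m*n (w * o) p∣2)) , λ p∣o → absurd (∣n⇒∣m*n 2 (∣n⇒∣m*n w p∣o))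
          where
          absurd : ¬ p ∣ 2 * (w * o)
          absurd d = contradiction (subst Prime (∣1⇒≡1 (∣m+n∣m⇒∣n (subst (p ∣_) (+-comm 1 (2 * (w * o))) h) d)) pp) ¬prime[1]

        x₂≡ : x₂ ≡ 3 + 4 * v * 2 ^ c
        x₂≡ = trans (cong (λ y → 1 + 2 * y) wo≡) (lem v (2 ^ c))
          where
          lem : ∀ v x → 1 + 2 * (1 + v * (2 * x)) ≡ 3 + 4 * v * x
          lem = solve-∀

        f₁ : PrimeFactorisation x₁
        f₁ = factorise x₁
        f₂ : PrimeFactorisation x₂
        f₂ = factorise x₂
        open PrimeFactorisation

        ps = factors f₁ ++ factors f₂

        ps-good : All (λ p → 1 ≤ p × k ∣ (p ^ e ∸ 1) ^ n) ps
        ps-good = ++⁺ (good-factors x₁ x₁-good _ (∣-reflexive (sym (isFactorisation f₁))) (factorsPrime f₁))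
                      (good-factors x₂ x₂-good _ (∣-reflexive (sym (isFactorisation f₂))) (factorsPrime f₂))

        small : ∀ {d a b r} → 2 ≤ a → d ∣ b → a ^ e + r * b ≡1mod d → d ≤ a ^ e
        small {d} {a} {b} {r} 2≤a d∣b h = ≤-trans (∣1≤ (m<n⇒0<n∸m 1<a^e) d∣y) (m∸n≤m (a ^ e) 1)
          where
          1<a^e : 1 < a ^ e
          1<a^e = ≤-trans 2≤a (subst (_≤ a ^ e) (^-identityʳ a) (^-monoʳ-≤ a {{>-nonZero (≤-trans (s≤s z≤n) 2≤a)}} 1≤e))
          d∣y : d ∣ a ^ e ∸ 1
          d∣y = ∣m+n∣m⇒∣n (subst (d ∣_) (trans (+-∸-comm (r * b) (<⇒≤ 1<a^e)) (+-comm (a ^ e ∸ 1) (r * b))) (≡1mod⇒∣ h)) (∣n⇒∣m*n r d∣b)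

        -- Modulo the odd part of `d` the congruence for `x₁` becomes `2 ^ e ≡1mod d₁`, and modulo
        -- its 2-part the one for `x₂` becomes `3 ^ e ≡1mod d₂`. Hence `d ≤ 3 ^ e * 2 ^ e`, and
        -- `k ∣ d ^ n` gives the bound.
        bound : k ≤ 6 ^ (e * n)
        bound with common-root {k} {n} {e} 1≤k 1≤n ps ps-good
        ... | d , 1≤d , d∣k , k∣d^n , one = ≤-trans (∣1≤ (1≤^ 1≤d n) k∣d^n)
          (subst (d ^ n ≤_) (^-*-assoc 6 e n) (^-monoˡ-≤ n d≤6^e))
          where
          one₁ : x₁ ^ e ≡1mod d
          one₁ = subst (λ x → x ^ e ≡1mod d) (sym (isFactorisation f₁)) (≡1mod-product {e = e} _ (++⁻ˡ (factors f₁) one))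
          one₂ : x₂ ^ e ≡1mod d
          one₂ = subst (λ x → x ^ e ≡1mod d) (sym (isFactorisation f₂)) (≡1mod-product {e = e} _ (++⁻ʳ (factors f₁) one))
          d₂ = gcd d (2 ^ c)
          d₁ = gcd d o
          d₁≤ : d₁ ≤ 2 ^ e
          d₁≤ = small {a = 2} {r = proj₁ (+*-^ 2 o 1 e)} ≤-refl (gcd[m,n]∣n d o)
                  (subst (_≡1mod d₁) (proj₂ (+*-^ 2 o 1 e)) (≡1mod-weaken (gcd[m,n]∣m d o) one₁))
          d₂≤ : d₂ ≤ 3 ^ e
          d₂≤ = small {a = 3} {r = proj₁ (+*-^ 3 (2 ^ c) (4 * v) e)} (s≤s (s≤s z≤n)) (gcd[m,n]∣n d (2 ^ c))
                  (subst (_≡1mod d₂) (trans (cong (_^ e) x₂≡) (proj₂ (+*-^ 3 (2 ^ c) (4 * v) e)))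
                    (≡1mod-weaken (gcd[m,n]∣m d (2 ^ c)) one₂))
          d∣ : d ∣ d₂ * d₁
          d∣ = ∣gcd*gcd d (2 ^ c) o {{>-nonZero 1≤d}}
                 (subst (d ∣_) D′≡ (∣n⇒∣m*n D (∣-trans d∣k (∣! 1≤k ≤-refl))))
          1≤gcd : ∀ y → 1 ≤ gcd d y
          1≤gcd y = n≢0⇒n>0 (gcd[m,n]≢0 d y (inj₁ (>⇒≢ 1≤d)))
          d≤6^e : d ≤ 6 ^ e
          d≤6^e = ≤-trans (∣1≤ (1≤-* (1≤gcd (2 ^ c)) (1≤gcd o)) d∣)
                    (subst (d₂ * d₁ ≤_) (sym (^-distrib-* 3 2 e)) (*-mono-≤ d₂≤ d₁≤))

    minkowski-bound : k ≤ 6 ^ (e * n)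
    minkowski-bound with odd-part (D * k !) (1≤-* 1≤D (1≤! k))
    -- The exponent is `suc c` because `inverse-mod` asks for a modulus of at least 2 and `c` may be
    -- 0.
    ... | c , o , D′≡ , o-odd with inverse-mod (*-monoʳ-≤ 2 (1≤^ {2} (s≤s z≤n) c)) (odd-coprime o-odd (suc c))
    ...   | w , v , wo≡ = WithUnits.bound c o D′≡ o-odd w v wo≡

-- Counting in finite lists, and Lagrange's theorem for free actions.

module FiniteSets where

  open import Level using (0ℓ)
  open import Algebra.Bundles using (Group)
  import Algebra.Properties.Group
  open import Data.Empty using (⊥)
  open import Data.Fin as Fin using (Fin; zero; suc)
  open import Data.Fin.Properties as Fin using (injective⇒≤)
  open import Data.List using (List; []; _∷_; length; map; allFin; cartesianProductWith; filter; lookup; concatMap)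
  open import Data.List.Properties using (length-map; length-++; length-tabulate)
  open import Data.List.Membership.Propositional using (_∈_)
  open import Data.List.Membership.Propositional.Properties
    using (∈-lookup; ∈-allFin; ∈-cartesianProductWith⁺; ∈-cartesianProductWith⁻; ∈-filter⁺; ∈-filter⁻; ∈-map⁻)
  open import Data.List.Relation.Unary.All as All using (All)
  open import Data.List.Relation.Unary.AllPairs using ([]; _∷_)
  open import Data.List.Relation.Unary.Any as Any using (here; there)
  open import Data.List.Relation.Unary.Any.Properties using (lookup-index)
  open import Data.List.Relation.Unary.Unique.Propositional using (Unique)
  import Data.List.Relation.Unary.Unique.Propositional.Properties as Unique
  open import Data.Nat using (ℕ; zero; suc; _+_; _*_; _^_; _≤_; z≤n; s≤s)
  open import Data.Nat.Divisibility using (_∣_; divides)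
  open import Data.Nat.Properties using (≤-antisym; ≤-refl; <⇒≱; *-comm; +-suc; +-identityʳ)
  open import Data.Product using (∃; _×_; _,_; proj₁; proj₂)
  open import Data.Vec as Vec using (Vec; []; _∷_)
  open import Data.Vec.Properties using (∷-injective)
  open import Function using (_∘_)
  open import Relation.Binary.PropositionalEquality
    using (_≡_; refl; sym; trans; cong; cong₂; subst)
  open import Relation.Nullary using (¬_; Dec; yes; no; contradiction; ¬?)
  open import Relation.Unary using (Decidable)

  ¬¬-dec : ∀ {a} {P : Set a} → ¬ ¬ Dec P
  ¬¬-dec k = k (no (k ∘ yes))

  ¬¬-Fin : ∀ {a m} {P : Fin m → Set a} → (∀ i → ¬ ¬ P i) → ¬ ¬ (∀ i → P i)
  ¬¬-Fin {m = zero}  h k = k λ ()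
  ¬¬-Fin {m = suc m} h k = h zero λ p₀ → ¬¬-Fin (h ∘ suc) λ p → k λ { zero → p₀ ; (suc i) → p i }

  ¬¬-maximum : ∀ (Q : ℕ → Set) b → Q 0 → (∀ {n} → Q n → n ≤ b) → ¬ ¬ (∃ λ n → Q n × ¬ Q (suc n))
  ¬¬-maximum Q b q₀ bound k = go b 0 q₀ λ {n} q → subst (n ≤_) (sym (+-identityʳ b)) (bound q)
    where
    go : ∀ d n → Q n → (∀ {m} → Q m → m ≤ d + n) → ⊥
    go zero n q bnd = k (n , q , λ q′ → contradiction (bnd q′) (<⇒≱ ≤-refl))
    go (suc d) n q bnd = k (n , q , λ q′ → go d (suc n) q′ λ {m} r → subst (m ≤_) (sym (+-suc d n)) (bnd r))

  lookup-injective : ∀ {A : Set} {xs : List A} → Unique xs → ∀ i j → lookup xs i ≡ lookup xs j → i ≡ j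
  lookup-injective (_ ∷ u) zero    zero    eq = refl
  lookup-injective (x ∷ u) zero    (suc j) eq = contradiction eq (All.lookup x (∈-lookup j))
  lookup-injective (x ∷ u) (suc i) zero    eq = contradiction (sym eq) (All.lookup x (∈-lookup i))
  lookup-injective (_ ∷ u) (suc i) (suc j) eq = cong suc (lookup-injective u i j eq)

  length-⊆ : ∀ {A : Set} {xs ys : List A} → Unique xs → (∀ {x} → x ∈ xs → x ∈ ys) → length xs ≤ length ys
  length-⊆ {xs = xs} {ys} u sub = injective⇒≤ {f = λ i → Any.index (sub (∈-lookup i))} λ {i} {j} eq → lookup-injective u i j
    (trans (lookup-index (sub (∈-lookup i))) (trans (cong (lookup ys) eq) (sym (lookup-index (sub (∈-lookup j))))))

  length-allFin : ∀ n → length (allFin n) ≡ n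
  length-allFin n = length-tabulate {n = n} Function.id

  length-cartesianProductWith : ∀ {A B C : Set} (f : A → B → C) xs ys →
    length (cartesianProductWith f xs ys) ≡ length xs * length ys
  length-cartesianProductWith f []       ys = refl
  length-cartesianProductWith f (x ∷ xs) ys =
    trans (length-++ (map (f x) ys)) (cong₂ _+_ (length-map (f x) ys) (length-cartesianProductWith f xs ys))

  length-filter-¬ : ∀ {A : Set} {P : A → Set} (P? : Decidable P) xs →
    length (filter P? xs) + length (filter (¬? ∘ P?) xs) ≡ length xs
  length-filter-¬ P? [] = refl
  length-filter-¬ P? (x ∷ xs) with P? x
  ... | yes _ = cong suc (length-filter-¬ P? xs)
  ... | no  _ = trans (+-suc _ _) (cong suc (length-filter-¬ P? xs))

  length-concatMap : ∀ {A B : Set} (f : A → List B) {c} xs → (∀ {x} → x ∈ xs → length (f x) ≡ c) →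
    length (concatMap f xs) ≡ length xs * c
  length-concatMap f []       h = refl
  length-concatMap f (x ∷ xs) h =
    trans (length-++ (f x)) (cong₂ _+_ (h (here refl)) (length-concatMap f xs (h ∘ there)))

  allVec : ∀ p m → List (Vec (Fin p) m)
  allVec p zero    = [] ∷ []
  allVec p (suc m) = cartesianProductWith _∷_ (allFin p) (allVec p m)

  length-allVec : ∀ p m → length (allVec p m) ≡ p ^ m
  length-allVec p zero    = refl
  length-allVec p (suc m) = trans (length-cartesianProductWith _∷_ (allFin p) (allVec p m))
    (cong₂ _*_ (length-allFin p) (length-allVec p m))

  unique-allVec : ∀ p m → Unique (allVec p m)
  unique-allVec p zero    = All.[] ∷ []
  unique-allVec p (suc m) =
    Unique.cartesianProductWith⁺ _∷_ ∷-injective (Unique.allFin⁺ p) (unique-allVec p m)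

  ∈-allVec : ∀ {p m} (v : Vec (Fin p) m) → v ∈ allVec p m
  ∈-allVec []      = here refl
  ∈-allVec (x ∷ v) = ∈-cartesianProductWith⁺ _∷_ (∈-allFin x) (∈-allVec v)

  module _ {m k : ℕ} (τ : Fin m → Fin k) (φ : Fin k → Fin k → Fin m → Fin m)
    (φ-fibre : ∀ {a} b {i} → τ i ≡ a → τ (φ a b i) ≡ b)
    (φ-inverse : ∀ a b i → φ b a (φ a b i) ≡ i) where

    -- `φ a b` carries the fibre over `a` into the fibre over `b` and `φ b a` undoes it, so all
    -- fibres have the size of the one over `zero`. For `k = 0` the map `τ` forces `m = 0`.
    equal-fibres⇒∣ : k ∣ m
    equal-fibres⇒∣ = go k refl
      where
      go : ∀ k′ → k′ ≡ k → k ∣ m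
      go zero refl = noFin m refl
        where
        noFin : ∀ m′ → m′ ≡ m → k ∣ m
        noFin zero    refl = divides 0 refl
        noFin (suc _) refl with τ zero
        ... | ()
      go (suc k′) refl = divides (length fibre) (trans m≡ (*-comm k (length fibre)))
        where
        fibre = filter (λ i → τ i Fin.≟ zero) (allFin m)
        τ0 : ∀ {i} → i ∈ fibre → τ i ≡ zero
        τ0 h = proj₂ (∈-filter⁻ (λ i → τ i Fin.≟ zero) {xs = allFin m} h)
        grid : ∀ bs is → (∀ {i} → i ∈ is → τ i ≡ zero) → Unique bs → Unique is →
               Unique (cartesianProductWith (φ zero) bs is)
        grid [] is h u v = []
        grid (b ∷ bs) is h (b∉ ∷ u) v = Unique.++⁺
          (Unique.map⁺ (λ {i} {j} eq → trans (sym (φ-inverse zero b i)) (trans (cong (φ b zero) eq) (φ-inverse zero b j))) v)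
          (grid bs is h u v)
          λ {i} (p , q) → let (j , j∈ , eq) = ∈-map⁻ (φ zero b) p
                              (b′ , j′ , b′∈ , j′∈ , eq′) = ∈-cartesianProductWith⁻ (φ zero) bs is q
                          in All.lookup b∉ b′∈ (trans (sym (φ-fibre b (h j∈))) (trans (cong τ (trans (sym eq) eq′)) (φ-fibre b′ (h j′∈))))
        covers : ∀ i → i ∈ cartesianProductWith (φ zero) (allFin k) fibre
        covers i = subst (_∈ cartesianProductWith (φ zero) (allFin k) fibre) (φ-inverse (τ i) zero i)
          (∈-cartesianProductWith⁺ (φ zero) (∈-allFin (τ i))
            (∈-filter⁺ (λ j → τ j Fin.≟ zero) (∈-allFin _) (φ-fibre zero refl)))
        m≡ : m ≡ k * length fibre
        m≡ = trans (sym (length-allFin m))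
              (trans (≤-antisym
                       (length-⊆ (Unique.allFin⁺ m) (λ {i} _ → covers i))
                       (length-⊆ (grid (allFin k) fibre τ0 (Unique.allFin⁺ k) (Unique.filter⁺ _ (Unique.allFin⁺ m))) (λ {i} _ → ∈-allFin i)))
                (trans (length-cartesianProductWith (φ zero) (allFin k) fibre) (cong (_* length fibre) (length-allFin k))))

  least : ∀ {m} {P : Fin m → Set} → Decidable P → ∃ P → ∃ λ i → P i × (∀ {j} → P j → i Fin.≤ j)
  least {suc m} P? (i , p) with P? zero
  ... | yes p₀ = zero , p₀ , λ _ → z≤n
  least {suc m} P? (zero , p)  | no ¬p₀ = contradiction p ¬p₀
  least {suc m} P? (suc i , p) | no ¬p₀ with least (P? ∘ suc) (i , p)
  ... | j , q , min = suc j , q , λ { {zero} r → contradiction r ¬p₀ ; {suc _} r → s≤s (min r) }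

  module _ (G : Group 0ℓ 0ℓ) where
    open Group G using (Carrier; _≈_; _∙_; ε; _⁻¹; setoid; assoc; ∙-congˡ; ∙-congʳ; inverseˡ; inverseʳ; identityˡ)
      renaming (sym to ≈-sym; trans to ≈-trans)
    open Algebra.Properties.Group G using (⁻¹-anti-homo-∙; ⁻¹-involutive)

    record IsSubgroup (P : Carrier → Set) : Set where
      field
        resp  : ∀ {x y} → x ≈ y → P x → P y
        ε∈    : P ε
        ∙∈    : ∀ {x y} → P x → P y → P (x ∙ y)
        ⁻¹∈   : ∀ {x} → P x → P (x ⁻¹)

    module _ {W H : Carrier → Set} (WS : IsSubgroup W) (HS : IsSubgroup H)
      {m k : ℕ} (act : Carrier → Fin m → Fin m)
      (act-≈ : ∀ {x y} → x ≈ y → ∀ i → act x i ≡ act y i)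
      (act-ε : ∀ i → act ε i ≡ i)
      (act-∙ : ∀ x y i → act (x ∙ y) i ≡ act x (act y i))
      (free : ∀ {x y} i → W x → W y → act x i ≡ act y i → H (x ⁻¹ ∙ y))
      (reps : Fin k → Carrier) (reps∈ : ∀ a → W (reps a))
      (cover : ∀ {x} → W x → ¬ ¬ (∃ λ a → H (reps a ⁻¹ ∙ x)))
      (disjoint : ∀ {a b} → H (reps a ⁻¹ ∙ reps b) → a ≡ b) where

      private
        module W = IsSubgroup WS
        module H = IsSubgroup HS
        open import Relation.Binary.Reasoning.Setoid setoid

        _⟶_ : Fin m → Fin m → Set
        i ⟶ j = ∃ λ x → W x × act x i ≡ j

        ⟶-refl : ∀ i → i ⟶ i
        ⟶-refl i = ε , W.ε∈ , act-ε i

        ⟶-trans : ∀ {i j l} → i ⟶ j → j ⟶ l → i ⟶ l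
        ⟶-trans {i} (x , wx , refl) (y , wy , refl) = y ∙ x , W.∙∈ wy wx , act-∙ y x i

        act-⁻¹ : ∀ x i → act (x ⁻¹) (act x i) ≡ i
        act-⁻¹ x i = trans (sym (act-∙ (x ⁻¹) x i)) (trans (act-≈ (inverseˡ x) i) (act-ε i))

        ⟶-sym : ∀ {i j} → i ⟶ j → j ⟶ i
        ⟶-sym {i} (x , wx , refl) = x ⁻¹ , W.⁻¹∈ wx , act-⁻¹ x i

        cancel-mid : ∀ x y z → (x ∙ y ⁻¹) ∙ (y ∙ z) ≈ x ∙ z
        cancel-mid x y z = begin
          (x ∙ y ⁻¹) ∙ (y ∙ z)  ≈⟨ assoc x (y ⁻¹) (y ∙ z) ⟩
          x ∙ (y ⁻¹ ∙ (y ∙ z))  ≈⟨ ∙-congˡ (≈-sym (assoc (y ⁻¹) y z)) ⟩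
          x ∙ ((y ⁻¹ ∙ y) ∙ z)  ≈⟨ ∙-congˡ (∙-congʳ (inverseˡ y)) ⟩
          x ∙ (ε ∙ z)           ≈⟨ ∙-congˡ (identityˡ z) ⟩
          x ∙ z                 ∎

        module Classes (dec : ∀ i j → Dec (i ⟶ j)) where

          root : ∀ j → ∃ λ i → i ⟶ j × (∀ {l} → l ⟶ j → i Fin.≤ l)
          root j = least (λ i → dec i j) (j , ⟶-refl j)

          root-cong : ∀ {i j} → i ⟶ j → proj₁ (root i) ≡ proj₁ (root j)
          root-cong {i} {j} ij = Fin.≤-antisym
            (proj₂ (proj₂ (root i)) (⟶-trans (proj₁ (proj₂ (root j))) (⟶-sym ij)))
            (proj₂ (proj₂ (root j)) (⟶-trans (proj₁ (proj₂ (root i))) ij))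

          tr : ∀ j → Carrier
          tr j = proj₁ (proj₁ (proj₂ (root j)))
          tr∈ : ∀ j → W (tr j)
          tr∈ j = proj₁ (proj₂ (proj₁ (proj₂ (root j))))
          act-tr : ∀ j → act (tr j) (proj₁ (root j)) ≡ j
          act-tr j = proj₂ (proj₂ (proj₁ (proj₂ (root j))))

          module _ (cls : ∀ j → ∃ λ a → H (reps a ⁻¹ ∙ tr j)) where

            -- Each point is reached by `tr j` from the least point of its orbit. The left coset of
            -- `tr j` modulo `H` labels the point, and translation by representatives permutes the
            -- labels.
            τ : Fin m → Fin k
            τ j = proj₁ (cls j)

            shift : Fin k → Fin k → Carrier
            shift a b = reps b ∙ reps a ⁻¹

            shift∈ : ∀ a b → W (shift a b)
            shift∈ a b = W.∙∈ (reps∈ b) (W.⁻¹∈ (reps∈ a))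

            φ : Fin k → Fin k → Fin m → Fin m
            φ a b = act (shift a b)

            φ-inverse : ∀ a b i → φ b a (φ a b i) ≡ i
            φ-inverse a b i = trans (sym (act-∙ (shift b a) (shift a b) i)) (trans (act-≈ eq i) (act-ε i))
              where
              eq : shift b a ∙ shift a b ≈ ε
              eq = ≈-trans (cancel-mid (reps a) (reps b) (reps a ⁻¹)) (inverseʳ (reps a))

            -- `shift a b ∙ tr i` lies in the coset of `reps b` and takes the common root to
            -- `φ a b i`, as does `tr` of that point. Freeness modulo `H` then puts both elements
            -- into the same left coset.
            φ-fibre : ∀ {a} b {i} → τ i ≡ a → τ (φ a b i) ≡ b
            φ-fibre b {i} refl = sym (disjoint (H.resp eq (H.∙∈ (proj₂ (cls i)) (H.∙∈ (free (proj₁ (root i)) (W.∙∈ (shift∈ a b) (tr∈ i)) (tr∈ j) same) (H.⁻¹∈ (proj₂ (cls j)))))))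
              where
              a = τ i
              j = φ a b i
              same : act (shift a b ∙ tr i) (proj₁ (root i)) ≡ act (tr j) (proj₁ (root i))
              same = trans (act-∙ (shift a b) (tr i) _)
                       (trans (cong (act (shift a b)) (act-tr i))
                         (trans (sym (act-tr j)) (cong (act (tr j)) (sym (root-cong (shift a b , shift∈ a b , refl))))))
              c = reps (τ j)
              inv-eq : (shift a b ∙ tr i) ⁻¹ ≈ tr i ⁻¹ ∙ (reps a ∙ reps b ⁻¹)
              inv-eq = begin
                (shift a b ∙ tr i) ⁻¹                      ≈⟨ ⁻¹-anti-homo-∙ (shift a b) (tr i) ⟩
                tr i ⁻¹ ∙ (reps b ∙ reps a ⁻¹) ⁻¹          ≈⟨ ∙-congˡ (⁻¹-anti-homo-∙ (reps b) (reps a ⁻¹)) ⟩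
                tr i ⁻¹ ∙ ((reps a ⁻¹) ⁻¹ ∙ reps b ⁻¹)     ≈⟨ ∙-congˡ (∙-congʳ (⁻¹-involutive (reps a))) ⟩
                tr i ⁻¹ ∙ (reps a ∙ reps b ⁻¹)             ∎
              tail-eq : (reps b ⁻¹ ∙ tr j) ∙ (c ⁻¹ ∙ tr j) ⁻¹ ≈ reps b ⁻¹ ∙ c
              tail-eq = begin
                (reps b ⁻¹ ∙ tr j) ∙ (c ⁻¹ ∙ tr j) ⁻¹          ≈⟨ ∙-congˡ (⁻¹-anti-homo-∙ (c ⁻¹) (tr j)) ⟩
                (reps b ⁻¹ ∙ tr j) ∙ (tr j ⁻¹ ∙ (c ⁻¹) ⁻¹)     ≈⟨ ∙-congʳ (∙-congˡ (≈-sym (⁻¹-involutive (tr j)))) ⟩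
                (reps b ⁻¹ ∙ (tr j ⁻¹) ⁻¹) ∙ (tr j ⁻¹ ∙ (c ⁻¹) ⁻¹) ≈⟨ cancel-mid (reps b ⁻¹) (tr j ⁻¹) _ ⟩
                reps b ⁻¹ ∙ (c ⁻¹) ⁻¹                          ≈⟨ ∙-congˡ (⁻¹-involutive c) ⟩
                reps b ⁻¹ ∙ c                                  ∎
              head-eq : (reps a ⁻¹ ∙ tr i) ∙ ((shift a b ∙ tr i) ⁻¹ ∙ tr j) ≈ reps b ⁻¹ ∙ tr j
              head-eq = begin
                (reps a ⁻¹ ∙ tr i) ∙ ((shift a b ∙ tr i) ⁻¹ ∙ tr j)             ≈⟨ ∙-congˡ (∙-congʳ inv-eq) ⟩
                (reps a ⁻¹ ∙ tr i) ∙ ((tr i ⁻¹ ∙ (reps a ∙ reps b ⁻¹)) ∙ tr j)  ≈⟨ ∙-congˡ (assoc _ _ _) ⟩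
                (reps a ⁻¹ ∙ tr i) ∙ (tr i ⁻¹ ∙ ((reps a ∙ reps b ⁻¹) ∙ tr j))  ≈⟨ ∙-congʳ (∙-congˡ (≈-sym (⁻¹-involutive (tr i)))) ⟩
                (reps a ⁻¹ ∙ (tr i ⁻¹) ⁻¹) ∙ (tr i ⁻¹ ∙ ((reps a ∙ reps b ⁻¹) ∙ tr j)) ≈⟨ cancel-mid _ (tr i ⁻¹) _ ⟩
                reps a ⁻¹ ∙ ((reps a ∙ reps b ⁻¹) ∙ tr j)                       ≈⟨ ∙-congˡ (assoc _ _ _) ⟩
                reps a ⁻¹ ∙ (reps a ∙ (reps b ⁻¹ ∙ tr j))                       ≈⟨ ≈-sym (assoc _ _ _) ⟩
                (reps a ⁻¹ ∙ reps a) ∙ (reps b ⁻¹ ∙ tr j)                       ≈⟨ ∙-congʳ (inverseˡ (reps a)) ⟩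
                ε ∙ (reps b ⁻¹ ∙ tr j)                                          ≈⟨ identityˡ _ ⟩
                reps b ⁻¹ ∙ tr j                                                ∎
              eq : (reps a ⁻¹ ∙ tr i) ∙ (((shift a b ∙ tr i) ⁻¹ ∙ tr j) ∙ (c ⁻¹ ∙ tr j) ⁻¹) ≈ reps b ⁻¹ ∙ c
              eq = ≈-trans (≈-sym (assoc _ _ _)) (≈-trans (∙-congʳ head-eq) tail-eq)

            k∣m : k ∣ m
            k∣m = equal-fibres⇒∣ τ φ φ-fibre φ-inverse

      -- Lagrange's theorem for an action that is free modulo H, where [W : H] = k.
      index∣ : ¬ ¬ (k ∣ m)
      index∣ no-div = ¬¬-Fin (λ i → ¬¬-Fin (λ j → ¬¬-dec)) λ dec →
        ¬¬-Fin (λ j → cover (Classes.tr∈ dec j)) λ cls → no-div (Classes.k∣m dec cls)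

-- Matrices, closures in the space of matrices, and quotient rings.

module Matrices where

  open import Level using (0ℓ)
  open import Algebra.Bundles using (CommutativeRing; Group)
  import Algebra.Properties.Semiring.Sum
  import Algebra.Properties.Ring
  import Relation.Binary.Reasoning.Setoid
  open import Data.Fin using (Fin; zero; suc)
  open import Data.Nat using (ℕ; zero; suc)
  open import Data.Product using (∃; _×_; _,_)
  open import Relation.Nullary using (¬_)
  open import Defs using (Poly; con; var; eval; _⊕_; _⊛_)

  HasInverses : CommutativeRing 0ℓ 0ℓ → Set
  HasInverses F = ∀ x → ¬ (x ≈ 0#) → ∃ λ y → x * y ≈ 1#
    where open CommutativeRing F

  module RingSolver (R : CommutativeRing 0ℓ 0ℓ) where
    open import Algebra.Solver.Ring.NaturalCoefficients.Default (CommutativeRing.commutativeSemiring R) public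
      using (solve; _:=_; _:+_; _:*_)

  -- A parameter for 0 and 1 rather than for the ring, so that a ring and its quotients share their identity matrix.
  kronecker : ∀ {A : Set} → A → A → ∀ {N} → Fin N → Fin N → A
  kronecker 0# 1# zero    zero    = 1#
  kronecker 0# 1# zero    (suc _) = 0#
  kronecker 0# 1# (suc _) zero    = 0#
  kronecker 0# 1# (suc i) (suc j) = kronecker 0# 1# i j

  module Mat (R : CommutativeRing 0ℓ 0ℓ) where
    open CommutativeRing R hiding (zero)
    open Algebra.Properties.Semiring.Sum semiring using (sum; sum-cong-≋; ∑-comm; *-distribˡ-sum; *-distribʳ-sum; sum-replicate-zero)
    open Relation.Binary.Reasoning.Setoid setoid

    Mat : ℕ → Set
    Mat N = Fin N → Fin N → Carrier

    infix 4 _≋_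
    _≋_ : ∀ {N} → Mat N → Mat N → Set
    A ≋ B = ∀ i j → A i j ≈ B i j

    infixl 7 _·_
    _·_ : ∀ {N} → Mat N → Mat N → Mat N
    (A · B) i j = sum λ k → A i k * B k j

    δ : ∀ {N} → Fin N → Fin N → Carrier
    δ = kronecker 0# 1#

    I : ∀ {N} → Mat N
    I = δ

    sum-0 : ∀ {n} {f : Fin n → Carrier} → (∀ i → f i ≈ 0#) → sum f ≈ 0#
    sum-0 {n} h = trans (sum-cong-≋ h) (sum-replicate-zero n)

    sum-δˡ : ∀ {n} (i : Fin n) f → sum (λ k → δ i k * f k) ≈ f i
    sum-δˡ zero f = trans (+-cong (*-identityˡ _) (sum-0 λ k → zeroˡ (f (suc k)))) (+-identityʳ _)
    sum-δˡ (suc i) f = trans (+-cong (zeroˡ _) (sum-δˡ i λ k → f (suc k))) (+-identityˡ _)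

    sum-δʳ : ∀ {n} (j : Fin n) f → sum (λ k → f k * δ k j) ≈ f j
    sum-δʳ zero f = trans (+-cong (*-identityʳ _) (sum-0 λ k → zeroʳ (f (suc k)))) (+-identityʳ _)
    sum-δʳ (suc j) f = trans (+-cong (zeroʳ _) (sum-δʳ j λ k → f (suc k))) (+-identityˡ _)

    apply : ∀ {N} → Mat N → (Fin N → Carrier) → Fin N → Carrier
    apply A v i = sum λ k → A i k * v k

    apply-cong : ∀ {N} {A B : Mat N} {v w} → A ≋ B → (∀ k → v k ≈ w k) → ∀ i → apply A v i ≈ apply B w i
    apply-cong AB vw i = sum-cong-≋ λ k → *-cong (AB i k) (vw k)

    apply-· : ∀ {N} (A B : Mat N) v i → apply (A · B) v i ≈ apply A (apply B v) i
    apply-· A B v i = begin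
      sum (λ k → sum (λ l → A i l * B l k) * v k)      ≈⟨ sum-cong-≋ (λ k → *-distribʳ-sum (v k) (λ l → A i l * B l k)) ⟩
      sum (λ k → sum (λ l → (A i l * B l k) * v k))    ≈⟨ ∑-comm (λ k l → (A i l * B l k) * v k) ⟩
      sum (λ l → sum (λ k → (A i l * B l k) * v k))    ≈⟨ sum-cong-≋ (λ l → sum-cong-≋ (λ k → *-assoc (A i l) (B l k) (v k))) ⟩
      sum (λ l → sum (λ k → A i l * (B l k * v k)))    ≈⟨ sum-cong-≋ (λ l → *-distribˡ-sum (A i l) (λ k → B l k * v k)) ⟨
      sum (λ l → A i l * sum (λ k → B l k * v k))      ∎

    apply-I : ∀ {N} v (i : Fin N) → apply I v i ≈ v i
    apply-I v i = sum-δˡ i v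

    ·-cong : ∀ {N} {A B C D : Mat N} → A ≋ B → C ≋ D → A · C ≋ B · D
    ·-cong AB CD i j = sum-cong-≋ λ k → *-cong (AB i k) (CD k j)

    ·-assoc : ∀ {N} (A B C : Mat N) → (A · B) · C ≋ A · (B · C)
    ·-assoc A B C i j = apply-· A B (λ k → C k j) i

    ·-identityˡ : ∀ {N} (A : Mat N) → I · A ≋ A
    ·-identityˡ A i j = sum-δˡ i λ k → A k j

    ·-identityʳ : ∀ {N} (A : Mat N) → A · I ≋ A
    ·-identityʳ A i j = sum-δʳ j (A i)

    ≋-refl : ∀ {N} {A : Mat N} → A ≋ A
    ≋-refl i j = refl
    ≋-sym : ∀ {N} {A B : Mat N} → A ≋ B → B ≋ A
    ≋-sym h i j = sym (h i j)
    ≋-trans : ∀ {N} {A B C : Mat N} → A ≋ B → B ≋ C → A ≋ C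
    ≋-trans h g i j = trans (h i j) (g i j)

    -- An element carries its inverse, so that passing to a quotient or to a subring only moves two
    -- matrices. Equality in `GL-group` compares `mat` alone, which determines `imat`.
    record GL (N : ℕ) : Set where
      constructor gl
      field
        mat   : Mat N
        imat  : Mat N
        right : mat · imat ≋ I
        left  : imat · mat ≋ I
    open GL public

    private
      inv-· : ∀ {N} (A A′ B B′ : Mat N) → A · A′ ≋ I → B · B′ ≋ I → (A · B) · (B′ · A′) ≋ I
      inv-· A A′ B B′ a b = ≋-trans (·-assoc A B (B′ · A′)) (≋-trans (·-cong (≋-refl {A = A})
        (≋-trans (≋-sym (·-assoc B B′ A′)) (≋-trans (·-cong b (≋-refl {A = A′})) (·-identityˡ A′)))) a)

    GL-group : ℕ → Group 0ℓ 0ℓ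
    GL-group N = record
      { Carrier = GL N
      ; _≈_ = λ x y → mat x ≋ mat y
      ; _∙_ = λ x y → gl (mat x · mat y) (imat y · imat x)
                         (inv-· (mat x) (imat x) (mat y) (imat y) (right x) (right y))
                         (inv-· (imat y) (mat y) (imat x) (mat x) (left y) (left x))
      ; ε = gl I I (·-identityˡ I) (·-identityˡ I)
      ; _⁻¹ = λ x → gl (imat x) (mat x) (left x) (right x)
      ; isGroup = record
        { isMonoid = record
          { isSemigroup = record
            { isMagma = record
              { isEquivalence = record { refl = ≋-refl ; sym = ≋-sym ; trans = ≋-trans }
              ; ∙-cong = ·-cong
              }
            ; assoc = λ x y z → ·-assoc (mat x) (mat y) (mat z)
            }
          ; identity = (λ x → ·-identityˡ (mat x)) , (λ x → ·-identityʳ (mat x))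
          }
        ; inverse = left , right
        ; ⁻¹-cong = λ {x} {y} xy → unique (mat x) (imat x) (mat y) (imat y) xy (left x) (right y)
        }
      }
      where
      unique : ∀ (A A′ B B′ : Mat N) → A ≋ B → A′ · A ≋ I → B · B′ ≋ I → A′ ≋ B′
      unique A A′ B B′ ab a b =
        ≋-trans (≋-sym (·-identityʳ A′)) (≋-trans (·-cong (≋-refl {A = A′}) (≋-sym b))
          (≋-trans (≋-sym (·-assoc A′ B B′)) (≋-trans (·-cong (≋-trans (·-cong (≋-refl {A = A′}) (≋-sym ab)) a) (≋-refl {A = B′}))
            (·-identityˡ B′))))

    MatPoly : ℕ → Set
    MatPoly N = Poly R (Fin N × Fin N)

    ev : ∀ {N} → MatPoly N → Mat N → Carrier
    ev f A = eval R f λ (i , j) → A i j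

    eval-cong : ∀ {V} (f : Poly R V) {x y : V → Carrier} → (∀ v → x v ≈ y v) → eval R f x ≈ eval R f y
    eval-cong (con c) h = refl
    eval-cong (var v) h = h v
    eval-cong (f ⊕ g) h = +-cong (eval-cong f h) (eval-cong g h)
    eval-cong (f ⊛ g) h = *-cong (eval-cong f h) (eval-cong g h)

    ev-cong : ∀ {N} (f : MatPoly N) {A B : Mat N} → A ≋ B → ev f A ≈ ev f B
    ev-cong f h = eval-cong f λ (i , j) → h i j

    subP : ∀ {V W} → Poly R V → (V → Poly R W) → Poly R W
    subP (con c) σ = con c
    subP (var v) σ = σ v
    subP (f ⊕ g) σ = subP f σ ⊕ subP g σ
    subP (f ⊛ g) σ = subP f σ ⊛ subP g σ

    eval-subP : ∀ {V W} (f : Poly R V) (σ : V → Poly R W) x → eval R (subP f σ) x ≈ eval R f λ v → eval R (σ v) x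
    eval-subP (con c) σ x = refl
    eval-subP (var v) σ x = refl
    eval-subP (f ⊕ g) σ x = +-cong (eval-subP f σ x) (eval-subP g σ x)
    eval-subP (f ⊛ g) σ x = *-cong (eval-subP f σ x) (eval-subP g σ x)

    sumP : ∀ {V n} → (Fin n → Poly R V) → Poly R V
    sumP {n = zero}  f = con 0#
    sumP {n = suc n} f = f zero ⊕ sumP λ i → f (suc i)

    eval-sumP : ∀ {V n} (f : Fin n → Poly R V) x → eval R (sumP f) x ≈ sum λ i → eval R (f i) x
    eval-sumP {n = zero}  f x = refl
    eval-sumP {n = suc n} f x = +-congˡ (eval-sumP (λ i → f (suc i)) x)

    left-translate right-translate : ∀ {N} → Mat N → MatPoly N → MatPoly N
    left-translate  A f = subP f λ (i , j) → sumP λ k → con (A i k) ⊛ var (k , j)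
    right-translate A f = subP f λ (i , j) → sumP λ k → var (i , k) ⊛ con (A k j)

    ev-left-translate : ∀ {N} (A B : Mat N) f → ev (left-translate A f) B ≈ ev f (A · B)
    ev-left-translate A B f = trans (eval-subP f _ _)
      (eval-cong f λ (i , j) → eval-sumP (λ k → con (A i k) ⊛ var (k , j)) λ (i , j) → B i j)

    ev-right-translate : ∀ {N} (A B : Mat N) f → ev (right-translate A f) B ≈ ev f (B · A)
    ev-right-translate A B f = trans (eval-subP f _ _)
      (eval-cong f λ (i , j) → eval-sumP (λ k → var (i , k) ⊛ con (A k j)) λ (i , j) → B i j)

    Closure : ∀ {N} → (Mat N → Set) → Mat N → Set
    Closure P x = ∀ f → (∀ y → P y → ev f y ≈ 0#) → ev f x ≈ 0#

    Closure-resp : ∀ {N} {P : Mat N → Set} {x y} → x ≋ y → Closure P x → Closure P y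
    Closure-resp xy c f h = trans (sym (ev-cong f xy)) (c f h)

    Closure-mono : ∀ {N} {P Q : Mat N → Set} → (∀ {x} → P x → Closure Q x) → ∀ {x} → Closure P x → Closure Q x
    Closure-mono sub c f h = c f λ y p → sub p f h

    -- The translates of a polynomial vanishing on P by elements of P vanish on P.
    Closure-· : ∀ {N} {P : Mat N → Set} → (∀ {x y} → P x → P y → P (x · y)) →
                ∀ {x y} → Closure P x → Closure P y → Closure P (x · y)
    Closure-· {P = P} mul {x} {y} cx cy f h =
      trans (sym (ev-right-translate y x f)) (cx (right-translate y f) λ u pu →
        trans (ev-right-translate y u f) (trans (sym (ev-left-translate u y f)) (cy (left-translate u f) λ v pv →
          trans (ev-left-translate u v f) (h (u · v) (mul pu pv)))))

  module Quotient (R : CommutativeRing 0ℓ 0ℓ) where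
    open CommutativeRing R hiding (zero)
    open Algebra.Properties.Ring ring
    open RingSolver R
    open Relation.Binary.Reasoning.Setoid setoid

    infix 4 _≡_[_]
    _≡_[_] : Carrier → Carrier → Carrier → Set
    x ≡ y [ m ] = ∃ λ c → x ≈ y + m * c

    ≡[]-reflexive : ∀ {m x y} → x ≈ y → x ≡ y [ m ]
    ≡[]-reflexive {m} {x} {y} h = 0# , trans h (sym (trans (+-congˡ (zeroʳ m)) (+-identityʳ y)))

    private
      ≡[]-sym : ∀ {m x y} → x ≡ y [ m ] → y ≡ x [ m ]
      ≡[]-sym {m} {x} {y} (c , h) = - c , (begin
        y                        ≈⟨ +-identityʳ y ⟨
        y + 0#                   ≈⟨ +-congˡ (trans (sym (zeroʳ m)) (*-congˡ (sym (-‿inverseʳ c)))) ⟩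
        y + m * (c + - c)        ≈⟨ solve 4 (λ y m c d → (y :+ m :* (c :+ d)) := ((y :+ m :* c) :+ m :* d)) refl y m c (- c) ⟩
        (y + m * c) + m * - c    ≈⟨ +-congʳ h ⟨
        x + m * - c              ∎)

      ≡[]-trans : ∀ {m x y z} → x ≡ y [ m ] → y ≡ z [ m ] → x ≡ z [ m ]
      ≡[]-trans {m} {z = z} (c , h) (d , g) = d + c , trans h (trans (+-congʳ g)
        (solve 4 (λ z m c d → ((z :+ m :* d) :+ m :* c) := (z :+ m :* (d :+ c))) refl z m c d))

      ≡[]-+ : ∀ {m x y u v} → x ≡ y [ m ] → u ≡ v [ m ] → x + u ≡ y + v [ m ]
      ≡[]-+ {m} {y = y} {v = v} (c , h) (d , g) = c + d , trans (+-cong h g)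
        (solve 5 (λ y v m c d → ((y :+ m :* c) :+ (v :+ m :* d)) := ((y :+ v) :+ m :* (c :+ d))) refl y v m c d)

      ≡[]-* : ∀ {m x y u v} → x ≡ y [ m ] → u ≡ v [ m ] → x * u ≡ y * v [ m ]
      ≡[]-* {m} {y = y} {v = v} (c , h) (d , g) = y * d + c * v + m * c * d , trans (*-cong h g)
        (solve 5 (λ y v m c d → ((y :+ m :* c) :* (v :+ m :* d)) := ((y :* v) :+ m :* ((y :* d) :+ (c :* v) :+ (m :* c :* d)))) refl y v m c d)

      ≡[]-neg : ∀ {m x y} → x ≡ y [ m ] → - x ≡ - y [ m ]
      ≡[]-neg {m} {x} {y} (c , h) = - c , trans (-‿cong h) (trans (sym (-‿+-comm y (m * c))) (+-congˡ (-‿distribʳ-* m c)))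

    -- The carrier is kept and only equality is coarsened: a matrix over the ring is literally a
    -- matrix over each quotient, and reduction is the identity on data.
    quotient : Carrier → CommutativeRing 0ℓ 0ℓ
    quotient m = record
      { Carrier = Carrier ; _≈_ = λ x y → x ≡ y [ m ]
      ; _+_ = _+_ ; _*_ = _*_ ; -_ = -_ ; 0# = 0# ; 1# = 1#
      ; isCommutativeRing = record
        { isRing = record
          { +-isAbelianGroup = record
            { isGroup = record
              { isMonoid = record
                { isSemigroup = record
                  { isMagma = record
                    { isEquivalence = record { refl = ≡[]-reflexive refl ; sym = ≡[]-sym ; trans = ≡[]-trans }
                    ; ∙-cong = ≡[]-+
                    }
                  ; assoc = λ x y z → ≡[]-reflexive (+-assoc x y z)
                  }
                ; identity = (λ x → ≡[]-reflexive (+-identityˡ x)) , (λ x → ≡[]-reflexive (+-identityʳ x))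
                }
              ; inverse = (λ x → ≡[]-reflexive (-‿inverseˡ x)) , (λ x → ≡[]-reflexive (-‿inverseʳ x))
              ; ⁻¹-cong = ≡[]-neg
              }
            ; comm = λ x y → ≡[]-reflexive (+-comm x y)
            }
          ; *-cong = ≡[]-*
          ; *-assoc = λ x y z → ≡[]-reflexive (*-assoc x y z)
          ; *-identity = (λ x → ≡[]-reflexive (*-identityˡ x)) , (λ x → ≡[]-reflexive (*-identityʳ x))
          ; distrib = (λ x y z → ≡[]-reflexive (distribˡ x y z)) , (λ x y z → ≡[]-reflexive (distribʳ x y z))
          }
        ; *-comm = λ x y → ≡[]-reflexive (*-comm x y)
        }
      }

-- Independent tuples over a finite field, and the action of GL_N on bases.

module FieldTuples where

  open import Level using (0ℓ)
  open import Algebra.Bundles using (CommutativeRing; Group)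
  import Algebra.Properties.Semiring.Sum
  import Algebra.Properties.Ring
  import Relation.Binary.Reasoning.Setoid
  open import Data.Fin as Fin using (Fin; zero; suc)
  open import Data.List as List using (List; []; _∷_; length; filter; concatMap)
  open import Data.List.Properties using (length-map)
  open import Data.List.Membership.Propositional using (_∈_; find; lose)
  open import Data.List.Membership.Propositional.Properties
    using (∈-lookup; ∈-map⁺; ∈-map⁻; ∈-filter⁺; ∈-filter⁻; ∈-concatMap⁺; ∈-concatMap⁻)
  open import Data.List.Relation.Unary.All as All using (All)
  import Data.List.Relation.Unary.All.Properties as All
  open import Data.List.Relation.Unary.AllPairs as AllPairs using ([]; _∷_)
  import Data.List.Relation.Unary.AllPairs.Properties as AllPairs
  open import Data.List.Relation.Unary.Any as Any using (here)
  open import Data.List.Relation.Unary.Any.Properties using (lookup-index)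
  open import Data.List.Relation.Unary.Unique.Propositional using (Unique)
  import Data.List.Relation.Unary.Unique.Propositional.Properties as Unique
  open import Data.Nat as ℕ using (ℕ; zero; suc; _≤_; _^_; _∸_)
  import Data.Nat.Properties as ℕ
  open import Data.Product using (∃; _,_; proj₁; proj₂)
  open import Data.Sum using (_⊎_; inj₁; inj₂)
  open import Data.Vec as Vec using (Vec; []; _∷_; lookup; tabulate)
  open import Data.Vec.Properties using (map-cong; map-id; map-∘; lookup∘tabulate; tabulate-cong; tabulate∘lookup; ∷-injectiveˡ; ∷-injectiveʳ; ≡-dec)
  open import Function using (_∘_)
  open import Relation.Binary.PropositionalEquality as ≡ using (_≡_; cong; cong₂; subst)
  open import Relation.Nullary using (¬_; Dec; yes; no; contradiction; ¬?)
  open import Relation.Nullary.Decidable using (map′)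
  open Arithmetic using (tupleCount)
  open FiniteSets
  open Matrices using (HasInverses; module RingSolver; module Mat)

  module FiniteField (F : CommutativeRing 0ℓ 0ℓ)
    (p : ℕ) (rep : Fin p → CommutativeRing.Carrier F) (cls : CommutativeRing.Carrier F → Fin p)
    (rep-cls : ∀ x → CommutativeRing._≈_ F (rep (cls x)) x)
    (cls-cong : ∀ {x y} → CommutativeRing._≈_ F x y → cls x ≡ cls y)
    (cls-rep : ∀ i → cls (rep i) ≡ i) (inverse : HasInverses F) (2≤p : 2 ≤ p) where

    open CommutativeRing F hiding (zero)
    open Algebra.Properties.Ring ring
    open RingSolver F
    open Relation.Binary.Reasoning.Setoid setoid

    Vector : ℕ → Set
    Vector M = Fin M → Carrier

    infix 4 _≈ᵛ_
    _≈ᵛ_ : ∀ {M} → Vector M → Vector M → Set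
    v ≈ᵛ w = ∀ k → v k ≈ w k

    comb : ∀ {M m} → Vec (Fin p) m → Vec (Vector M) m → Vector M
    comb []       []       k = 0#
    comb (c ∷ cs) (v ∷ vs) k = rep c * v k + comb cs vs k

    -- Independence is injectivity of `comb`: in this form the `p ^ m` combinations are distinct at
    -- once, and the statements about dimension reduce to counting them.
    Indep : ∀ {M m} → Vec (Vector M) m → Set
    Indep vs = ∀ c d → comb c vs ≈ᵛ comb d vs → c ≡ d

    indep-[] : ∀ {M} → Indep {M} []
    indep-[] [] [] _ = ≡.refl

    InSpan : ∀ {M m} → Vec (Vector M) m → Vector M → Set
    InSpan vs v = ∃ λ c → comb c vs ≈ᵛ v

    canon : ∀ {M} → Vector M → Vec (Fin p) M
    canon v = tabulate (cls ∘ v)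

    real : ∀ {M} → Vec (Fin p) M → Vector M
    real c k = rep (lookup c k)

    real-canon : ∀ {M} (v : Vector M) → real (canon v) ≈ᵛ v
    real-canon v k = trans (reflexive (cong rep (lookup∘tabulate (cls ∘ v) k))) (rep-cls (v k))

    canon-cong : ∀ {M} {v w : Vector M} → v ≈ᵛ w → canon v ≡ canon w
    canon-cong h = tabulate-cong (cls-cong ∘ h)

    canon-real : ∀ {M} (c : Vec (Fin p) M) → canon (real c) ≡ c
    canon-real c = ≡.trans (tabulate-cong λ k → cls-rep (lookup c k)) (tabulate∘lookup c)

    canon-injective : ∀ {M} {v w : Vector M} → canon v ≡ canon w → v ≈ᵛ w
    canon-injective {v = v} {w} eq k =
      trans (sym (real-canon v k)) (trans (reflexive (cong (λ c → real c k) eq)) (real-canon w k))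

    inSpan? : ∀ {M m} (vs : Vec (Vector M) m) v → Dec (InSpan vs v)
    inSpan? {m = m} vs v = map′ (λ a → let (c , e) = Any.satisfied a in c , canon-injective e) (λ (c , h) → lose (∈-allVec c) (canon-cong h))
      (Any.any? (λ c → ≡-dec Fin._≟_ (canon (comb c vs)) (canon v)) (allVec p m))

    comb-affine : ∀ {M m} y (c d : Vec (Fin p) m) (vs : Vec (Vector M) m) k →
      comb (Vec.zipWith (λ c d → cls (y * (rep d + - rep c))) c d) vs k ≈ y * (comb d vs k + - comb c vs k)
    comb-affine y [] [] [] k = sym (trans (*-congˡ (-‿inverseʳ 0#)) (zeroʳ y))
    comb-affine y (c ∷ cs) (d ∷ ds) (v ∷ vs) k = begin
      rep (cls (y * (rep d + - rep c))) * v k + comb (Vec.zipWith (λ c d → cls (y * (rep d + - rep c))) cs ds) vs k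
        ≈⟨ +-cong (*-congʳ (rep-cls _)) (comb-affine y cs ds vs k) ⟩
      y * (rep d + - rep c) * v k + y * (comb ds vs k + - comb cs vs k)
        ≈⟨ solve 6 (λ y d c v s t → (y :* (d :+ c) :* v :+ y :* (s :+ t)) := (y :* ((d :* v :+ s) :+ (c :* v :+ t)))) refl y (rep d) (- rep c) (v k) (comb ds vs k) (- comb cs vs k) ⟩
      y * ((rep d * v k + comb ds vs k) + (- rep c * v k + - comb cs vs k))
        ≈⟨ *-congˡ (+-congˡ (trans (+-congʳ (sym (-‿distribˡ-* (rep c) (v k)))) (-‿+-comm (rep c * v k) (comb cs vs k)))) ⟩
      y * ((rep d * v k + comb ds vs k) + - (rep c * v k + comb cs vs k)) ∎

    -- Two equal combinations with different coefficients at `v` can be solved for `v` after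
    -- division by the difference of these coefficients, which would put `v` into the span. With
    -- equal coefficients the term of `v` cancels.
    indep-∷ : ∀ {M m} (vs : Vec (Vector M) m) v → Indep vs → ¬ InSpan vs v → Indep (v ∷ vs)
    indep-∷ vs v ind v∉ (c ∷ cs) (d ∷ ds) h with c Fin.≟ d
    ... | yes ≡.refl = cong (c ∷_) (ind cs ds λ k → +-cancelˡ (rep c * v k) _ _ (h k))
    ... | no c≢d = contradiction
      (Vec.zipWith (λ c d → cls (y * (rep d + - rep c))) cs ds , λ k → trans (comb-affine y cs ds vs k) (v≈ k)) v∉
      where
      x = rep c + - rep d
      x≉0 : ¬ (x ≈ 0#)
      x≉0 eq = c≢d (≡.trans (≡.sym (cls-rep c)) (≡.trans (cls-cong (x∙y⁻¹≈ε⇒x≈y (rep c) (rep d) eq)) (cls-rep d)))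
      inv = inverse x x≉0
      y = proj₁ inv
      v≈ : ∀ k → y * (comb ds vs k + - comb cs vs k) ≈ v k
      v≈ k = begin
        y * (D + - C)                                  ≈⟨ *-congˡ (+-identityˡ _) ⟨
        y * (0# + (D + - C))                           ≈⟨ *-congˡ (+-congʳ (sym (-‿inverseˡ dv))) ⟩
        y * ((- dv + dv) + (D + - C))                  ≈⟨ *-congˡ (solve 4 (λ a b D C → ((a :+ b) :+ (D :+ C)) := ((b :+ D) :+ (a :+ C))) refl (- dv) dv D (- C)) ⟩
        y * ((dv + D) + (- dv + - C))                  ≈⟨ *-congˡ (+-congʳ (h k)) ⟨
        y * ((cv + C) + (- dv + - C))                  ≈⟨ *-congˡ (solve 4 (λ a b C E → ((a :+ C) :+ (b :+ E)) := ((a :+ b) :+ (C :+ E))) refl cv (- dv) C (- C)) ⟩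
        y * ((cv + - dv) + (C + - C))                  ≈⟨ *-congˡ (trans (+-congˡ (-‿inverseʳ C)) (+-identityʳ _)) ⟩
        y * (cv + - dv)                                ≈⟨ *-congˡ (+-congˡ (-‿distribˡ-* (rep d) (v k))) ⟩
        y * (rep c * v k + - rep d * v k)              ≈⟨ solve 4 (λ y c d v → (y :* (c :* v :+ d :* v)) := (((c :+ d) :* y) :* v)) refl y (rep c) (- rep d) (v k) ⟩
        (x * y) * v k                                  ≈⟨ *-congʳ (proj₂ inv) ⟩
        1# * v k                                       ≈⟨ *-identityˡ (v k) ⟩
        v k                                            ∎
        where
        D = comb ds vs k
        C = comb cs vs k
        cv = rep c * v k
        dv = rep d * v k

    span-or-extend : ∀ {M m} (vs : Vec (Vector M) m) v → Indep vs → InSpan vs v ⊎ Indep (v ∷ vs)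
    span-or-extend vs v ind with inSpan? vs v
    ... | yes s = inj₁ s
    ... | no ¬s = inj₂ (indep-∷ vs v ind ¬s)

    combs : ∀ {M m} → Vec (Vector M) m → List (Vec (Fin p) M)
    combs {m = m} vs = List.map (λ c → canon (comb c vs)) (allVec p m)

    unique-combs : ∀ {M m} (vs : Vec (Vector M) m) → Indep vs → Unique (combs vs)
    unique-combs {m = m} vs ind = Unique.map⁺ (λ {c} {d} eq → ind c d (canon-injective eq)) (unique-allVec p m)

    length-combs : ∀ {M m} (vs : Vec (Vector M) m) → length (combs vs) ≡ p ^ m
    length-combs {m = m} vs = ≡.trans (length-map _ (allVec p m)) (length-allVec p m)

    indep⇒≤ : ∀ {M m} (vs : Vec (Vector M) m) → Indep vs → m ≤ M
    indep⇒≤ {M} {m} vs ind = ℕ.≮⇒≥ λ M<m → ℕ.<⇒≱ (ℕ.^-monoʳ-< p 2≤p M<m)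
      (ℕ.≤-trans (ℕ.≤-reflexive (≡.sym (length-combs vs)))
        (ℕ.≤-trans (length-⊆ (unique-combs vs ind) (λ {x} _ → ∈-allVec x)) (ℕ.≤-reflexive (length-allVec p M))))

    basis-spans : ∀ {M} (vs : Vec (Vector M) M) → Indep vs → ∀ v → InSpan vs v
    basis-spans vs ind v with span-or-extend vs v ind
    ... | inj₁ s = s
    ... | inj₂ ind′ = contradiction (indep⇒≤ (v ∷ vs) ind′) ℕ.1+n≰n

    Ind : ∀ {M m} → Vec (Vec (Fin p) M) m → Set
    Ind vs = Indep (Vec.map real vs)

    module _ {M : ℕ} where

      outside? : ∀ {m} (vs : Vec (Vec (Fin p) M) m) v → Dec (¬ InSpan (Vec.map real vs) (real v))
      outside? vs v = ¬? (inSpan? (Vec.map real vs) (real v))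

      extensions : ∀ {m} → Vec (Vec (Fin p) M) m → List (Vec (Vec (Fin p) M) (suc m))
      extensions vs = List.map (_∷ vs) (filter (outside? vs) (allVec p M))

      -- Vectors are stored by representatives in `Fin p`, so that membership and uniqueness in
      -- lists concern propositional equality. Prolonging an independent tuple of length `m` leaves
      -- `p ^ M ∸ p ^ m` choices, one factor of `tupleCount`.
      tuples : ∀ m → List (Vec (Vec (Fin p) M) m)
      tuples zero    = [] ∷ []
      tuples (suc m) = concatMap extensions (tuples m)

      tuples-sound : ∀ m {vs} → vs ∈ tuples m → Ind vs
      tuples-sound zero    (here ≡.refl) [] [] _ = ≡.refl
      tuples-sound (suc m) vs∈ with find (∈-concatMap⁻ extensions {xs = tuples m} vs∈)
      ... | ws , ws∈ , h with ∈-map⁻ (_∷ ws) h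
      ...   | v , v∈ , ≡.refl = indep-∷ _ _ (tuples-sound m ws∈) (proj₂ (∈-filter⁻ (outside? ws) {xs = allVec p M} v∈))

      tuples-complete : ∀ m (vs : Vec (Vec (Fin p) M) m) → Ind vs → vs ∈ tuples m
      tuples-complete zero [] _ = here ≡.refl
      tuples-complete (suc m) (v ∷ vs) ind =
        ∈-concatMap⁺ extensions (lose (tuples-complete m vs ind-vs)
          (∈-map⁺ (_∷ vs) (∈-filter⁺ (outside? vs) (∈-allVec v) v∉)))
        where
        0̂ = cls 0#
        1̂ = cls 1#
        zero-head : ∀ c k → comb (0̂ ∷ c) (Vec.map real (v ∷ vs)) k ≈ comb c (Vec.map real vs) k
        zero-head c k = trans (+-congʳ (trans (*-congʳ (rep-cls 0#)) (zeroˡ _))) (+-identityˡ _)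
        ind-vs : Ind vs
        ind-vs c d h = ∷-injectiveʳ (ind (0̂ ∷ c) (0̂ ∷ d) λ k → trans (zero-head c k) (trans (h k) (sym (zero-head d k))))
        zero-comb : ∀ {m} (ws : Vec (Vector M) m) k → comb (Vec.replicate m 0̂) ws k ≈ 0#
        zero-comb []       k = refl
        zero-comb (w ∷ ws) k = trans (+-cong (trans (*-congʳ (rep-cls 0#)) (zeroˡ _)) (zero-comb ws k)) (+-identityˡ 0#)
        -- Nontriviality of the field comes from `2 ≤ p`: if 1 and 0 had the same class, all
        -- elements would be equal and `cls-rep` would identify the first two elements of `Fin p`.
        1≉0 : ¬ 1̂ ≡ 0̂
        1≉0 eq = absurd 2≤p
          where
          all-zero : ∀ x → x ≈ 0#
          all-zero x = trans (sym (*-identityˡ x)) (trans (*-congʳ (trans (sym (rep-cls 1#)) (trans (reflexive (cong rep eq)) (rep-cls 0#)))) (zeroˡ x))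
          absurd : 2 ≤ p → _
          absurd le with ≡.trans (≡.sym (cls-rep (Fin.fromℕ< {0} (ℕ.≤-trans (ℕ.s≤s ℕ.z≤n) le)))) (≡.trans (cls-cong (trans (all-zero _) (sym (all-zero _)))) (cls-rep (Fin.fromℕ< {1} le)))
          ... | e = contradiction (≡.trans (≡.sym (toℕ-fromℕ< _)) (≡.trans (cong Fin.toℕ e) (toℕ-fromℕ< _))) λ ()
            where open import Data.Fin.Properties using (toℕ-fromℕ<)
        v∉ : ¬ InSpan (Vec.map real vs) (real v)
        v∉ (c , h) = 1≉0 (∷-injectiveˡ (ind (1̂ ∷ Vec.replicate m 0̂) (0̂ ∷ c) λ k → begin
          rep 1̂ * real v k + comb (Vec.replicate m 0̂) (Vec.map real vs) k  ≈⟨ +-cong (trans (*-congʳ (rep-cls 1#)) (*-identityˡ _)) (zero-comb (Vec.map real vs) k) ⟩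
          real v k + 0#                                                    ≈⟨ +-identityʳ _ ⟩
          real v k                                                         ≈⟨ h k ⟨
          comb c (Vec.map real vs) k                                       ≈⟨ zero-head c k ⟨
          comb (0̂ ∷ c) (Vec.map real (v ∷ vs)) k                           ∎))

      unique-tuples : ∀ m → Unique (tuples m)
      unique-tuples zero    = All.[] ∷ []
      unique-tuples (suc m) = Unique.concat⁺
        (All.map⁺ (All.universal (λ vs → Unique.map⁺ ∷-injectiveˡ (Unique.filter⁺ (outside? vs) (unique-allVec p M))) (tuples m)))
        (AllPairs.map⁺ (AllPairs.map (λ {vs} {ws} vs≢ws {x} (a , b) →
          let (_ , _ , e) = ∈-map⁻ (_∷ vs) a ; (_ , _ , e′) = ∈-map⁻ (_∷ ws) b
          in vs≢ws (∷-injectiveʳ (≡.trans (≡.sym e) e′))) (unique-tuples m)))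

      length-outside : ∀ {m} (vs : Vec (Vec (Fin p) M) m) → Ind vs →
                       length (filter (outside? vs) (allVec p M)) ≡ p ^ M ∸ p ^ m
      length-outside {m} vs ind = ≡.trans (≡.sym (ℕ.m+n∸m≡n (length inside) _))
        (cong₂ _∸_ (≡.trans (length-filter-¬ (λ v → inSpan? rvs (real v)) (allVec p M)) (length-allVec p M)) inside≡)
        where
        rvs = Vec.map real vs
        inside = filter (λ v → inSpan? rvs (real v)) (allVec p M)
        inside≡ : length inside ≡ p ^ m
        inside≡ = ≡.trans (ℕ.≤-antisym
          (length-⊆ (Unique.filter⁺ _ (unique-allVec p M)) λ {v} v∈ →
            let (c , h) = proj₂ (∈-filter⁻ (λ v → inSpan? rvs (real v)) {xs = allVec p M} v∈)
            in subst (_∈ combs rvs) (≡.trans (canon-cong h) (canon-real v)) (∈-map⁺ _ (∈-allVec c)))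
          (length-⊆ (unique-combs rvs ind) λ {v} v∈ →
            let (c , _ , e) = ∈-map⁻ _ v∈
            in ∈-filter⁺ _ (∈-allVec v) (c , λ k → trans (sym (real-canon _ k)) (reflexive (cong (λ u → real u k) (≡.sym e))))))
          (length-combs rvs)

      length-tuples : ∀ m → length (tuples m) ≡ tupleCount p M m
      length-tuples zero    = ≡.refl
      length-tuples (suc m) = ≡.trans
        (length-concatMap extensions (tuples m) λ {vs} vs∈ →
          ≡.trans (length-map (_∷ vs) (filter (outside? vs) (allVec p M))) (length-outside vs (tuples-sound m vs∈)))
        (cong (ℕ._* (p ^ M ∸ p ^ m)) (length-tuples m))

    -- Independent tuples of length `N` are the bases of the space. The action on them is free
    -- because an invertible matrix is determined by its values on one basis.
    module Action (N : ℕ) where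
      open Mat F
      open Group (GL-group N) using (_∙_; ε) renaming (_≈_ to _≈ᴳ_)
      open Algebra.Properties.Semiring.Sum semiring using (∑-distrib-+; *-distribˡ-sum; sum-cong-≋)

      apply-comb : ∀ (A : Mat N) {m} c (vs : Vec (Vector N) m) → apply A (comb c vs) ≈ᵛ comb c (Vec.map (apply A) vs)
      apply-comb A []       []       i = sum-0 λ k → zeroʳ (A i k)
      apply-comb A (c ∷ cs) (v ∷ vs) i = begin
        apply A (comb (c ∷ cs) (v ∷ vs)) i
          ≈⟨ sum-cong-≋ (λ k → solve 4 (λ a c v s → (a :* (c :* v :+ s)) := (c :* (a :* v) :+ a :* s)) refl (A i k) (rep c) (v k) (comb cs vs k)) ⟩
        _ ≈⟨ ∑-distrib-+ (λ k → rep c * (A i k * v k)) (λ k → A i k * comb cs vs k) ⟩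
        _ ≈⟨ +-cong (sym (*-distribˡ-sum (rep c) (λ k → A i k * v k))) (apply-comb A cs vs i) ⟩
        comb (c ∷ cs) (Vec.map (apply A) (v ∷ vs)) i ∎

      move : Mat N → ∀ {m} → Vec (Vec (Fin p) N) m → Vec (Vec (Fin p) N) m
      move A = Vec.map λ v → canon (apply A (real v))

      comb-move : ∀ A {m} c (vs : Vec (Vec (Fin p) N) m) → comb c (Vec.map real (move A vs)) ≈ᵛ apply A (comb c (Vec.map real vs))
      comb-move A c vs i = trans (lemma c vs) (sym (apply-comb A c (Vec.map real vs) i))
        where
        lemma : ∀ {m} c (vs : Vec (Vec (Fin p) N) m) → comb c (Vec.map real (move A vs)) i ≈ comb c (Vec.map (apply A) (Vec.map real vs)) i
        lemma []       []       = refl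
        lemma (c ∷ cs) (v ∷ vs) = +-cong (*-congˡ (real-canon _ i)) (lemma cs vs)

      move-ind : ∀ (g : GL N) {m} (vs : Vec (Vec (Fin p) N) m) → Ind vs → Ind (move (mat g) vs)
      move-ind g vs ind c d h = ind c d λ k → trans (undo c k) (trans (apply-cong (≋-refl {A = imat g})
        (λ l → trans (sym (comb-move (mat g) c vs l)) (trans (h l) (comb-move (mat g) d vs l))) k) (sym (undo d k)))
        where
        undo : ∀ c → comb c (Vec.map real vs) ≈ᵛ apply (imat g) (apply (mat g) (comb c (Vec.map real vs)))
        undo c k = trans (sym (apply-I _ k)) (trans (apply-cong (≋-sym (left g)) (λ _ → refl) k) (apply-· (imat g) (mat g) _ k))

      opaque
        size : ℕ
        size = length (tuples {N} N)

        size≡ : size ≡ tupleCount p N N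
        size≡ = length-tuples N

        frame : Fin size → Vec (Vec (Fin p) N) N
        frame = List.lookup (tuples N)

        frame-ind : ∀ i → Ind (frame i)
        frame-ind i = tuples-sound N (∈-lookup i)

        moved∈ : ∀ g i → move (mat g) (frame i) ∈ tuples N
        moved∈ g i = tuples-complete N _ (move-ind g (frame i) (frame-ind i))

        act : GL N → Fin size → Fin size
        act g i = Any.index (moved∈ g i)

        frame-act : ∀ g i → frame (act g i) ≡ move (mat g) (frame i)
        frame-act g i = ≡.sym (lookup-index (moved∈ g i))

        frame-injective : ∀ {i j} → frame i ≡ frame j → i ≡ j
        frame-injective = lookup-injective (unique-tuples N) _ _

        act-≈ : ∀ {g h} → g ≈ᴳ h → ∀ i → act g i ≡ act h i
        act-≈ {g} {h} gh i = frame-injective (≡.trans (frame-act g i) (≡.trans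
          (map-cong (λ v → canon-cong (apply-cong gh λ _ → refl)) (frame i)) (≡.sym (frame-act h i))))

        act-ε : ∀ i → act ε i ≡ i
        act-ε i = frame-injective (≡.trans (frame-act ε i) (≡.trans
          (map-cong (λ v → ≡.trans (canon-cong (apply-I (real v))) (canon-real v)) (frame i)) (map-id (frame i))))

        act-∙ : ∀ g h i → act (g ∙ h) i ≡ act g (act h i)
        act-∙ g h i = frame-injective (≡.trans (frame-act (g ∙ h) i) (≡.trans (≡.trans
          (map-cong (λ v → canon-cong λ k → trans (apply-· (mat g) (mat h) (real v) k)
            (apply-cong (≋-refl {A = mat g}) (λ l → sym (real-canon (apply (mat h) (real v)) l)) k)) (frame i))
          (map-∘ (λ v → canon (apply (mat g) (real v))) _ (frame i)))
          (≡.trans (cong (move (mat g)) (≡.sym (frame-act h i))) (≡.sym (frame-act g (act h i))))))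

        act-free : ∀ g h i → act g i ≡ act h i → g ≈ᴳ h
        act-free g h i eq k j = begin
          mat g k j                     ≈⟨ sum-δʳ j (mat g k) ⟨
          apply (mat g) (λ l → δ l j) k ≈⟨ apply-cong (≋-refl {A = mat g}) (λ l → sym (eⱼ l)) k ⟩
          apply (mat g) e k             ≈⟨ comb-move (mat g) c (frame i) k ⟨
          comb c (Vec.map real (move (mat g) (frame i))) k ≡⟨ cong (λ vs → comb c (Vec.map real vs) k) moved ⟩
          comb c (Vec.map real (move (mat h) (frame i))) k ≈⟨ comb-move (mat h) c (frame i) k ⟩
          apply (mat h) e k             ≈⟨ apply-cong (≋-refl {A = mat h}) eⱼ k ⟩
          apply (mat h) (λ l → δ l j) k ≈⟨ sum-δʳ j (mat h k) ⟩
          mat h k j                     ∎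
          where
          span : InSpan (Vec.map real (frame i)) (λ l → δ l j)
          span = basis-spans (Vec.map real (frame i)) (frame-ind i) (λ l → δ l j)
          c : Vec (Fin p) N
          c = proj₁ span
          e : Vector N
          e = comb c (Vec.map real (frame i))
          eⱼ : e ≈ᵛ λ l → δ l j
          eⱼ = proj₂ span
          moved : move (mat g) (frame i) ≡ move (mat h) (frame i)
          moved = ≡.trans (≡.sym (frame-act g i)) (≡.trans (cong frame eq) (frame-act h i))

-- Generated subgroups and their closures.

module GeneratedSubgroups where

  open import Level using (0ℓ)
  open import Algebra.Bundles using (CommutativeRing; Group)
  import Algebra.Properties.Monoid.Mult
  open import Data.List using (List)
  open import Data.List.Membership.Propositional using (_∈_)
  open import Data.Nat using (ℕ; zero; suc)
  open import Data.Product using (∃; _×_; _,_)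
  open FiniteSets using (IsSubgroup)
  open Matrices using (module Mat)

  module Gen (R : CommutativeRing 0ℓ 0ℓ) (N : ℕ) where
    open Mat R
    open Group (GL-group N) using (_∙_; ε; _⁻¹; monoid) renaming (_≈_ to _≈ᴳ_; Carrier to G)
    open Algebra.Properties.Monoid.Mult monoid public using () renaming (_×_ to _×ᴳ_; ×-assocˡ to ×ᴳ-assocˡ)

    infixr 8 _^ᴳ_
    _^ᴳ_ : G → ℕ → G
    x ^ᴳ n = n ×ᴳ x

    -- `resp` closes the group under equality of `mat`, since equal matrices may carry different
    -- stored inverses and proofs.
    data W (gs : List G) : G → Set where
      gen  : ∀ {g} → g ∈ gs → W gs g
      one  : W gs ε
      mul  : ∀ {x y} → W gs x → W gs y → W gs (x ∙ y)
      inv  : ∀ {x} → W gs x → W gs (x ⁻¹)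
      resp : ∀ {x y} → x ≈ᴳ y → W gs x → W gs y

    W-subgroup : ∀ gs → IsSubgroup (GL-group N) (W gs)
    W-subgroup gs = record { resp = resp ; ε∈ = one ; ∙∈ = mul ; ⁻¹∈ = inv }

    W-pow : ∀ {gs x} n → W gs x → W gs (x ^ᴳ n)
    W-pow zero    w = one
    W-pow (suc n) w = mul w (W-pow n w)

    W-least : ∀ {zs} {P : G → Set} → IsSubgroup (GL-group N) P → (∀ {g} → g ∈ zs → P g) → ∀ {x} → W zs x → P x
    W-least {zs} {P} PS sub = go
      where
      module P = IsSubgroup PS
      go : ∀ {x} → W zs x → P x
      go (gen h)    = sub h
      go one        = P.ε∈
      go (mul v w)  = P.∙∈ (go v) (go w)
      go (inv w)    = P.⁻¹∈ (go w)
      go (resp e w) = P.resp e (go w)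

    W-mono : ∀ {zs gs} → (∀ {g} → g ∈ zs → g ∈ gs) → ∀ {x} → W zs x → W gs x
    W-mono {gs = gs} sub = W-least (W-subgroup gs) λ h → gen (sub h)

    Image : List G → Mat N → Set
    Image gs A = ∃ λ y → W gs y × mat y ≋ A

    C : List G → G → Set
    C gs x = Closure (Image gs) (mat x)

    W⊆C : ∀ {gs x} → W gs x → C gs x
    W⊆C {x = x} w f h = h (mat x) (x , w , ≋-refl)

    C-resp : ∀ {gs x y} → x ≈ᴳ y → C gs x → C gs y
    C-resp = Closure-resp

    C-∙ : ∀ {gs x y} → C gs x → C gs y → C gs (x ∙ y)
    C-∙ = Closure-· λ { (u , wu , eu) (v , wv , ev) → u ∙ v , mul wu wv , ·-cong eu ev }

    C-pow : ∀ {gs x} n → C gs x → C gs (x ^ᴳ n)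
    C-pow zero    w = W⊆C one
    C-pow {x = x} (suc n) w = C-∙ {x = x} {x ^ᴳ n} w (C-pow n w)

    C-mono : ∀ {zs gs} → (∀ {g} → g ∈ zs → g ∈ gs) → ∀ {x} → C zs x → C gs x
    C-mono sub c f h = c f λ { A (y , w , e) → h A (y , W-mono sub w , e) }

-- Congruence conditions, leading coefficients and the p-adic rank.

module Congruences where

  open import Level using (0ℓ)
  open import Algebra.Bundles using (CommutativeRing; Group)
  import Algebra.Properties.Semiring.Mult
  import Algebra.Properties.Semiring.Sum
  import Relation.Binary.Reasoning.Setoid
  open import Data.Fin as Fin using (Fin; zero; suc; toℕ; fromℕ<; combine; remQuot)
  open import Data.Fin.Properties using (toℕ-fromℕ<; toℕ-injective; remQuot-combine; toℕ<n)
  open import Data.List using (List; []; _∷_)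
  open import Data.List.Membership.Propositional using (_∈_)
  open import Data.Nat as ℕ using (ℕ; zero; suc; _≤_; _<_; _^_; s≤s; z≤n)
  import Data.Nat.Properties as ℕ
  open import Data.Nat.Coprimality using (Coprime; prime⇒coprime) renaming (sym to coprime-sym)
  open import Data.Nat.Divisibility using (_∣_)
  open import Data.Nat.Primality using (Prime; prime⇒nonZero; prime⇒nonTrivial; prime⇒irreducible)
  open import Data.Product using (Σ; ∃; _×_; _,_; proj₁; proj₂)
  open import Data.Sum using (inj₁; inj₂; [_,_]′)
  open import Data.Vec using (Vec; []; _∷_)
  open import Relation.Binary.PropositionalEquality as ≡ using (_≡_; cong; subst)
  open import Relation.Nullary using (¬_; contradiction)
  open import Defs using (Poly; con; var; eval; _⊕_; _⊛_)
  open Arithmetic using (coprime-^ʳ; inverse-mod)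
  open GeneratedSubgroups using (module Gen)
  open Matrices
  open FieldTuples using (module FiniteField)

  module Numeral (R : CommutativeRing 0ℓ 0ℓ) where
    open CommutativeRing R hiding (zero)
    open Algebra.Properties.Semiring.Mult semiring using (×1-homo-*) renaming (_×_ to _×ᴿ_)
    open Quotient R

    opaque
      ⟦_⟧ : ℕ → Carrier
      ⟦ n ⟧ = n ×ᴿ 1#

      ⟦0⟧ : ⟦ 0 ⟧ ≈ 0#
      ⟦0⟧ = refl

      ⟦suc⟧ : ∀ n → ⟦ suc n ⟧ ≈ 1# + ⟦ n ⟧
      ⟦suc⟧ n = refl

      ⟦⟧-* : ∀ m n → ⟦ m ℕ.* n ⟧ ≈ ⟦ m ⟧ * ⟦ n ⟧
      ⟦⟧-* = ×1-homo-*

    -- The properties of ℤ[1/D] that are used: residue fields at, and Hausdorffness for, moduli prime to D.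
    record IsArithmetic (D : ℕ) : Set where
      field
        residue   : ∀ {m} → 2 ≤ m → Coprime m D → ∀ x → ∃ λ c → c < m × x ≡ ⟦ c ⟧ [ ⟦ m ⟧ ]
        faithful  : ∀ {m} → 2 ≤ m → Coprime m D → ∀ {c d} → c < m → d < m → ⟦ c ⟧ ≡ ⟦ d ⟧ [ ⟦ m ⟧ ] → c ≡ d
        separated : ∀ {p} → 2 ≤ p → Coprime p D → ∀ {x} → (∀ s → ¬ ¬ (x ≡ 0# [ ⟦ p ^ suc s ⟧ ])) → x ≈ 0#

  module Congruence (R : CommutativeRing 0ℓ 0ℓ) {D : ℕ} (A : Numeral.IsArithmetic R D) (N : ℕ) where
    open CommutativeRing R hiding (zero)
    open Quotient R
    open Numeral R
    open IsArithmetic A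
    open Mat R
    open Algebra.Properties.Semiring.Sum semiring using (sum; sum-cong-≋; ∑-distrib-+; *-distribˡ-sum)
    open RingSolver R
    open Relation.Binary.Reasoning.Setoid setoid
    open Group (GL-group N) using (_∙_; ε; _⁻¹) renaming (_≈_ to _≈ᴳ_; Carrier to G)
    open Gen R N public

    infix 4 _≋_[_]
    record _≋_[_] (A B : Mat N) (m : ℕ) : Set where
      constructor mk
      field entry : ∀ i j → A i j ≡ B i j [ ⟦ m ⟧ ]
    open _≋_[_]

    module Q (m : ℕ) where
      open CommutativeRing (quotient (⟦ m ⟧)) public hiding (zero)
      open Mat (quotient (⟦ m ⟧)) public

    ≋⇒≋[] : ∀ {m A B} → A ≋ B → A ≋ B [ m ]
    ≋⇒≋[] h = mk λ i j → ≡[]-reflexive (h i j)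

    ≋[]-refl : ∀ {m A} → A ≋ A [ m ]
    ≋[]-refl = ≋⇒≋[] ≋-refl

    eval-≡[] : ∀ {V} (f : Poly R V) m {x y : V → Carrier} → (∀ v → x v ≡ y v [ ⟦ m ⟧ ]) → eval R f x ≡ eval R f y [ ⟦ m ⟧ ]
    eval-≡[] (con c) m h = Q.refl m
    eval-≡[] (var v) m h = h v
    eval-≡[] (f ⊕ g) m h = Q.+-cong m (eval-≡[] f m h) (eval-≡[] g m h)
    eval-≡[] (f ⊛ g) m h = Q.*-cong m (eval-≡[] f m h) (eval-≡[] g m h)

    ∙-≋[] : ∀ {m} {x x′ y y′ : G} → mat x ≋ mat x′ [ m ] → mat y ≋ mat y′ [ m ] → mat (x ∙ y) ≋ mat (x′ ∙ y′) [ m ]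
    ∙-≋[] {m} (mk h) (mk g) = mk (Q.·-cong m h g)

    ≋[]-sym : ∀ {m A B} → A ≋ B [ m ] → B ≋ A [ m ]
    ≋[]-sym {m} (mk h) = mk (Q.≋-sym m h)

    ≋[]-trans : ∀ {m A B C} → A ≋ B [ m ] → B ≋ C [ m ] → A ≋ C [ m ]
    ≋[]-trans {m} (mk h) (mk g) = mk (Q.≋-trans m h g)

    ≡[]-weaken : ∀ {p m x y} → x ≡ y [ ⟦ p ℕ.* m ⟧ ] → x ≡ y [ ⟦ m ⟧ ]
    ≡[]-weaken {p} {m} (c , h) = ⟦ p ⟧ * c , trans h (+-congˡ (trans (*-congʳ (⟦⟧-* p m))
      (solve 3 (λ p m c → (p :* m :* c) := (m :* (p :* c))) refl (⟦ p ⟧) (⟦ m ⟧) c)))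

    ⁻¹∙≋I : ∀ {m} x y → mat x ≋ mat y [ m ] → mat (x ⁻¹ ∙ y) ≋ I [ m ]
    ⁻¹∙≋I {m} x y h = ≋[]-trans (∙-≋[] {m} {x ⁻¹} {x ⁻¹} {y} {x} ≋[]-refl (≋[]-sym h)) (≋⇒≋[] (left x))

    ∙-⁻¹-cancel : ∀ y x → y ∙ (y ⁻¹ ∙ x) ≈ᴳ x
    ∙-⁻¹-cancel y x = ≋-trans (≋-sym (·-assoc (mat y) (imat y) (mat x)))
      (≋-trans (·-cong (right y) (≋-refl {A = mat x})) (·-identityˡ (mat x)))

    ⁻¹∙-≋ : ∀ {m} x y z → mat (y ⁻¹ ∙ x) ≋ mat z [ m ] → mat x ≋ mat (y ∙ z) [ m ]
    ⁻¹∙-≋ {m} x y z h = ≋[]-trans {m} {mat x} {mat (y ∙ (y ⁻¹ ∙ x))} {mat (y ∙ z)}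
      (≋[]-sym (≋⇒≋[] (∙-⁻¹-cancel y x))) (∙-≋[] {m} {y} {y} {y ⁻¹ ∙ x} {z} ≋[]-refl h)

    record Lead (e : Carrier) (A X : Mat N) : Set where
      constructor lead
      field eq : ∀ i j → A i j ≈ δ i j + e * X i j

    lead-· : ∀ {e A B X Y} → Lead e A X → Lead e B Y → Lead e (A · B) λ i j → (X i j + Y i j) + e * (X · Y) i j
    lead-· {e} {A} {B} {X} {Y} (lead a) (lead b) = lead λ i j → begin
      sum (λ k → A i k * B k j)
        ≈⟨ sum-cong-≋ (λ k → trans (*-congʳ (a i k)) (distribʳ (B k j) (δ i k) (e * X i k))) ⟩
      sum (λ k → δ i k * B k j + e * X i k * B k j)
        ≈⟨ ∑-distrib-+ (λ k → δ i k * B k j) (λ k → e * X i k * B k j) ⟩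
      sum (λ k → δ i k * B k j) + sum (λ k → e * X i k * B k j)
        ≈⟨ +-cong (trans (sum-δˡ i λ k → B k j) (b i j)) (trans (sum-cong-≋ λ k → *-assoc e (X i k) (B k j)) (sym (*-distribˡ-sum e λ k → X i k * B k j))) ⟩
      (δ i j + e * Y i j) + e * sum (λ k → X i k * B k j)
        ≈⟨ +-congˡ (*-congˡ (inner i j)) ⟩
      (δ i j + e * Y i j) + e * (X i j + e * (X · Y) i j)
        ≈⟨ solve 5 (λ d e x y z → ((d :+ e :* y) :+ e :* (x :+ e :* z)) := (d :+ e :* ((x :+ y) :+ e :* z))) refl (δ i j) e (X i j) (Y i j) ((X · Y) i j) ⟩
      δ i j + e * ((X i j + Y i j) + e * (X · Y) i j) ∎
      where
      inner : ∀ i j → sum (λ k → X i k * B k j) ≈ X i j + e * (X · Y) i j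
      inner i j = begin
        sum (λ k → X i k * B k j)
          ≈⟨ sum-cong-≋ (λ k → trans (*-congˡ (b k j)) (solve 4 (λ x d e y → (x :* (d :+ e :* y)) := (x :* d :+ e :* (x :* y))) refl (X i k) (δ k j) e (Y k j))) ⟩
        sum (λ k → X i k * δ k j + e * (X i k * Y k j))
          ≈⟨ ∑-distrib-+ (λ k → X i k * δ k j) (λ k → e * (X i k * Y k j)) ⟩
        sum (λ k → X i k * δ k j) + sum (λ k → e * (X i k * Y k j))
          ≈⟨ +-cong (sum-δʳ j (X i)) (sym (*-distribˡ-sum e λ k → X i k * Y k j)) ⟩
        X i j + e * (X · Y) i j ∎

    opaque
      -- By (1 + eX)(1 + eY) = 1 + e(X + Y + eXY), multiplying matrices adds leading coefficients up
      -- to a multiple of `e`; a power therefore multiplies them by its exponent. `U` collects the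
      -- error.
      lead-pow : ∀ {e x X} → Lead e (mat x) X → ∀ n →
        ∃ λ Z → Lead e (mat (x ^ᴳ n)) Z × ∃ λ (U : Mat N) → ∀ i j → Z i j ≈ ⟦ n ⟧ * X i j + e * U i j
      lead-pow {e} l zero = (λ _ _ → 0#) , lead (λ i j → sym (trans (+-congˡ (zeroʳ e)) (+-identityʳ _))) ,
        (λ _ _ → 0#) , λ i j → sym (trans (+-cong (trans (*-congʳ ⟦0⟧) (zeroˡ _)) (zeroʳ e)) (+-identityʳ 0#))
      lead-pow {e} {x} {X} l (suc n) = let (Z , lz , U , eq) = lead-pow {x = x} l n in
        (λ i j → (X i j + Z i j) + e * (X · Z) i j) , lead-· l lz , (λ i j → U i j + (X · Z) i j) , λ i j → begin
        (X i j + Z i j) + e * (X · Z) i j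
          ≈⟨ +-congʳ (+-congˡ (eq i j)) ⟩
        (X i j + (⟦ n ⟧ * X i j + e * U i j)) + e * (X · Z) i j
          ≈⟨ solve 5 (λ x n e u z → ((x :+ (n :* x :+ e :* u)) :+ e :* z) := ((x :+ n :* x) :+ e :* (u :+ z))) refl (X i j) (⟦ n ⟧) e (U i j) ((X · Z) i j) ⟩
        (X i j + ⟦ n ⟧ * X i j) + e * (U i j + (X · Z) i j)
          ≈⟨ +-congʳ (trans (*-congʳ (⟦suc⟧ n)) (trans (distribʳ (X i j) 1# ⟦ n ⟧) (+-congʳ (*-identityˡ _)))) ⟨
        ⟦ suc n ⟧ * X i j + e * (U i j + (X · Z) i j) ∎

    module Leading (p : ℕ) where

      q^ : ℕ → Carrier
      q^ t = ⟦ p ^ t ⟧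

      q^-suc : ∀ t → q^ (suc t) ≈ ⟦ p ⟧ * q^ t
      q^-suc t = ⟦⟧-* p (p ^ t)

      opaque
        -- In the power with exponent `p` both the main term `p X` and the error, a multiple of
        -- `q^ (suc t)`, contain a factor `p`. Taking it out raises the level by one and changes the
        -- leading coefficient only by a multiple of `q^ t`.
        lead-p : ∀ {t x X} → Lead (q^ (suc t)) (mat x) X →
          ∃ λ Z → Lead (q^ (suc (suc t))) (mat (x ^ᴳ p)) Z × ∃ λ (U : Mat N) → ∀ i j → Z i j ≈ X i j + q^ t * U i j
        lead-p {t} {x} {X} l = let (Y , lead ly , U , eq) = lead-pow {x = x} l p in (λ i j → X i j + q^ t * U i j) , lead (λ i j → begin
          mat (x ^ᴳ p) i j                                   ≈⟨ ly i j ⟩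
          δ i j + q^ (suc t) * Y i j                         ≈⟨ +-congˡ (*-congˡ (eq i j)) ⟩
          δ i j + q^ (suc t) * (⟦ p ⟧ * X i j + q^ (suc t) * U i j)
            ≈⟨ +-congˡ (*-congˡ (+-congˡ (*-congʳ (q^-suc t)))) ⟩
          δ i j + q^ (suc t) * (⟦ p ⟧ * X i j + ⟦ p ⟧ * q^ t * U i j)
            ≈⟨ solve 6 (λ d e p x f u → (d :+ e :* (p :* x :+ p :* f :* u)) := (d :+ (p :* e) :* (x :+ f :* u))) refl (δ i j) (q^ (suc t)) ⟦ p ⟧ (X i j) (q^ t) (U i j) ⟩
          δ i j + (⟦ p ⟧ * q^ (suc t)) * (X i j + q^ t * U i j)  ≈⟨ +-congˡ (*-congʳ (q^-suc (suc t))) ⟨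
          δ i j + q^ (suc (suc t)) * (X i j + q^ t * U i j)  ∎) , U , λ i j → refl

      vec : Mat N → Fin (N ℕ.* N) → Carrier
      vec X k = X (proj₁ (remQuot N k)) (proj₂ (remQuot {N} N k))

      vec-combine : ∀ {X Y} → (∀ k → vec X k ≡ vec Y k [ ⟦ p ⟧ ]) → X ≋ Y [ p ]
      vec-combine {X} {Y} h = mk λ i j → subst (λ (i , j) → X i j ≡ Y i j [ ⟦ p ⟧ ]) (remQuot-combine i j) (h (combine i j))

      lead-≋ : ∀ {t A B X Y} → Lead (q^ t) A X → Lead (q^ t) B Y → X ≋ Y [ p ] → A ≋ B [ p ^ suc t ]
      lead-≋ {t} {A} {B} {X} {Y} (lead a) (lead b) (mk xy) = mk λ i j → let (c , eq) = xy i j in c , (begin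
        A i j                                     ≈⟨ a i j ⟩
        δ i j + q^ t * X i j                      ≈⟨ +-congˡ (*-congˡ eq) ⟩
        δ i j + q^ t * (Y i j + ⟦ p ⟧ * c)      ≈⟨ solve 5 (λ d e y p c → (d :+ e :* (y :+ p :* c)) := ((d :+ e :* y) :+ (p :* e) :* c)) refl (δ i j) (q^ t) (Y i j) (⟦ p ⟧) c ⟩
        (δ i j + q^ t * Y i j) + (⟦ p ⟧ * q^ t) * c  ≈⟨ +-cong (b i j) (*-congʳ (q^-suc t)) ⟨
        B i j + q^ (suc t) * c                    ∎)

      ≋I⇒lead : ∀ {t A} → A ≋ I [ p ^ t ] → ∃ (Lead (q^ t) A)
      ≋I⇒lead (mk h) = (λ i j → proj₁ (h i j)) , lead λ i j → proj₂ (h i j)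

      lead⇒≋I : ∀ {t A X} → Lead (q^ t) A X → A ≋ I [ p ^ t ]
      lead⇒≋I {X = X} (lead h) = mk λ i j → X i j , h i j

      pow-≋I : ∀ {x} → mat x ≋ I [ p ^ 1 ] → ∀ t → mat (x ^ᴳ (p ^ t)) ≋ I [ p ^ suc t ]
      pow-≋I {x} h zero    = ≋[]-trans (≋⇒≋[] (·-identityʳ (mat x))) h
      pow-≋I {x} h (suc t) = ≋[]-trans (≋⇒≋[] (≋-sym (×ᴳ-assocˡ x p (p ^ t))))
        (let (_ , l) = ≋I⇒lead {suc t} (pow-≋I {x} h t) ; (_ , l′ , _) = lead-p {t} {x ^ᴳ (p ^ t)} l in lead⇒≋I {suc (suc t)} l′)

      -- The vectors of `Vs` only have to agree with the leading coefficients modulo `p`; thus one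
      -- family `Vs` can be kept while the level `t` grows.
      data Leads (t : ℕ) (gs : List G) : ∀ {v} → Vec (Fin (N ℕ.* N) → Carrier) v → Set where
        []   : Leads t gs []
        cons : ∀ {v V} {Vs : Vec _ v} x X → W gs x → Lead (q^ t) (mat x) X → (∀ k → vec X k ≡ V k [ ⟦ p ⟧ ]) → Leads t gs Vs → Leads t gs (V ∷ Vs)

      leads-mono : ∀ {t zs gs v} {Vs : Vec _ v} → (∀ {g} → g ∈ zs → g ∈ gs) → Leads t zs Vs → Leads t gs Vs
      leads-mono sub []                   = []
      leads-mono sub (cons x X w l e ls) = cons x X (W-mono sub w) l e (leads-mono sub ls)

      -- This needs p^t with t ≥ 2: then (1 + p^t X)^p ≡ 1 + p^(t+1) X modulo p^(t+2).
      leads-suc : ∀ {t gs v} {Vs : Vec _ v} → Leads (2 ℕ.+ t) gs Vs → Leads (3 ℕ.+ t) gs Vs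
      leads-suc [] = []
      leads-suc {t} (cons x X w l e ls) = let (Z , lz , U , eq) = lead-p {suc t} {x} l in cons (x ^ᴳ p) Z (W-pow {x = x} p w) lz
        (λ k → Q.trans p (q^ t * vec U k , trans (eq _ _) (+-congˡ (trans (*-congʳ (q^-suc t)) (*-assoc _ _ _)))) (e k)) (leads-suc ls)

      leads-+ : ∀ {t gs v} {Vs : Vec _ v} s → Leads (2 ℕ.+ t) gs Vs → Leads (2 ℕ.+ (s ℕ.+ t)) gs Vs
      leads-+ zero    ls = ls
      leads-+ (suc s) ls = leads-suc (leads-+ s ls)

    module AtPrime {p : ℕ} (pp : Prime p) (p∤D : ¬ p ∣ D) where

      2≤p : 2 ≤ p
      2≤p = ℕ.nonTrivial⇒n>1 p {{prime⇒nonTrivial pp}}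

      p-coprime : Coprime p D
      p-coprime (d∣p , d∣D) with prime⇒irreducible pp d∣p
      ... | inj₁ e      = e
      ... | inj₂ ≡.refl = contradiction d∣D p∤D

      p^-coprime : ∀ s → Coprime (p ^ s) D
      p^-coprime s = coprime-sym (coprime-^ʳ (coprime-sym p-coprime) s)

      2≤p^ : ∀ s → 2 ≤ p ^ suc s
      2≤p^ s = ℕ.≤-trans 2≤p (subst (_≤ p ^ suc s) (ℕ.*-identityʳ p) (ℕ.^-monoʳ-≤ p {{prime⇒nonZero pp}} (s≤s (z≤n {s}))))

      -- Polynomials are p-adically continuous, so closures are p-adically closed.
      C-closed : ∀ {gs x} → (∀ s → ¬ ¬ (∃ λ y → C gs y × mat x ≋ mat y [ p ^ suc s ])) → C gs x
      C-closed {x = x} near f h = separated 2≤p p-coprime λ s k → near s λ (y , c , xy) →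
        k (Q.trans (p ^ suc s) (eval-≡[] f (p ^ suc s) λ (i , j) → entry xy i j) (≡[]-reflexive (c f h)))

      𝔽 : CommutativeRing 0ℓ 0ℓ
      𝔽 = quotient (⟦ p ⟧)

      rep : Fin p → Carrier
      rep i = ⟦ toℕ i ⟧

      cls : Carrier → Fin p
      cls x = fromℕ< (proj₁ (proj₂ (residue 2≤p p-coprime x)))

      rep-cls : ∀ x → rep (cls x) ≡ x [ ⟦ p ⟧ ]
      rep-cls x with residue 2≤p p-coprime x
      ... | c , c<p , h = subst (λ d → ⟦ d ⟧ ≡ x [ ⟦ p ⟧ ]) (≡.sym (toℕ-fromℕ< c<p)) (Q.sym p h)

      rep-injective : ∀ {i j} → rep i ≡ rep j [ ⟦ p ⟧ ] → i ≡ j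
      rep-injective h = toℕ-injective (faithful 2≤p p-coprime (toℕ<n _) (toℕ<n _) h)

      𝔽-inverse : ∀ x → ¬ (x ≡ 0# [ ⟦ p ⟧ ]) → ∃ λ y → x * y ≡ 1# [ ⟦ p ⟧ ]
      𝔽-inverse x x≉0 with residue 2≤p p-coprime x
      ... | zero  , _   , h = contradiction (Q.trans p h (≡[]-reflexive ⟦0⟧)) x≉0
      ... | suc c , c<p , h with inverse-mod 2≤p (coprime-sym (prime⇒coprime pp c<p))
      ...   | w , r , eq = ⟦ w ⟧ , Q.trans p (Q.*-congʳ p h) (⟦ r ⟧ , (begin
        ⟦ suc c ⟧ * ⟦ w ⟧       ≈⟨ *-comm _ _ ⟩
        ⟦ w ⟧ * ⟦ suc c ⟧       ≈⟨ ⟦⟧-* w (suc c) ⟨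
        ⟦ w ℕ.* suc c ⟧           ≡⟨ cong ⟦_⟧ eq ⟩
        ⟦ suc (r ℕ.* p) ⟧             ≈⟨ ⟦suc⟧ (r ℕ.* p) ⟩
        1# + ⟦ r ℕ.* p ⟧          ≈⟨ +-congˡ (trans (⟦⟧-* r p) (*-comm _ _)) ⟩
        1# + ⟦ p ⟧ * ⟦ r ⟧        ∎))

      cls-cong : ∀ {x y} → x ≡ y [ ⟦ p ⟧ ] → cls x ≡ cls y
      cls-cong {x} {y} h = rep-injective (Q.trans p (rep-cls x) (Q.trans p h (Q.sym p (rep-cls y))))

      cls-rep : ∀ i → cls (rep i) ≡ i
      cls-rep i = rep-injective (rep-cls (rep i))

      open FiniteField 𝔽 p rep cls rep-cls cls-cong cls-rep 𝔽-inverse 2≤p public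

      open Leading p public

      opaque
        -- Products of powers realise linear combinations, `x ^ᴳ toℕ c` contributing `c` times the
        -- leading coefficient of `x`. At a level of at least 1 all error terms are divisible by
        -- `p`.
        leads-comb : ∀ {t gs v} {Vs : Vec _ v} → Leads (suc t) gs Vs → ∀ c →
          ∃ λ x → ∃ λ X → W gs x × Lead (q^ (suc t)) (mat x) X × vec X ≈ᵛ comb c Vs
        leads-comb [] [] = ε , (λ _ _ → 0#) , one ,
          lead (λ i j → sym (trans (+-congˡ (zeroʳ _)) (+-identityʳ _))) , λ k → Q.refl p
        leads-comb {t} (cons {V = V} {Vs} x X w l e ls) (c ∷ cs) =
          let (y , Y , wy , ly , ey) = leads-comb ls cs ; (Z , lz , U , eq) = lead-pow {x = x} l (toℕ c) in
          x ^ᴳ toℕ c ∙ y , _ , mul (W-pow {x = x} (toℕ c) w) wy , lead-· lz ly , λ k →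
          let i = proj₁ (remQuot {N} N k) ; j = proj₂ (remQuot {N} N k) in
          Q.trans p
            ((q^ t * U i j + q^ t * (Z · Y) i j) , trans (+-cong (+-congʳ (eq i j)) (*-congʳ (q^-suc t)))
              (trans (+-congʳ (+-congʳ (+-congˡ (*-congʳ (q^-suc t)))))
                (solve 7 (λ n x p e u y z → (((n :* x :+ p :* e :* u) :+ y) :+ p :* e :* z) := ((n :* x :+ y) :+ p :* (e :* u :+ e :* z)))
                  refl (rep c) (X i j) (⟦ p ⟧) (q^ t) (U i j) (Y i j) ((Z · Y) i j))))
            (Q.+-cong p (Q.*-congˡ p (e k)) (ey k))

      -- The p-adic dimension of the group generated by gs is at least v.
      Rank≥ : List G → ℕ → Set
      Rank≥ gs v = Σ ℕ λ t → Σ (Vec (Vector (N ℕ.* N)) v) λ Vs → Leads (2 ℕ.+ t) gs Vs × Indep {N ℕ.* N} {v} Vs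

      rank-bound : ∀ {gs v} → Rank≥ gs v → v ≤ N ℕ.* N
      rank-bound (_ , Vs , _ , ind) = indep⇒≤ {N ℕ.* N} Vs ind

      rank-0 : ∀ gs → Rank≥ gs 0
      rank-0 gs = 0 , [] , [] , indep-[] {N ℕ.* N}

      module _ {zs gs : List G} {v : ℕ} (sub : ∀ {g} → g ∈ zs → g ∈ gs) (rank : Rank≥ zs v) (¬rank : ¬ Rank≥ gs (suc v)) where
        private
          t₀ = proj₁ rank
          Vs = proj₁ (proj₂ rank)
          leads₀ = proj₁ (proj₂ (proj₂ rank))
          indep = proj₂ (proj₂ (proj₂ rank))

        opaque
          -- The leading coefficient of `x` lies in the span of `Vs`: otherwise it would prolong
          -- `Vs` to `suc v` independent vectors realised in `W gs`, against `¬rank`. An element of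
          -- `W zs` with the same leading coefficient agrees with `x` to one more power of `p`.
          approx-step : ∀ s {x} → W gs x → mat x ≋ I [ p ^ (2 ℕ.+ (s ℕ.+ t₀)) ] →
            ∃ λ y → W zs y × mat x ≋ mat y [ p ^ (3 ℕ.+ (s ℕ.+ t₀)) ]
          approx-step s {x} w h =
            let (X , l) = ≋I⇒lead {2 ℕ.+ (s ℕ.+ t₀)} h in
            [ (λ (c , hc) → let (y , Y , wy , ly , ey) = leads-comb (leads-+ s leads₀) c in
                 y , wy , lead-≋ {2 ℕ.+ (s ℕ.+ t₀)} l ly (vec-combine λ k → Q.sym p (Q.trans p (ey k) (hc k))))
            , (λ ind → contradiction
                 (s ℕ.+ t₀ , vec X ∷ Vs , cons x X w l (λ k → Q.refl p) (leads-mono sub (leads-+ s leads₀)) , ind) ¬rank)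
            ]′ (span-or-extend Vs (vec X) indep)

        Near : ℕ → G → Set
        Near s x = ∃ λ y → W zs y × mat x ≋ mat y [ p ^ (2 ℕ.+ (s ℕ.+ t₀)) ]

        private
          compose : ∀ s {x y} → W zs y → (∃ λ z → W zs z × mat (y ⁻¹ ∙ x) ≋ mat z [ p ^ (3 ℕ.+ (s ℕ.+ t₀)) ]) → Near (suc s) x
          compose s {x} {y} wy (z , wz , eq) = y ∙ z , mul wy wz , ⁻¹∙-≋ {p ^ (3 ℕ.+ (s ℕ.+ t₀))} x y z eq

        -- Successive approximation: the quotient `y ⁻¹ ∙ x` is close to 1 and lies in `W gs`, so
        -- `approx-step` supplies a correction by which `y` is multiplied on the right.
        nearer : ∀ s {x} → W gs x → Near s x → Near (suc s) x
        nearer s {x} w (y , wy , xy) = compose s {x} {y} wy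
          (approx-step s {y ⁻¹ ∙ x} (mul (inv (W-mono sub wy)) w) (⁻¹∙≋I {p ^ (2 ℕ.+ (s ℕ.+ t₀))} y x (≋[]-sym xy)))

        approximate : ∀ s {x} → W gs x → mat x ≋ I [ p ^ (2 ℕ.+ t₀) ] → Near s x
        approximate zero    w h = ε , one , h
        approximate (suc s) {x} w h = nearer s {x} w (approximate s {x} w h)

        weaken-+ : ∀ s {A B} → A ≋ B [ p ^ (2 ℕ.+ (s ℕ.+ t₀)) ] → A ≋ B [ p ^ suc s ]
        weaken-+ s {A} {B} (mk h) = mk λ i j → go (suc t₀) (subst (λ e → A i j ≡ B i j [ ⟦ p ^ e ⟧ ]) (eq s t₀) (h i j))
          where
          eq : ∀ s t → 2 ℕ.+ (s ℕ.+ t) ≡ suc t ℕ.+ suc s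
          eq s t = cong suc (≡.trans (cong suc (ℕ.+-comm s t)) (≡.sym (ℕ.+-suc t s)))
          go : ∀ d {a b} → a ≡ b [ ⟦ p ^ (d ℕ.+ suc s) ⟧ ] → a ≡ b [ ⟦ p ^ suc s ⟧ ]
          go zero    h = h
          go (suc d) h = go d (≡[]-weaken {p} h)

        level : ℕ
        level = suc t₀

        equal-rank⇒closure : ∀ {x} → W gs x → mat x ≋ I [ p ^ suc level ] → C zs x
        equal-rank⇒closure {x} w h = C-closed {x = x} λ s k → let (y , wy , xy) = approximate s w h in
          k (y , W⊆C wy , weaken-+ s xy)

-- Coset systems and finite index.

module Cosets where

  open import Level using (0ℓ)
  open import Algebra.Bundles using (Group)
  import Algebra.Properties.Group
  import Algebra.Properties.Monoid.Mult
  import Relation.Binary.Reasoning.Setoid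
  open import Data.Fin as Fin using (Fin; zero; suc; toℕ; splitAt; join)
  open import Data.Fin.Properties as Fin using (pigeonhole; injective⇒≤; join-splitAt; toℕ≤pred[n])
  open import Data.Nat as ℕ using (ℕ; zero; suc; _≤_; _<_)
  import Data.Nat.Properties as ℕ
  open import Data.Product using (Σ; ∃; _×_; _,_; proj₁; proj₂)
  open import Data.Sum using (_⊎_; inj₁; inj₂; [_,_]′)
  open import Function using (_∘_)
  open import Relation.Binary.PropositionalEquality as ≡ using (_≡_; cong; subst)
  open import Relation.Nullary using (¬_; contradiction)
  open FiniteSets

  module _ (G : Group 0ℓ 0ℓ) where
    open Group G
    open Algebra.Properties.Group G
    open Algebra.Properties.Monoid.Mult monoid renaming (_×_ to _×ᴳ_; ×-homo-+ to ×ᴳ-homo-+)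
    open Relation.Binary.Reasoning.Setoid setoid

    private
      pow : Carrier → ℕ → Carrier
      pow x n = n ×ᴳ x

      cancel : ∀ x y z → (x ∙ y) ⁻¹ ∙ (x ∙ z) ≈ y ⁻¹ ∙ z
      cancel x y z = begin
        (x ∙ y) ⁻¹ ∙ (x ∙ z)        ≈⟨ ∙-congʳ (⁻¹-anti-homo-∙ x y) ⟩
        (y ⁻¹ ∙ x ⁻¹) ∙ (x ∙ z)     ≈⟨ assoc _ _ _ ⟩
        y ⁻¹ ∙ (x ⁻¹ ∙ (x ∙ z))     ≈⟨ ∙-congˡ (\\-leftDividesʳ x z) ⟩
        y ⁻¹ ∙ z                    ∎

      <⇒∃+ : ∀ {a b} → a < b → ∃ λ e → b ≡ a ℕ.+ suc e
      <⇒∃+ {a} {b} a<b = b ℕ.∸ suc a , ≡.trans (≡.sym (ℕ.m+[n∸m]≡n a<b)) (≡.sym (ℕ.+-suc a _))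

    -- Meant for closures, where inversion cannot be treated by translating polynomials. Two powers
    -- of `x`, with exponents a < b, share a code; then x to the power a - b satisfies `P`, and
    -- multiplication by x to the power b - a - 1 yields the inverse.
    finite-order-inverse : ∀ {W P : Carrier → Set} → IsSubgroup G W →
      (∀ {x y} → x ≈ y → P x → P y) → P ε → (∀ {x y} → P x → P y → P (x ∙ y)) →
      ∀ {q} (code : Carrier → Fin q) → (∀ {x y} → W x → W y → code x ≡ code y → P (x ⁻¹ ∙ y)) →
      ∀ {x} → W x → P x → P (x ⁻¹)
    finite-order-inverse {W} {P} WS P-resp P-ε P-∙ {q} code sound {x} w px
      with pigeonhole {q} {suc q} ℕ.≤-refl (λ i → code (pow x (toℕ i)))
    ... | a , b , a<b , eq with <⇒∃+ a<b
    ...   | e , b≡ = P-resp (inverseʳ-unique x _ x∙z≈ε) (P-∙ (P-pow e) (sound (W-pow (toℕ b)) (W-pow (toℕ a)) (≡.sym eq)))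
      where
      module W = IsSubgroup WS
      P-pow : ∀ n → P (pow x n)
      P-pow zero    = P-ε
      P-pow (suc n) = P-∙ px (P-pow n)
      W-pow : ∀ n → W (pow x n)
      W-pow zero    = W.ε∈
      W-pow (suc n) = W.∙∈ w (W-pow n)
      xa = pow x (toℕ a)
      xb = pow x (toℕ b)
      xb≈ : xb ≈ xa ∙ pow x (suc e)
      xb≈ = trans (reflexive (cong (pow x) b≡)) (×ᴳ-homo-+ x (toℕ a) (suc e))
      x∙z≈ε : x ∙ (pow x e ∙ (xb ⁻¹ ∙ xa)) ≈ ε
      x∙z≈ε = begin
        x ∙ (pow x e ∙ (xb ⁻¹ ∙ xa))               ≈⟨ assoc _ _ _ ⟨
        pow x (suc e) ∙ (xb ⁻¹ ∙ xa)               ≈⟨ ∙-congˡ (∙-congʳ (trans (⁻¹-cong xb≈) (⁻¹-anti-homo-∙ xa _))) ⟩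
        pow x (suc e) ∙ ((pow x (suc e) ⁻¹ ∙ xa ⁻¹) ∙ xa) ≈⟨ ∙-congˡ (//-rightDividesˡ xa _) ⟩
        pow x (suc e) ∙ pow x (suc e) ⁻¹           ≈⟨ inverseʳ _ ⟩
        ε                                          ∎

    -- `n` elements of `V` in different left cosets of `H` witness that the index is at least `n`.
    -- The index itself appears as the size of a system that has no successor.
    CosetSystem : (V H : Carrier → Set) → ℕ → Set
    CosetSystem V H n = Σ (Fin n → Carrier) λ r → (∀ a → V (r a)) × (∀ {a b} → H (r a ⁻¹ ∙ r b) → a ≡ b)

    module _ {H : Carrier → Set} (HS : IsSubgroup G H) where
      private module H = IsSubgroup HS

      H-flip : ∀ {x y} → H (x ⁻¹ ∙ y) → H (y ⁻¹ ∙ x)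
      H-flip {x} {y} h = H.resp (trans (⁻¹-anti-homo-∙ (x ⁻¹) y) (∙-congˡ (⁻¹-involutive x))) (H.⁻¹∈ h)

      -- By `sep` no element of `V` shares a coset with an element of the translate of `V` by `g`;
      -- so a system and its translate together form one of twice the size.
      double : ∀ {V V′ : Carrier → Set} {n} g → (∀ {x} → V x → V′ x) → (∀ {x} → V x → V′ (g ∙ x)) →
               (∀ {x y} → V x → V y → ¬ H (x ⁻¹ ∙ (g ∙ y))) → CosetSystem V H n → CosetSystem V′ H (n ℕ.+ n)
      double {V} {V′} {n} g sub shift sep (r , r∈ , dis) = (λ i → r′ (splitAt n i)) , (λ i → r′∈ (splitAt n i)) ,
        λ {i} {j} h → ≡.trans (≡.sym (join-splitAt n n i)) (≡.trans (cong (join n n) (dis′ (splitAt n i) (splitAt n j) h)) (join-splitAt n n j))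
        where
        r′ : Fin n ⊎ Fin n → Carrier
        r′ = [ r , (λ a → g ∙ r a) ]′
        r′∈ : ∀ i → V′ (r′ i)
        r′∈ (inj₁ a) = sub (r∈ a)
        r′∈ (inj₂ a) = shift (r∈ a)
        dis′ : ∀ i j → H (r′ i ⁻¹ ∙ r′ j) → i ≡ j
        dis′ (inj₁ a) (inj₁ b) h = cong inj₁ (dis h)
        dis′ (inj₁ a) (inj₂ b) h = contradiction h (sep (r∈ a) (r∈ b))
        dis′ (inj₂ a) (inj₁ b) h = contradiction (H-flip h) (sep (r∈ b) (r∈ a))
        dis′ (inj₂ a) (inj₂ b) h = cong inj₂ (dis (H.resp (cancel g (r a) (r b)) h))

      module _ {V : Carrier → Set} where

        system-1 : V ε → CosetSystem V H 1
        system-1 v = (λ _ → ε) , (λ _ → v) , λ { {zero} {zero} _ → ≡.refl }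

        system-≤ : ∀ {m n} → m ≤ n → CosetSystem V H n → CosetSystem V H m
        system-≤ m≤n (r , r∈ , dis) = (λ i → r (Fin.inject≤ i m≤n)) , (λ i → r∈ _) ,
          λ h → Fin.inject≤-injective m≤n m≤n _ _ (dis h)

        system-bound : ∀ {n q} (code : Carrier → Fin q) → (∀ {x y} → V x → V y → code x ≡ code y → H (x ⁻¹ ∙ y)) →
                       CosetSystem V H n → n ≤ q
        system-bound code sound (r , r∈ , dis) = injective⇒≤ {f = code ∘ r} λ {a} {b} eq → dis (sound (r∈ a) (r∈ b) eq)

        system-covers : ∀ {n} (sys : CosetSystem V H n) → ¬ CosetSystem V H (suc n) →
                        ∀ {x} → V x → ¬ ¬ (∃ λ a → H (proj₁ sys a ⁻¹ ∙ x))
        system-covers {n} (r , r∈ , dis) max {x} v none = max (r′ , r′∈ , dis′)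
          where
          r′ : Fin (suc n) → Carrier
          r′ zero    = x
          r′ (suc a) = r a
          r′∈ : ∀ a → V (r′ a)
          r′∈ zero    = v
          r′∈ (suc a) = r∈ a
          dis′ : ∀ {a b} → H (r′ a ⁻¹ ∙ r′ b) → a ≡ b
          dis′ {zero}  {zero}  h = ≡.refl
          dis′ {zero}  {suc b} h = contradiction (b , H-flip h) none
          dis′ {suc a} {zero}  h = contradiction (a , h) none
          dis′ {suc a} {suc b} h = cong suc (dis h)

        -- The `suc n` powers of `x` with exponents 0 to `n` fall into `n` cosets, so two of them
        -- share one. The bound on the exponent makes it prime to every prime above `n`.
        power∈ : ∀ {n} → IsSubgroup G V → (sys : CosetSystem V H n) → ¬ CosetSystem V H (suc n) →
                 ∀ {x} → V x → ¬ ¬ (∃ λ b → suc b ≤ n × H (pow x (suc b)))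
        power∈ {n} VS sys max {x} v k = ¬¬-Fin {m = suc n} (λ i → system-covers sys max (V-pow (toℕ i))) λ cls →
          let (a , b , a<b , eq) = pigeonhole {n} {suc n} ℕ.≤-refl (λ i → proj₁ (cls i))
              (e , b≡) = <⇒∃+ a<b
              r = proj₁ sys (proj₁ (cls a))
          in k (e , ℕ.≤-trans (ℕ.m≤n+m (suc e) (toℕ a)) (subst (_≤ n) b≡ (toℕ≤pred[n] b)) ,
            H.resp (trans (cancel (r ⁻¹) (pow x (toℕ a)) (pow x (toℕ b)))
                     (trans (∙-congˡ (trans (reflexive (cong (pow x) b≡)) (×ᴳ-homo-+ x (toℕ a) (suc e)))) (\\-leftDividesʳ (pow x (toℕ a)) _)))
              (H.∙∈ (H.⁻¹∈ (proj₂ (cls a))) (subst (λ c → H (proj₁ sys c ⁻¹ ∙ pow x (toℕ b))) (≡.sym eq) (proj₂ (cls b)))))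
          where
          module V = IsSubgroup VS
          V-pow : ∀ n → V (pow x n)
          V-pow zero    = V.ε∈
          V-pow (suc n) = V.∙∈ v (V-pow n)

-- The bound for strict chains over an arithmetic ring.

module Chains where

  open import Level using (0ℓ)
  open import Algebra.Bundles using (CommutativeRing; Group)
  import Algebra.Properties.Group
  open import Data.Fin as Fin using (Fin; zero; suc; fromℕ<; remQuot; combine)
  open import Data.Fin.Properties using (toℕ-fromℕ<; remQuot-combine)
  open import Data.List as List using (List; []; _∷_; _++_; length; take; drop)
  open import Data.List.Properties using (length-drop; length-take; take++drop≡id)
  open import Data.List.Membership.Propositional using (_∈_)
  open import Data.List.Membership.Propositional.Properties using (∈-++⁺ʳ)
  open import Data.List.Relation.Unary.Any as Any using (here; there)
  open import Data.List.Relation.Unary.Any.Properties using (lookup-index)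
  open import Data.Nat as ℕ using (ℕ; zero; suc; _≤_; _<_; _^_; s≤s; z≤n; _!)
  import Data.Nat.Properties as ℕ
  open import Data.Nat.Coprimality using (Coprime; prime⇒coprime) renaming (sym to coprime-sym)
  open import Data.Nat.Divisibility using (_∣_; _∣?_; ∣m+n∣m⇒∣n; ∣1⇒≡1; m∣m*n)
  open import Data.Nat.Primality using (Prime; ¬prime[1])
  open import Data.Nat.Primality.Factorisation using (factorise)
  open import Data.Nat.ListAction using (product)
  open import Data.List.Relation.Unary.All using (All; []; _∷_)
  open import Data.Product using (∃; _×_; _,_; proj₁; proj₂)
  open import Data.Unit using (⊤)
  open import Data.Vec as Vec using (Vec; tabulate; lookup)
  open import Data.Vec.Properties using (lookup∘tabulate)
  open import Relation.Binary.PropositionalEquality as ≡ using (_≡_; cong; subst)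
  open import Relation.Nullary using (¬_; contradiction)
  open import Relation.Nullary.Decidable using (decidable-stable)
  open Arithmetic
  open FiniteSets
  open Cosets
  open Matrices
  open Congruences

  -- Euclid's choice: a prime factor of the number after `D`.
  prime∤ : ∀ D → 1 ≤ D → ∃ λ p → Prime p × ¬ p ∣ D
  prime∤ (suc D) _ with factorise (suc (suc D))
  ... | record { factors = [] ; isFactorisation = () }
  ... | record { factors = p ∷ ps ; isFactorisation = eq ; factorsPrime = pp ∷ _ } = p , pp , λ p∣D →
    contradiction (subst Prime (∣1⇒≡1 (∣m+n∣m⇒∣n (subst (p ∣_) (≡.trans (≡.sym eq) (ℕ.+-comm 1 (suc D))) (m∣m*n (product ps))) p∣D)) pp) ¬prime[1]

  -- From 2 ^ steps ≤ index ≤ 6 ^ (N ! * N).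
  stepBound : ℕ → ℕ
  stepBound N = 3 ℕ.* (N ! ℕ.* N)

  2^-cancel-≤ : ∀ {m n} → 2 ^ m ≤ 2 ^ n → m ≤ n
  2^-cancel-≤ {m} {n} h = ℕ.≮⇒≥ λ n<m → ℕ.<⇒≱ (ℕ.^-monoʳ-< 2 (s≤s (s≤s z≤n)) n<m) h

  module ChainBound (R : CommutativeRing 0ℓ 0ℓ) {D : ℕ} (A : Numeral.IsArithmetic R D) (1≤D : 1 ≤ D) (N : ℕ) (1≤N : 1 ≤ N) where
    open CommutativeRing R using (Carrier)
    open Quotient R
    open Numeral R
    open IsArithmetic A
    open Mat R
    open Congruence R A N
    open Group (GL-group N) using (_∙_; ε; _⁻¹) renaming (_≈_ to _≈ᴳ_; Carrier to G)

    code : ∀ {q} → 2 ≤ q → Coprime q D → G → Fin (length (allVec q (N ℕ.* N)))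
    code {q} 2≤q cop x = Any.index (∈-allVec (tabulate λ k →
      fromℕ< (proj₁ (proj₂ (residue 2≤q cop (mat x (proj₁ (remQuot {N} N k)) (proj₂ (remQuot {N} N k))))))))

    code-sound : ∀ {q} (2≤q : 2 ≤ q) (cop : Coprime q D) x y → code 2≤q cop x ≡ code 2≤q cop y → mat x ≋ mat y [ q ]
    code-sound {q} 2≤q cop x y eq = mk λ i j → subst (λ (i , j) → mat x i j ≡ mat y i j [ ⟦ q ⟧ ]) (remQuot-combine i j) (entry-≡ (combine i j))
      where
      res : (x : G) (k : Fin (N ℕ.* N)) → ∃ λ c → c < q × mat x (proj₁ (remQuot {N} N k)) (proj₂ (remQuot {N} N k)) ≡ ⟦ c ⟧ [ ⟦ q ⟧ ]
      res x k = residue 2≤q cop (mat x (proj₁ (remQuot {N} N k)) (proj₂ (remQuot {N} N k)))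
      digits : G → Vec (Fin q) (N ℕ.* N)
      digits x = tabulate λ k → fromℕ< (proj₁ (proj₂ (res x k)))
      digits≡ : digits x ≡ digits y
      digits≡ = ≡.trans (lookup-index (∈-allVec (digits x))) (≡.trans (cong (List.lookup (allVec q (N ℕ.* N))) eq) (≡.sym (lookup-index (∈-allVec (digits y)))))
      toℕ-digit : ∀ x k → Fin.toℕ (lookup (digits x) k) ≡ proj₁ (res x k)
      toℕ-digit x k = ≡.trans (cong Fin.toℕ (lookup∘tabulate _ k)) (toℕ-fromℕ< _)
      c≡ : ∀ k → proj₁ (res x k) ≡ proj₁ (res y k)
      c≡ k = ≡.trans (≡.sym (toℕ-digit x k)) (≡.trans (cong (λ ds → Fin.toℕ (lookup ds k)) digits≡) (toℕ-digit y k))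
      entry-≡ : ∀ k → mat x (proj₁ (remQuot {N} N k)) (proj₂ (remQuot {N} N k)) ≡ mat y (proj₁ (remQuot {N} N k)) (proj₂ (remQuot {N} N k)) [ ⟦ q ⟧ ]
      entry-≡ k = Q.trans q (proj₂ (proj₂ (res x k)))
        (Q.sym q (subst (λ c → mat y (proj₁ (remQuot {N} N k)) (proj₂ (remQuot {N} N k)) ≡ ⟦ c ⟧ [ ⟦ q ⟧ ]) (≡.sym (c≡ k)) (proj₂ (proj₂ (res y k)))))

    -- The newest generator stands first, so that the tails of the list generate the smaller groups
    -- of the chain.
    Chain : List G → Set
    Chain []       = ⊤
    Chain (g ∷ gs) = ¬ C gs g × Chain gs

    pow≋I : ∀ {m x} → mat x ≋ I [ m ] → ∀ n → mat (x ^ᴳ n) ≋ I [ m ]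
    pow≋I h zero = ≋[]-refl
    pow≋I {m} {x} h (suc n) = ≋[]-trans {m} {mat (x ∙ x ^ᴳ n)} {mat (ε ∙ ε)} {I}
      (∙-≋[] {m} {x} {ε} {x ^ᴳ n} {ε} h (pow≋I {m} {x} h n)) (≋⇒≋[] (·-identityˡ I))

    ≋[]-weaken : ∀ {p m A B} → A ≋ B [ p ℕ.* m ] → A ≋ B [ m ]
    ≋[]-weaken {p} {m} (mk h) = mk λ i j → ≡[]-weaken {p} {m} (h i j)

    -- Γ and Δ of the overview are `W zs` and `W gs`. As `zs` is contained in `gs`, the two rank
    -- conditions fix the rank of both at `v`.
    module Segment {p : ℕ} (pp : Prime p) (p∤D : ¬ p ∣ D) (zs gs : List G) (v : ℕ) (sub : ∀ {g} → g ∈ zs → g ∈ gs)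
      (rank : AtPrime.Rank≥ pp p∤D zs v) (¬rank : ¬ AtPrime.Rank≥ pp p∤D gs (suc v)) where

      private
        module P = AtPrime pp p∤D

      q : ℕ
      q = p ^ suc (P.level sub rank ¬rank)

      codeᴳ : G → Fin (length (allVec q (N ℕ.* N)))
      codeᴳ = code (P.2≤p^ (P.level sub rank ¬rank)) (P.p^-coprime (suc (P.level sub rank ¬rank)))

      same-code⇒C : ∀ {x y} → W gs x → W gs y → codeᴳ x ≡ codeᴳ y → C zs (x ⁻¹ ∙ y)
      same-code⇒C {x} {y} wx wy eq = P.equal-rank⇒closure sub rank ¬rank {x ⁻¹ ∙ y} (mul (inv wx) wy)
        (⁻¹∙≋I {q} x y (code-sound (P.2≤p^ (P.level sub rank ¬rank)) (P.p^-coprime (suc (P.level sub rank ¬rank))) x y eq))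

      H : G → Set
      H x = W gs x × C zs x

      same-code⇒H : ∀ {x y} → W gs x → W gs y → codeᴳ x ≡ codeᴳ y → H (x ⁻¹ ∙ y)
      same-code⇒H {x} {y} wx wy eq = mul (inv wx) wy , same-code⇒C {x} {y} wx wy eq

      H-subgroup : IsSubgroup (GL-group N) H
      H-subgroup = record
        { resp = λ {x} {y} e (w , c) → resp e w , C-resp {zs} {x} {y} e c
        ; ε∈   = one , W⊆C one
        ; ∙∈   = λ {x} {y} (w , c) (w′ , c′) → mul w w′ , C-∙ {zs} {x} {y} c c′
        ; ⁻¹∈  = λ {x} (w , c) → inv w , finite-order-inverse (GL-group N) {W gs} {C zs} (W-subgroup gs)
                   (λ {x} {y} → C-resp {zs} {x} {y}) (W⊆C one) (λ {x} {y} → C-∙ {zs} {x} {y}) codeᴳ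
                   (λ {x} {y} → same-code⇒C {x} {y}) {x} w c
        }

      System : ℕ → Set
      System = CosetSystem (GL-group N) (W gs) H

      private
        unconjugate : ∀ {us x g y} → W us x → W us y → C us (x ⁻¹ ∙ (g ∙ y)) → C us g
        unconjugate {us} {x} {g} {y} wx wy c = C-resp {us} {x ∙ ((x ⁻¹ ∙ (g ∙ y)) ∙ y ⁻¹)} {g}
          (trans {x ∙ ((x ⁻¹ ∙ (g ∙ y)) ∙ y ⁻¹)} {x ∙ (x ⁻¹ ∙ g)} {g}
            (∙-congˡ {x} {(x ⁻¹ ∙ (g ∙ y)) ∙ y ⁻¹} {x ⁻¹ ∙ g}
              (trans {(x ⁻¹ ∙ (g ∙ y)) ∙ y ⁻¹} {x ⁻¹ ∙ ((g ∙ y) ∙ y ⁻¹)} {x ⁻¹ ∙ g} (assoc (x ⁻¹) (g ∙ y) (y ⁻¹))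
                (∙-congˡ {x ⁻¹} {(g ∙ y) ∙ y ⁻¹} {g} (//-rightDividesʳ y g))))
            (\\-leftDividesˡ x g))
          (C-∙ {us} {x} {(x ⁻¹ ∙ (g ∙ y)) ∙ y ⁻¹} (W⊆C wx) (C-∙ {us} {x ⁻¹ ∙ (g ∙ y)} {y ⁻¹} c (W⊆C (inv wy))))
          where
          open Group (GL-group N) using (trans; ∙-congˡ; assoc)
          open Algebra.Properties.Group (GL-group N)

      -- Let `x` and `z` lie in the group of the older generators. If `x` and `y ∙ z` shared a coset
      -- of `H`, then `x ⁻¹ ∙ (y ∙ z)` and hence `y` would lie in the closure of that group, against
      -- the chain condition. So each generator doubles the system.
      grow : ∀ ys → Chain (ys ++ zs) → CosetSystem (GL-group N) (W (ys ++ zs)) H (2 ^ length ys)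
      grow []       _           = system-1 (GL-group N) H-subgroup {W zs} one
      grow (y ∷ ys) (y∉ , rest) = subst (CosetSystem (GL-group N) (W (y ∷ ys ++ zs)) H) (cong (2 ^ length ys ℕ.+_) (≡.sym (ℕ.+-identityʳ _)))
        (double (GL-group N) H-subgroup {W (ys ++ zs)} {W (y ∷ ys ++ zs)} y (W-mono there) (λ w → mul (gen (here ≡.refl)) (W-mono there w))
          (λ {x} {z} wx wz h → y∉ (unconjugate {ys ++ zs} {x} {y} {z} wx wz (C-mono (∈-++⁺ʳ ys) {x ⁻¹ ∙ (y ∙ z)} (proj₂ h))))
          (grow ys rest))

      maximal : ¬ ¬ (∃ λ k → System k × ¬ System (suc k))
      maximal = ¬¬-maximum System _ (system-≤ (GL-group N) H-subgroup {W gs} z≤n (system-1 (GL-group N) H-subgroup {W gs} one))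
        (λ {n} → system-bound (GL-group N) H-subgroup {W gs} {n} codeᴳ (λ {x} {y} → same-code⇒H {x} {y}))

      module Maximal {k : ℕ} (sys : System k) (max : ¬ System (suc k)) where

        module _ {p′ : ℕ} (pp′ : Prime p′) (p′∤D : ¬ p′ ∣ D) (k<p′ : k < p′) where

          private
            module P′ = AtPrime pp′ p′∤D

          -- Some x^b with 1 ≤ b ≤ k lies in H; as b is prime to p′, the powers of x^b accumulate p′-adically at x.
          kernel⊆H : ∀ {x} → W gs x → mat x ≋ I [ p′ ^ 1 ] → C zs x
          kernel⊆H {x} w h = P′.C-closed {zs} {x} λ s none → power∈ (GL-group N) H-subgroup {W gs} (W-subgroup gs) sys max {x} w λ (b , b<k , (_ , c)) →
            let (z , r , eq) = inverse-mod {suc b} {p′ ^ suc s} (P′.2≤p^ s)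
                                 (coprime-^ʳ (coprime-sym (prime⇒coprime pp′ (ℕ.≤-<-trans b<k k<p′))) (suc s))
            in none ((x ^ᴳ suc b) ^ᴳ z , C-pow {zs} {x ^ᴳ suc b} z c , near s (suc b) z r eq)
            where
            near : ∀ s b z r → z ℕ.* b ≡ 1 ℕ.+ r ℕ.* p′ ^ suc s → mat x ≋ mat ((x ^ᴳ b) ^ᴳ z) [ p′ ^ suc s ]
            near s b z r eq = ≋[]-sym (≋[]-trans {p′ ^ suc s} {mat ((x ^ᴳ b) ^ᴳ z)} {mat (x ∙ (x ^ᴳ (p′ ^ suc s)) ^ᴳ r)} {mat x}
              (≋⇒≋[] (λ i j → R.trans (×ᴳ-assocˡ x z b i j) (R.trans (R.reflexive (cong (λ m → mat (x ^ᴳ m) i j) eq))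
                (·-cong (≋-refl {A = mat x}) (≋-sym (×ᴳ-assocˡ x r (p′ ^ suc s))) i j))))
              (≋[]-trans {p′ ^ suc s} {mat (x ∙ (x ^ᴳ (p′ ^ suc s)) ^ᴳ r)} {mat (x ∙ ε)} {mat x}
                (∙-≋[] {p′ ^ suc s} {x} {x} {(x ^ᴳ (p′ ^ suc s)) ^ᴳ r} {ε} ≋[]-refl
                  (pow≋I {p′ ^ suc s} {x ^ᴳ (p′ ^ suc s)} (≋[]-weaken {p′} {p′ ^ suc s} (P′.pow-≋I {x} h (suc s))) r))
                (≋⇒≋[] (·-identityʳ (mat x)))))
              where module R = CommutativeRing R

          private
            module Act = P′.Action N

            reduce : G → Mat.GL P′.𝔽 N
            reduce x = Q.gl (mat x) (imat x) (_≋_[_].entry (≋⇒≋[] {p′} (right x))) (_≋_[_].entry (≋⇒≋[] {p′} (left x)))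

          private
            actᴳ : G → Fin Act.size → Fin Act.size
            actᴳ x = Act.act (reduce x)

            actᴳ-≈ : ∀ {x y} → x ≈ᴳ y → ∀ i → actᴳ x i ≡ actᴳ y i
            actᴳ-≈ {x} {y} e = Act.act-≈ {reduce x} {reduce y} (_≋_[_].entry (≋⇒≋[] {p′} {mat x} {mat y} e))

            actᴳ-ε : ∀ i → actᴳ ε i ≡ i
            actᴳ-ε i = ≡.trans (Act.act-≈ {reduce ε} {Group.ε (Mat.GL-group P′.𝔽 N)} (λ i j → Q.refl p′) i) (Act.act-ε i)

            actᴳ-∙ : ∀ x y i → actᴳ (x ∙ y) i ≡ actᴳ x (actᴳ y i)
            actᴳ-∙ x y i = ≡.trans
              (Act.act-≈ {reduce (x ∙ y)} {Group._∙_ (Mat.GL-group P′.𝔽 N) (reduce x) (reduce y)} (λ i j → Q.refl p′) i)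
              (Act.act-∙ (reduce x) (reduce y) i)

            -- Elements that agree on one basis are congruent modulo `p′`, and `kernel⊆H` puts their
            -- quotient into `H`: the freeness modulo `H` that `index∣` asks for.
            actᴳ-free : ∀ {x y} i → W gs x → W gs y → actᴳ x i ≡ actᴳ y i → H (x ⁻¹ ∙ y)
            actᴳ-free {x} {y} i wx wy eq = mul (inv wx) wy , kernel⊆H {x ⁻¹ ∙ y} (mul (inv wx) wy)
              (⁻¹∙≋I {p′ ^ 1} x y (subst (mat x ≋ mat y [_]) (≡.sym (ℕ.*-identityʳ p′)) (mk (Act.act-free (reduce x) (reduce y) i eq))))

            index∣size : ¬ ¬ (k ∣ Act.size)
            index∣size = index∣ (GL-group N) (W-subgroup gs) H-subgroup actᴳ (λ {x} {y} → actᴳ-≈ {x} {y}) actᴳ-ε actᴳ-∙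
              (λ {x} {y} → actᴳ-free {x} {y}) (proj₁ sys) (proj₁ (proj₂ sys))
              (λ {x} → system-covers (GL-group N) H-subgroup {W gs} sys max {x}) (proj₂ (proj₂ sys))

          index∣count : k ∣ tupleCount p′ N N
          index∣count = decidable-stable (k ∣? tupleCount p′ N N) λ n → index∣size λ k∣size → n (subst (k ∣_) Act.size≡ k∣size)

        index-bound : ∀ ys → gs ≡ ys ++ zs → Chain (ys ++ zs) → length ys ≤ stepBound N
        index-bound ys ≡.refl chain = 2^-cancel-≤ (ℕ.≤-trans 2^≤k (ℕ.≤-trans
          (minkowski-bound {k} {N} {N !} {D} (ℕ.≤-trans (1≤^ {2} (s≤s z≤n) (length ys)) 2^≤k) 1≤N 1≤D (1≤! N) ∣! (λ p pp p∤D k<p → index∣count pp p∤D k<p))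
          (ℕ.≤-trans (ℕ.^-monoˡ-≤ (N ! ℕ.* N) 6≤8) (ℕ.≤-reflexive (ℕ.^-*-assoc 2 3 (N ! ℕ.* N))))))
          where
          2^≤k : 2 ^ length ys ≤ k
          2^≤k = ℕ.≮⇒≥ λ k< → max (system-≤ (GL-group N) H-subgroup {W gs} k< (grow ys chain))
          -- Rounding 6 up to 8, the cube of 2, lets the exponents be compared; this is the 3 in
          -- `stepBound`.
          6≤8 : 6 ≤ 8
          6≤8 = ℕ.m≤m+n 6 2

      segment-bound : ∀ ys → gs ≡ ys ++ zs → Chain (ys ++ zs) → length ys ≤ stepBound N
      segment-bound ys eq chain = decidable-stable (length ys ℕ.≤? stepBound N) λ k → maximal λ (_ , sys , max) →
        k (Maximal.index-bound sys max ys eq chain)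

    module _ {p : ℕ} (pp : Prime p) (p∤D : ¬ p ∣ D) where
      private
        module P = AtPrime pp p∤D

      Chain-++ : ∀ ys {zs} → Chain (ys ++ zs) → Chain zs
      Chain-++ []       c       = c
      Chain-++ (y ∷ ys) (_ , c) = Chain-++ ys c

      -- If the newest `suc (stepBound N)` generators left the rank at `v`, they would form a single
      -- segment, which `segment-bound` forbids. Hence every such block raises the rank by at least
      -- one.
      rank-grows : ∀ v gs → Chain gs → v ℕ.* suc (stepBound N) ≤ length gs → ¬ ¬ P.Rank≥ gs v
      rank-grows zero    gs chain le ¬rank = ¬rank (P.rank-0 gs)
      rank-grows (suc v) gs chain le ¬rank = rank-grows v zs (Chain-++ ys chain′) zs-long λ rank →
        ℕ.<⇒≱ ys-long (Segment.segment-bound pp p∤D zs gs v (λ {g} z → subst (g ∈_) split (∈-++⁺ʳ ys z)) rank ¬rank ys (≡.sym split) chain′)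
        where
        L = suc (stepBound N)
        ys = take L gs
        zs = drop L gs
        split : ys ++ zs ≡ gs
        split = take++drop≡id L gs
        chain′ : Chain (ys ++ zs)
        chain′ = subst Chain (≡.sym split) chain
        zs-long : v ℕ.* L ≤ length zs
        zs-long = subst (v ℕ.* L ≤_) (≡.sym (length-drop L gs)) (ℕ.m+n≤o⇒m≤o∸n (v ℕ.* L) (subst (_≤ length gs) (ℕ.+-comm L (v ℕ.* L)) le))
        ys-long : stepBound N < length ys
        ys-long = subst (L ≤_) (≡.sym (length-take L gs)) (ℕ.⊓-glb ℕ.≤-refl (ℕ.≤-trans (ℕ.m≤m+n L (v ℕ.* L)) le))

    -- The rank is at most `N * N`, so one block more than that cannot fit into the chain.
    chain-bound : ∀ gs → Chain gs → length gs < suc (N ℕ.* N) ℕ.* suc (stepBound N)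
    chain-bound gs chain = ℕ.≰⇒> λ le → let (p , pp , p∤D) = prime∤ D 1≤D in
      rank-grows pp p∤D (suc (N ℕ.* N)) gs chain le λ rank → ℕ.1+n≰n (AtPrime.rank-bound pp p∤D rank)

-- The rings ℤ[1/D] and their residues.

module Localisations where

  open import Level using (0ℓ)
  open import Algebra.Bundles using (CommutativeRing)
  open import Data.Integer as ℤ using (ℤ; +_; ∣_∣)
  import Data.Integer.Properties as ℤ
  open import Data.Integer.DivMod using (_%ℕ_; _/ℕ_; n%ℕd<d; a≡a%ℕn+[a/ℕn]*n)
  import Data.Integer.Solver
  open import Data.Nat as ℕ using (ℕ; zero; suc; _≤_; _<_; _^_; s≤s; z≤n)
  import Data.Nat.Properties as ℕ
  open import Data.Nat.Coprimality using (Coprime; coprime-divisor) renaming (sym to coprime-sym)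
  open import Data.Nat.Divisibility using (_∣_; divides; ∣⇒≤)
  open import Data.Product using (Σ; ∃; _×_; _,_; proj₁; proj₂)
  open import Data.Rational as ℚ using (ℚ; mkℚ; 0ℚ; 1ℚ)
  import Data.Rational.Properties as ℚ
  open import Data.Rational.Unnormalised as ℚᵘ using (mkℚᵘ; *≡*)
  import Data.Rational.Unnormalised.Properties as ℚᵘ
  open import Relation.Binary.PropositionalEquality as ≡ using (_≡_; cong; cong₂; subst; module ≡-Reasoning)
  open import Relation.Nullary using (¬_; contradiction; yes; no)
  open Arithmetic
  open Matrices
  open Congruences using (module Numeral)

  ℚ-ring : CommutativeRing 0ℓ 0ℓ
  ℚ-ring = ℚ.+-*-commutativeRing

  module Mℚ = Mat ℚ-ring

  -- Stated for an arbitrary ring because the solver would unfold the arithmetic of ℚ.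
  module Identities (R : CommutativeRing 0ℓ 0ℓ) where
    open CommutativeRing R
    open RingSolver R

    cross-+ : ∀ e f x y → (e * f) * (x + y) ≈ f * (e * x) + e * (f * y)
    cross-+ = solve 4 (λ e f x y → ((e :* f) :* (x :+ y)) := (f :* (e :* x) :+ e :* (f :* y))) refl

    cross-* : ∀ e f x y → (e * f) * (x * y) ≈ (e * x) * (f * y)
    cross-* = solve 4 (λ e f x y → ((e :* f) :* (x :* y)) := ((e :* x) :* (f :* y))) refl

    expand : ∀ d y m c → d * (y + m * c) ≈ d * y + m * (d * c)
    expand = solve 4 (λ d y m c → (d :* (y :+ m :* c)) := (d :* y :+ m :* (d :* c))) refl

    rotate : ∀ f e x → f * (e * x) ≈ (f * x) * e
    rotate = solve 3 (λ f e x → (f :* (e :* x)) := ((f :* x) :* e)) refl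

  open Identities ℚ-ring

  opaque
    fromℤ : ℤ → ℚ
    fromℤ z = ℚ.fromℚᵘ (mkℚᵘ z 0)

    private
      toℚᵘ-fromℤ : ∀ z → ℚ.toℚᵘ (fromℤ z) ℚᵘ.≃ mkℚᵘ z 0
      toℚᵘ-fromℤ z = ℚ.toℚᵘ-fromℚᵘ (mkℚᵘ z 0)

    fromℤ-+ : ∀ a b → fromℤ (a ℤ.+ b) ≡ fromℤ a ℚ.+ fromℤ b
    fromℤ-+ a b = ℚ.toℚᵘ-injective (ℚᵘ.≃-trans (toℚᵘ-fromℤ (a ℤ.+ b)) (ℚᵘ.≃-sym
      (ℚᵘ.≃-trans (ℚ.toℚᵘ-homo-+ (fromℤ a) (fromℤ b)) (ℚᵘ.≃-trans (ℚᵘ.+-cong (toℚᵘ-fromℤ a) (toℚᵘ-fromℤ b))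
        (*≡* (cong (ℤ._* + 1) (cong₂ ℤ._+_ (ℤ.*-identityʳ a) (ℤ.*-identityʳ b))))))))

    fromℤ-* : ∀ a b → fromℤ (a ℤ.* b) ≡ fromℤ a ℚ.* fromℤ b
    fromℤ-* a b = ℚ.toℚᵘ-injective (ℚᵘ.≃-trans (toℚᵘ-fromℤ (a ℤ.* b)) (ℚᵘ.≃-sym
      (ℚᵘ.≃-trans (ℚ.toℚᵘ-homo-* (fromℤ a) (fromℤ b)) (ℚᵘ.*-cong (toℚᵘ-fromℤ a) (toℚᵘ-fromℤ b)))))

    fromℤ-neg : ∀ a → fromℤ (ℤ.- a) ≡ ℚ.- fromℤ a
    fromℤ-neg a = ℚ.toℚᵘ-injective (ℚᵘ.≃-trans (toℚᵘ-fromℤ (ℤ.- a)) (ℚᵘ.≃-sym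
      (ℚᵘ.≃-trans (ℚ.toℚᵘ-homo‿- (fromℤ a)) (ℚᵘ.-‿cong (toℚᵘ-fromℤ a)))))

    fromℤ-0 : fromℤ (+ 0) ≡ 0ℚ
    fromℤ-0 = ≡.refl

    fromℤ-1 : fromℤ (+ 1) ≡ 1ℚ
    fromℤ-1 = ≡.refl

    fromℤ-injective : ∀ {a b} → fromℤ a ≡ fromℤ b → a ≡ b
    fromℤ-injective {a} {b} eq with ℚᵘ.≃-trans (ℚᵘ.≃-sym (toℚᵘ-fromℤ a)) (ℚᵘ.≃-trans (ℚ.toℚᵘ-cong eq) (toℚᵘ-fromℤ b))
    ... | *≡* e = ≡.trans (≡.sym (ℤ.*-identityʳ a)) (≡.trans e (ℤ.*-identityʳ b))

    clear-denominator : ∀ q → fromℤ (+ ℚ.denominatorℕ q) ℚ.* q ≡ fromℤ (ℚ.numerator q)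
    clear-denominator q@(mkℚ n d-1 _) = ℚ.toℚᵘ-injective (ℚᵘ.≃-trans (ℚ.toℚᵘ-homo-* (fromℤ (+ suc d-1)) q)
      (ℚᵘ.≃-trans (ℚᵘ.*-cong (toℚᵘ-fromℤ (+ suc d-1)) ℚᵘ.≃-refl) (ℚᵘ.≃-trans
        (*≡* (≡.trans (ℤ.*-identityʳ _) (≡.trans (ℤ.*-comm (+ suc d-1) n) (cong (λ m → n ℤ.* + m) (≡.sym (ℕ.+-identityʳ (suc d-1)))))))
        (ℚᵘ.≃-sym (toℚᵘ-fromℤ n)))))

  inverseℚ : ∀ q → ¬ q ≡ 0ℚ → ∃ λ r → q ℚ.* r ≡ 1ℚ
  inverseℚ q q≢0 = ℚ.1/_ q {{ℚ.≢-nonZero q≢0}} , ℚ.*-inverseʳ q {{ℚ.≢-nonZero q≢0}}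

  *-cancelˡ : ∀ r {x y} → ¬ r ≡ 0ℚ → r ℚ.* x ≡ r ℚ.* y → x ≡ y
  *-cancelˡ r {x} {y} r≢0 eq = ≡.trans (≡.sym (undo x)) (≡.trans (cong (s ℚ.*_) eq) (undo y))
    where
    s = proj₁ (inverseℚ r r≢0)
    undo : ∀ z → s ℚ.* (r ℚ.* z) ≡ z
    undo z = ≡.trans (≡.sym (ℚ.*-assoc s r z)) (≡.trans (cong (ℚ._* z) (≡.trans (ℚ.*-comm s r) (proj₂ (inverseℚ r r≢0)))) (ℚ.*-identityˡ z))

  module Localisation (D : ℕ) (1≤D : 1 ≤ D) where

    D^ : ℕ → ℚ
    D^ e = fromℤ (+ (D ^ e))

    D^≢0 : ∀ e → ¬ D^ e ≡ 0ℚ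
    D^≢0 e eq = ℕ.>⇒≢ (1≤^ 1≤D e) (ℤ.+-injective (fromℤ-injective (≡.trans eq (≡.sym fromℤ-0))))

    D^-+ : ∀ e f → D^ (e ℕ.+ f) ≡ D^ e ℚ.* D^ f
    D^-+ e f = ≡.trans (cong (λ m → fromℤ (+ m)) (ℕ.^-distribˡ-+-* D e f)) (≡.trans (cong fromℤ (ℤ.pos-* (D ^ e) (D ^ f))) (fromℤ-* _ _))

    -- Membership in ℤ[1/D] with any exponent, not only the least; equality in `ring` ignores the
    -- chosen exponent and numerator.
    Local : ℚ → Set
    Local q = ∃ λ e → ∃ λ a → D^ e ℚ.* q ≡ fromℤ a

    local-fromℤ : ∀ a → Local (fromℤ a)
    local-fromℤ a = 0 , a , ≡.trans (cong (ℚ._* fromℤ a) fromℤ-1) (ℚ.*-identityˡ _)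

    local-+ : ∀ {x y} → Local x → Local y → Local (x ℚ.+ y)
    local-+ {x} {y} (e , a , p) (f , b , q) = e ℕ.+ f , + (D ^ f) ℤ.* a ℤ.+ + (D ^ e) ℤ.* b ,
      ≡.trans (cong (ℚ._* (x ℚ.+ y)) (D^-+ e f))
        (≡.trans (cross-+ (D^ e) (D^ f) x y)
          (≡.trans (cong₂ (λ u v → D^ f ℚ.* u ℚ.+ D^ e ℚ.* v) p q)
            (≡.sym (≡.trans (fromℤ-+ (+ (D ^ f) ℤ.* a) (+ (D ^ e) ℤ.* b)) (cong₂ ℚ._+_ (fromℤ-* (+ (D ^ f)) a) (fromℤ-* (+ (D ^ e)) b))))))

    local-* : ∀ {x y} → Local x → Local y → Local (x ℚ.* y)
    local-* {x} {y} (e , a , p) (f , b , q) = e ℕ.+ f , a ℤ.* b ,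
      ≡.trans (cong (ℚ._* (x ℚ.* y)) (D^-+ e f))
        (≡.trans (cross-* (D^ e) (D^ f) x y)
          (≡.trans (cong₂ ℚ._*_ p q) (≡.sym (fromℤ-* a b))))

    local-neg : ∀ {x} → Local x → Local (ℚ.- x)
    local-neg {x} (e , a , p) = e , ℤ.- a , ≡.trans (≡.sym (ℚ.neg-distribʳ-* (D^ e) x)) (≡.trans (cong (λ y → ℚ.- y) p) (≡.sym (fromℤ-neg a)))

    ring : CommutativeRing 0ℓ 0ℓ
    ring = record
      { Carrier = Σ ℚ Local
      ; _≈_ = λ x y → proj₁ x ≡ proj₁ y
      ; _+_ = λ (x , p) (y , q) → x ℚ.+ y , local-+ p q
      ; _*_ = λ (x , p) (y , q) → x ℚ.* y , local-* p q
      ; -_ = λ (x , p) → ℚ.- x , local-neg p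
      ; 0# = 0ℚ , subst Local fromℤ-0 (local-fromℤ (+ 0))
      ; 1# = 1ℚ , subst Local fromℤ-1 (local-fromℤ (+ 1))
      ; isCommutativeRing = record
        { isRing = record
          { +-isAbelianGroup = record
            { isGroup = record
              { isMonoid = record
                { isSemigroup = record
                  { isMagma = record
                    { isEquivalence = record { refl = ≡.refl ; sym = ≡.sym ; trans = ≡.trans }
                    ; ∙-cong = cong₂ ℚ._+_ }
                  ; assoc = λ (x , _) (y , _) (z , _) → ℚ.+-assoc x y z }
                ; identity = (λ (x , _) → ℚ.+-identityˡ x) , (λ (x , _) → ℚ.+-identityʳ x) }
              ; inverse = (λ (x , _) → ℚ.+-inverseˡ x) , (λ (x , _) → ℚ.+-inverseʳ x)
              ; ⁻¹-cong = cong (λ y → ℚ.- y) }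
            ; comm = λ (x , _) (y , _) → ℚ.+-comm x y }
          ; *-cong = cong₂ ℚ._*_
          ; *-assoc = λ (x , _) (y , _) (z , _) → ℚ.*-assoc x y z
          ; *-identity = (λ (x , _) → ℚ.*-identityˡ x) , (λ (x , _) → ℚ.*-identityʳ x)
          ; distrib = (λ (x , _) (y , _) (z , _) → ℚ.*-distribˡ-+ x y z) , (λ (x , _) (y , _) (z , _) → ℚ.*-distribʳ-+ x y z) }
        ; *-comm = λ (x , _) (y , _) → ℚ.*-comm x y } }

    open Numeral ring
    open Quotient ring

    proj₁-⟦⟧ : ∀ n → proj₁ ⟦ n ⟧ ≡ fromℤ (+ n)
    proj₁-⟦⟧ zero    = ≡.trans ⟦0⟧ (≡.sym fromℤ-0)
    proj₁-⟦⟧ (suc n) = ≡.trans (⟦suc⟧ n) (≡.trans (cong₂ ℚ._+_ (≡.sym fromℤ-1) (proj₁-⟦⟧ n)) (≡.sym (fromℤ-+ (+ 1) (+ n))))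

    opaque
      -- Multiplying by a power of `D` that clears the denominator of the quotient `c` turns the
      -- error term into an integral multiple of `m`.
      ≡[]⇒ℤ : ∀ {m x y} → x ≡ y [ ⟦ m ⟧ ] → ∃ λ f → ∃ λ b → D^ f ℚ.* proj₁ x ≡ D^ f ℚ.* proj₁ y ℚ.+ fromℤ (+ m ℤ.* b)
      ≡[]⇒ℤ {m} {x} {y} ((c , f , b , eqc) , eq) = f , b ,
        ≡.trans (cong (D^ f ℚ.*_) (≡.trans eq (cong (λ u → proj₁ y ℚ.+ u ℚ.* c) (proj₁-⟦⟧ m))))
          (≡.trans (expand (D^ f) (proj₁ y) (fromℤ (+ m)) c)
            (cong (D^ f ℚ.* proj₁ y ℚ.+_) (≡.trans (cong (fromℤ (+ m) ℚ.*_) eqc) (≡.sym (fromℤ-* (+ m) b)))))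

    private
      over-D^ : ∀ e t → ∃ λ (c : Σ ℚ Local) → D^ e ℚ.* proj₁ c ≡ fromℤ t
      over-D^ e t = (r ℚ.* fromℤ t , e , t , eq) , eq
        where
        r = proj₁ (inverseℚ (D^ e) (D^≢0 e))
        eq : D^ e ℚ.* (r ℚ.* fromℤ t) ≡ fromℤ t
        eq = ≡.trans (≡.sym (ℚ.*-assoc (D^ e) r (fromℤ t))) (≡.trans (cong (ℚ._* fromℤ t) (proj₂ (inverseℚ (D^ e) (D^≢0 e)))) (ℚ.*-identityˡ _))

      -- The remainder `c` of `w * a` works when `w` inverts `d` modulo `m`. Applied with `d` a
      -- power of `D`, it gives the residue of the fraction a/d.
      ℤ-residue : ∀ {m d} → 2 ≤ m → Coprime d m → ∀ a → ∃ λ c → c < m × ∃ λ t → a ≡ + d ℤ.* + c ℤ.+ + m ℤ.* t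
      ℤ-residue {m@(suc _)} {d} 2≤m cop a with inverse-mod 2≤m cop
      ... | w , r , eq = c , n%ℕd<d b m , + d ℤ.* u ℤ.- + r ℤ.* a ,
        (begin
          a                                                          ≡⟨ lem₁ a (+ r) (+ m) ⟩
          (+ 1 ℤ.+ + r ℤ.* + m) ℤ.* a ℤ.- + r ℤ.* + m ℤ.* a          ≡⟨ cong (λ y → y ℤ.* a ℤ.- + r ℤ.* + m ℤ.* a) wd≡ ⟨
          + w ℤ.* + d ℤ.* a ℤ.- + r ℤ.* + m ℤ.* a                    ≡⟨ lem₂ (+ w) (+ d) a (+ r) (+ m) ⟩
          + d ℤ.* b ℤ.- + r ℤ.* + m ℤ.* a                            ≡⟨ cong (λ y → + d ℤ.* y ℤ.- + r ℤ.* + m ℤ.* a) (a≡a%ℕn+[a/ℕn]*n b m) ⟩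
          + d ℤ.* (+ c ℤ.+ u ℤ.* + m) ℤ.- + r ℤ.* + m ℤ.* a          ≡⟨ lem₃ (+ d) (+ c) u (+ m) (+ r) a ⟩
          + d ℤ.* + c ℤ.+ + m ℤ.* (+ d ℤ.* u ℤ.- + r ℤ.* a)          ∎)
        where
        open ≡-Reasoning
        open Data.Integer.Solver.+-*-Solver renaming (solve to solveℤ; _:=_ to _:=ℤ_; _:+_ to _:+ℤ_; _:*_ to _:*ℤ_; _:-_ to _:-ℤ_; con to conℤ)
        b = + w ℤ.* a
        c = b %ℕ m
        u = b /ℕ m
        wd≡ : + w ℤ.* + d ≡ + 1 ℤ.+ + r ℤ.* + m
        wd≡ = ≡.trans (≡.sym (ℤ.pos-* w d)) (≡.trans (cong +_ eq) (cong (λ y → + 1 ℤ.+ y) (ℤ.pos-* r m)))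
        lem₁ : ∀ a r m → a ≡ (+ 1 ℤ.+ r ℤ.* m) ℤ.* a ℤ.- r ℤ.* m ℤ.* a
        lem₁ = solveℤ 3 (λ a r m → a :=ℤ ((conℤ (+ 1) :+ℤ r :*ℤ m) :*ℤ a :-ℤ r :*ℤ m :*ℤ a)) ≡.refl
        lem₂ : ∀ w d a r m → w ℤ.* d ℤ.* a ℤ.- r ℤ.* m ℤ.* a ≡ d ℤ.* (w ℤ.* a) ℤ.- r ℤ.* m ℤ.* a
        lem₂ = solveℤ 5 (λ w d a r m → (w :*ℤ d :*ℤ a :-ℤ r :*ℤ m :*ℤ a) :=ℤ (d :*ℤ (w :*ℤ a) :-ℤ r :*ℤ m :*ℤ a)) ≡.refl
        lem₃ : ∀ d c u m r a → d ℤ.* (c ℤ.+ u ℤ.* m) ℤ.- r ℤ.* m ℤ.* a ≡ d ℤ.* c ℤ.+ m ℤ.* (d ℤ.* u ℤ.- r ℤ.* a)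
        lem₃ = solveℤ 6 (λ d c u m r a → (d :*ℤ (c :+ℤ u :*ℤ m) :-ℤ r :*ℤ m :*ℤ a) :=ℤ (d :*ℤ c :+ℤ m :*ℤ (d :*ℤ u :-ℤ r :*ℤ a))) ≡.refl

      fromℤ-eq : ∀ f a c m b → D^ f ℚ.* fromℤ a ≡ D^ f ℚ.* fromℤ c ℚ.+ fromℤ (m ℤ.* b) → + (D ^ f) ℤ.* (a ℤ.- c) ≡ m ℤ.* b
      fromℤ-eq f a c m b eq = ≡.trans (lem (+ (D ^ f)) a c)
        (≡.trans (cong (ℤ._- + (D ^ f) ℤ.* c) (fromℤ-injective (≡.trans (fromℤ-* (+ (D ^ f)) a) (≡.trans eq
          (≡.trans (cong (ℚ._+ fromℤ (m ℤ.* b)) (≡.sym (fromℤ-* (+ (D ^ f)) c))) (≡.sym (fromℤ-+ _ (m ℤ.* b))))))))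
          (lem′ (+ (D ^ f) ℤ.* c) (m ℤ.* b)))
        where
        open Data.Integer.Solver.+-*-Solver renaming (solve to solveℤ; _:=_ to _:=ℤ_; _:+_ to _:+ℤ_; _:*_ to _:*ℤ_; _:-_ to _:-ℤ_)
        lem : ∀ d a c → d ℤ.* (a ℤ.- c) ≡ d ℤ.* a ℤ.- d ℤ.* c
        lem = solveℤ 3 (λ d a c → (d :*ℤ (a :-ℤ c)) :=ℤ (d :*ℤ a :-ℤ d :*ℤ c)) ≡.refl
        lem′ : ∀ x y → x ℤ.+ y ℤ.- x ≡ y
        lem′ = solveℤ 2 (λ x y → (x :+ℤ y :-ℤ x) :=ℤ y) ≡.refl

      ∣D^*⇒∣ : ∀ {m} f z b → Coprime m D → + (D ^ f) ℤ.* z ≡ + m ℤ.* b → m ∣ ∣ z ∣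
      ∣D^*⇒∣ {m} f z b cop eq = coprime-divisor (coprime-^ʳ cop f)
        (divides ∣ b ∣ (≡.trans (≡.sym (ℤ.abs-* (+ (D ^ f)) z)) (≡.trans (cong ∣_∣ eq) (≡.trans (ℤ.abs-* (+ m) b) (ℕ.*-comm m ∣ b ∣)))))

      residueᴸ : ∀ {m} → 2 ≤ m → Coprime m D → ∀ x → ∃ λ c → c < m × x ≡ ⟦ c ⟧ [ ⟦ m ⟧ ]
      residueᴸ {m} 2≤m cop (x , e , a , eq) with ℤ-residue 2≤m (coprime-sym (coprime-^ʳ cop e)) a
      ... | c , c<m , t , a≡ with over-D^ e t
      ...   | y , y≡ = c , c<m , y , *-cancelˡ (D^ e) (D^≢0 e) (begin
        D^ e ℚ.* x                                       ≡⟨ eq ⟩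
        fromℤ a                                          ≡⟨ cong fromℤ a≡ ⟩
        fromℤ (+ (D ^ e) ℤ.* + c ℤ.+ + m ℤ.* t)          ≡⟨ ≡.trans (fromℤ-+ _ (+ m ℤ.* t)) (cong₂ ℚ._+_ (fromℤ-* (+ (D ^ e)) (+ c)) (fromℤ-* (+ m) t)) ⟩
        D^ e ℚ.* fromℤ (+ c) ℚ.+ fromℤ (+ m) ℚ.* fromℤ t ≡⟨ cong (λ u → D^ e ℚ.* fromℤ (+ c) ℚ.+ fromℤ (+ m) ℚ.* u) y≡ ⟨
        D^ e ℚ.* fromℤ (+ c) ℚ.+ fromℤ (+ m) ℚ.* (D^ e ℚ.* proj₁ y)
          ≡⟨ expand (D^ e) (fromℤ (+ c)) (fromℤ (+ m)) (proj₁ y) ⟨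
        D^ e ℚ.* (fromℤ (+ c) ℚ.+ fromℤ (+ m) ℚ.* proj₁ y)
          ≡⟨ cong₂ (λ u v → D^ e ℚ.* (u ℚ.+ v ℚ.* proj₁ y)) (proj₁-⟦⟧ c) (proj₁-⟦⟧ m) ⟨
        D^ e ℚ.* (proj₁ ⟦ c ⟧ ℚ.+ proj₁ ⟦ m ⟧ ℚ.* proj₁ y) ∎)
        where open ≡-Reasoning

      ∣difference∣⇒≡ : ∀ {m c d} → c < m → d < m → m ∣ ∣ + c ℤ.- + d ∣ → c ≡ d
      ∣difference∣⇒≡ {m} {c} {d} c<m d<m m∣ with ∣ + c ℤ.- + d ∣ in z≡
      ... | zero  = ℤ.+-injective (ℤ.i-j≡0⇒i≡j (+ c) (+ d) (ℤ.∣i∣≡0⇒i≡0 z≡))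
      ... | suc z = contradiction (∣⇒≤ m∣) (ℕ.<⇒≱ (subst (_< m) z≡ (ℕ.≤-<-trans
                      (subst (_≤ c ℕ.⊔ d) (cong ∣_∣ (≡.sym (ℤ.m-n≡m⊖n c d))) (ℤ.∣m⊝n∣≤m⊔n c d)) (ℕ.⊔-lub c<m d<m))))

      faithfulᴸ : ∀ {m} → 2 ≤ m → Coprime m D → ∀ {c d} → c < m → d < m → ⟦ c ⟧ ≡ ⟦ d ⟧ [ ⟦ m ⟧ ] → c ≡ d
      faithfulᴸ {m} 2≤m cop {c} {d} c<m d<m h =
        let (f , b , eq) = ≡[]⇒ℤ {m} {⟦ c ⟧} {⟦ d ⟧} h in
        ∣difference∣⇒≡ {m} {c} {d} c<m d<m (∣D^*⇒∣ {m} f (+ c ℤ.- + d) b cop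
          (fromℤ-eq f (+ c) (+ d) (+ m) b (≡.trans (cong (D^ f ℚ.*_) (≡.sym (proj₁-⟦⟧ c)))
            (≡.trans eq (cong (λ u → D^ f ℚ.* u ℚ.+ fromℤ (+ m ℤ.* b)) (proj₁-⟦⟧ d))))))

      p^-large : ∀ {p} → 2 ≤ p → ∀ n → n < p ^ suc n
      p^-large {p} 2≤p n = ℕ.<-≤-trans (ℕ.<-≤-trans (n<2^n n) (ℕ.^-monoʳ-≤ 2 (ℕ.n≤1+n n))) (ℕ.^-monoˡ-≤ (suc n) 2≤p)
        where
        n<2^n : ∀ n → n < 2 ^ n
        n<2^n zero    = s≤s z≤n
        n<2^n (suc n) = ℕ.+-mono-≤ (1≤^ {2} (s≤s z≤n) n) (ℕ.≤-trans (n<2^n n) (ℕ.m≤m+n (2 ^ n) 0))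

      -- For a nonzero numerator `a` a single exponent refutes the hypothesis: `p` to the power |a|
      -- + 1 is larger than |a|, so it cannot divide `a`.
      separatedᴸ : ∀ {p} → 2 ≤ p → Coprime p D → ∀ {x} → (∀ s → ¬ ¬ (x ≡ CommutativeRing.0# ring [ ⟦ p ^ suc s ⟧ ])) → proj₁ x ≡ 0ℚ
      separatedᴸ {p} 2≤p cop {x , e , a , eq} near with a ℤ.≟ + 0
      ... | yes ≡.refl = *-cancelˡ (D^ e) (D^≢0 e) (≡.trans eq (≡.trans fromℤ-0 (≡.sym (ℚ.*-zeroʳ (D^ e)))))
      ... | no a≢0 = contradiction (near ∣ a ∣) λ nn → nn λ h →
        let (f , b , eq′) = ≡[]⇒ℤ {p ^ suc ∣ a ∣} {x , e , a , eq} {CommutativeRing.0# ring} h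
            q∣a = ∣D^*⇒∣ f (a ℤ.- + 0) (b ℤ.* + (D ^ e)) (coprime-sym (coprime-^ʳ (coprime-sym cop) (suc ∣ a ∣)))
                    (fromℤ-eq f a (+ 0) (+ (p ^ suc ∣ a ∣)) (b ℤ.* + (D ^ e)) (clear f b eq′))
        in ℕ.<⇒≱ (p^-large 2≤p ∣ a ∣) (∣⇒≤ {{ℕ.≢-nonZero λ z → a≢0 (ℤ.∣i∣≡0⇒i≡0 z)}} (subst (λ z → p ^ suc ∣ a ∣ ∣ ∣ z ∣) (ℤ.+-identityʳ a) q∣a))
        where
        m = + (p ^ suc ∣ a ∣)
        open ≡-Reasoning
        clear : ∀ f b → D^ f ℚ.* x ≡ D^ f ℚ.* 0ℚ ℚ.+ fromℤ (m ℤ.* b) →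
                D^ f ℚ.* fromℤ a ≡ D^ f ℚ.* fromℤ (+ 0) ℚ.+ fromℤ (m ℤ.* (b ℤ.* + (D ^ e)))
        clear f b eq′ = begin
          D^ f ℚ.* fromℤ a                                  ≡⟨ cong (D^ f ℚ.*_) eq ⟨
          D^ f ℚ.* (D^ e ℚ.* x)                             ≡⟨ rotate (D^ f) (D^ e) x ⟩
          (D^ f ℚ.* x) ℚ.* D^ e                             ≡⟨ cong (ℚ._* D^ e) eq′ ⟩
          (D^ f ℚ.* 0ℚ ℚ.+ fromℤ (m ℤ.* b)) ℚ.* D^ e        ≡⟨ cong (ℚ._* D^ e) (≡.trans (cong (ℚ._+ fromℤ (m ℤ.* b)) (ℚ.*-zeroʳ (D^ f))) (ℚ.+-identityˡ (fromℤ (m ℤ.* b)))) ⟩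
          fromℤ (m ℤ.* b) ℚ.* D^ e                          ≡⟨ ≡.trans (≡.sym (fromℤ-* (m ℤ.* b) (+ (D ^ e)))) (cong fromℤ (ℤ.*-assoc m b (+ (D ^ e)))) ⟩
          fromℤ (m ℤ.* (b ℤ.* + (D ^ e)))                   ≡⟨ ≡.trans (cong (ℚ._+ fromℤ (m ℤ.* (b ℤ.* + (D ^ e)))) (≡.trans (cong (D^ f ℚ.*_) fromℤ-0) (ℚ.*-zeroʳ (D^ f)))) (ℚ.+-identityˡ _) ⟨
          D^ f ℚ.* fromℤ (+ 0) ℚ.+ fromℤ (m ℤ.* (b ℤ.* + (D ^ e))) ∎

    isArithmetic : IsArithmetic D
    isArithmetic = record { residue = residueᴸ ; faithful = faithfulᴸ ; separated = λ 2≤p cop {x} → separatedᴸ 2≤p cop {x} }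

-- Clearing the denominators of a rational chain.

module RationalChains where

  open import Algebra.Bundles using (CommutativeRing)
  import Algebra.Properties.Semiring.Sum
  open import Data.Fin using (Fin; zero; suc)
  open import Data.Integer as ℤ using (+_)
  import Data.Integer.Properties as ℤ
  open import Data.List using (List; []; _∷_; length)
  open import Data.List.Membership.Propositional using (_∈_)
  open import Data.List.Relation.Unary.Any using (here; there)
  open import Data.Nat as ℕ using (ℕ; zero; suc; _≤_; _<_; s≤s; z≤n)
  import Data.Nat.Properties as ℕ
  open import Data.Nat.Divisibility using (_∣_; divides; ∣-trans; m∣m*n; n∣m*n)
  open import Data.Product using (Σ; ∃; _×_; _,_; proj₁; proj₂)
  open import Data.Rational as ℚ using (ℚ; 0ℚ)
  import Data.Rational.Properties as ℚ
  open import Data.Unit using (⊤; tt)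
  open import Relation.Binary.PropositionalEquality as ≡ using (_≡_; cong; cong₂; subst)
  open import Relation.Nullary using (¬_)
  open import Defs using (Poly; con; var; eval; _⊕_; _⊛_)
  open Arithmetic using (1≤-*)
  open Chains
  open GeneratedSubgroups using (module Gen)
  open Matrices
  open Localisations

  -- Asking for all multiples of some `D` makes these properties stable under finite conjunction, by
  -- multiplying the witnesses. So one `D` serves all matrices and polynomials of a chain.
  Eventually : (∀ D → 1 ≤ D → Set) → Set
  Eventually Q = ∃ λ D → 1 ≤ D × (∀ D′ (1≤D′ : 1 ≤ D′) → D ∣ D′ → Q D′ 1≤D′)

  always : ∀ {Q} → (∀ D 1≤D → Q D 1≤D) → Eventually Q
  always h = 1 , s≤s z≤n , λ D′ 1≤D′ _ → h D′ 1≤D′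

  eventually-× : ∀ {P Q} → Eventually P → Eventually Q → Eventually λ D 1≤D → P D 1≤D × Q D 1≤D
  eventually-× (D , 1≤D , h) (E , 1≤E , g) = D ℕ.* E , 1≤-* 1≤D 1≤E , λ D′ 1≤D′ d →
    h D′ 1≤D′ (∣-trans (m∣m*n E) d) , g D′ 1≤D′ (∣-trans (n∣m*n D) d)

  eventually-Fin : ∀ {n} {Q : Fin n → ∀ D → 1 ≤ D → Set} → (∀ i → Eventually (Q i)) → Eventually λ D 1≤D → ∀ i → Q i D 1≤D
  eventually-Fin {zero}  h = always λ _ _ ()
  eventually-Fin {suc n} {Q} h with eventually-× {Q zero} {λ D 1≤D → ∀ i → Q (suc i) D 1≤D} (h zero) (eventually-Fin λ i → h (suc i))
  ... | D , 1≤D , g = D , 1≤D , λ { D′ 1≤D′ d zero → proj₁ (g D′ 1≤D′ d) ; D′ 1≤D′ d (suc i) → proj₂ (g D′ 1≤D′ d) i }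

  Local : ∀ D → 1 ≤ D → ℚ → Set
  Local = Localisation.Local

  eventually-local : ∀ q → Eventually λ D 1≤D → Local D 1≤D q
  eventually-local q = ℚ.denominatorℕ q , s≤s z≤n , λ { _ 1≤D′ (divides k ≡.refl) → 1 , + k ℤ.* ℚ.numerator q ,
    ≡.trans (cong (λ m → fromℤ (+ m) ℚ.* q) (ℕ.*-identityʳ (k ℕ.* d)))
      (≡.trans (cong (ℚ._* q) (≡.trans (cong fromℤ (ℤ.pos-* k d)) (fromℤ-* (+ k) (+ d))))
        (≡.trans (ℚ.*-assoc (fromℤ (+ k)) (fromℤ (+ d)) q)
          (≡.trans (cong (fromℤ (+ k) ℚ.*_) (clear-denominator q)) (≡.sym (fromℤ-* (+ k) (ℚ.numerator q)))))) }
    where d = ℚ.denominatorℕ q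

  LocalP : ∀ {V} D → 1 ≤ D → Poly ℚ-ring V → Set
  LocalP D 1≤D (con c) = Local D 1≤D c
  LocalP D 1≤D (var v) = ⊤
  LocalP D 1≤D (f ⊕ g) = LocalP D 1≤D f × LocalP D 1≤D g
  LocalP D 1≤D (f ⊛ g) = LocalP D 1≤D f × LocalP D 1≤D g

  eventually-localP : ∀ {V} (f : Poly ℚ-ring V) → Eventually λ D 1≤D → LocalP D 1≤D f
  eventually-localP (con c) = eventually-local c
  eventually-localP (var v) = always λ _ _ → tt
  eventually-localP (f ⊕ g) = eventually-× {λ D 1≤D → LocalP D 1≤D f} {λ D 1≤D → LocalP D 1≤D g} (eventually-localP f) (eventually-localP g)
  eventually-localP (f ⊛ g) = eventually-× {λ D 1≤D → LocalP D 1≤D f} {λ D 1≤D → LocalP D 1≤D g} (eventually-localP f) (eventually-localP g)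

  module _ {N : ℕ} where
    open Gen ℚ-ring N public using (W)

    -- An explicit polynomial instead of mere non-membership in a closure: its coefficients have to
    -- be moved to ℤ[1/D] along with the matrices.
    Separated : Mℚ.GL N → List (Mℚ.GL N) → Set
    Separated g gs = Σ (Mℚ.MatPoly N) λ f → (∀ x → W gs x → Mℚ.ev f (Mℚ.mat x) ≡ 0ℚ) × ¬ Mℚ.ev f (Mℚ.mat g) ≡ 0ℚ

    Chainℚ : List (Mℚ.GL N) → Set
    Chainℚ []       = ⊤
    Chainℚ (g ∷ gs) = Separated g gs × Chainℚ gs

    LocalM : ∀ D → 1 ≤ D → Mℚ.Mat N → Set
    LocalM D 1≤D A = ∀ i j → Local D 1≤D (A i j)

    LocalChain : ∀ D → 1 ≤ D → ∀ gs → Chainℚ gs → Set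
    LocalChain D 1≤D []       _       = ⊤
    LocalChain D 1≤D (g ∷ gs) (s , c) =
      (LocalM D 1≤D (Mℚ.mat g) × LocalM D 1≤D (Mℚ.imat g)) × (LocalP D 1≤D (proj₁ s) × LocalChain D 1≤D gs c)

    eventually-localM : ∀ A → Eventually λ D 1≤D → LocalM D 1≤D A
    eventually-localM A = eventually-Fin λ i → eventually-Fin λ j → eventually-local (A i j)

    eventually-localChain : ∀ gs c → Eventually λ D 1≤D → LocalChain D 1≤D gs c
    eventually-localChain []       _       = always λ _ _ → tt
    eventually-localChain (g ∷ gs) (s , c) =
      eventually-× {λ D 1≤D → LocalM D 1≤D (Mℚ.mat g) × LocalM D 1≤D (Mℚ.imat g)} {λ D 1≤D → LocalP D 1≤D (proj₁ s) × LocalChain D 1≤D gs c}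
        (eventually-× {λ D 1≤D → LocalM D 1≤D (Mℚ.mat g)} {λ D 1≤D → LocalM D 1≤D (Mℚ.imat g)} (eventually-localM (Mℚ.mat g)) (eventually-localM (Mℚ.imat g)))
        (eventually-× {λ D 1≤D → LocalP D 1≤D (proj₁ s)} {λ D 1≤D → LocalChain D 1≤D gs c} (eventually-localP (proj₁ s)) (eventually-localChain gs c))

    module _ (D : ℕ) (1≤D : 1 ≤ D) where
      private
        𝓡 = Localisation.ring D 1≤D
        module M𝓡 = Mat 𝓡
        module G𝓡 = Gen 𝓡 N
        module Sℚ = Algebra.Properties.Semiring.Sum (CommutativeRing.semiring ℚ-ring)
        module S𝓡 = Algebra.Properties.Semiring.Sum (CommutativeRing.semiring 𝓡)

      down-sum : ∀ {n} (f : Fin n → CommutativeRing.Carrier 𝓡) → proj₁ (S𝓡.sum f) ≡ Sℚ.sum λ i → proj₁ (f i)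
      down-sum {zero}  f = ≡.refl
      down-sum {suc n} f = cong (proj₁ (f zero) ℚ.+_) (down-sum λ i → f (suc i))

      downM : M𝓡.Mat N → Mℚ.Mat N
      downM A i j = proj₁ (A i j)

      downM-· : ∀ A B → downM (A M𝓡.· B) Mℚ.≋ downM A Mℚ.· downM B
      downM-· A B i j = down-sum λ k → CommutativeRing._*_ 𝓡 (A i k) (B k j)

      downM-I : downM M𝓡.I Mℚ.≋ Mℚ.I
      downM-I = go
        where
        go : ∀ {n} (i j : Fin n) → proj₁ (M𝓡.δ i j) ≡ Mℚ.δ i j
        go zero    zero    = ≡.refl
        go zero    (suc j) = ≡.refl
        go (suc i) zero    = ≡.refl
        go (suc i) (suc j) = go i j

      down : M𝓡.GL N → Mℚ.GL N
      down x = Mℚ.gl (downM (M𝓡.mat x)) (downM (M𝓡.imat x))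
        (λ i j → ≡.trans (≡.sym (downM-· (M𝓡.mat x) (M𝓡.imat x) i j)) (≡.trans (M𝓡.right x i j) (downM-I i j)))
        (λ i j → ≡.trans (≡.sym (downM-· (M𝓡.imat x) (M𝓡.mat x) i j)) (≡.trans (M𝓡.left x i j) (downM-I i j)))

      upM : ∀ {A} → LocalM D 1≤D A → M𝓡.Mat N
      upM {A} l i j = A i j , l i j

      up : ∀ g → LocalM D 1≤D (Mℚ.mat g) → LocalM D 1≤D (Mℚ.imat g) → M𝓡.GL N
      up g l l′ = M𝓡.gl (upM l) (upM l′)
        (λ i j → ≡.trans (downM-· (upM l) (upM l′) i j) (≡.trans (Mℚ.right g i j) (≡.sym (downM-I i j))))
        (λ i j → ≡.trans (downM-· (upM l′) (upM l) i j) (≡.trans (Mℚ.left g i j) (≡.sym (downM-I i j))))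

      upP : ∀ {V} (f : Poly ℚ-ring V) → LocalP D 1≤D f → Poly 𝓡 V
      upP (con c) l        = con (c , l)
      upP (var v) _        = var v
      upP (f ⊕ g) (l , l′) = upP f l ⊕ upP g l′
      upP (f ⊛ g) (l , l′) = upP f l ⊛ upP g l′

      eval-upP : ∀ {V} (f : Poly ℚ-ring V) l x → proj₁ (eval 𝓡 (upP f l) x) ≡ eval ℚ-ring f λ v → proj₁ (x v)
      eval-upP (con c) l        x = ≡.refl
      eval-upP (var v) _        x = ≡.refl
      eval-upP (f ⊕ g) (l , l′) x = cong₂ ℚ._+_ (eval-upP f l x) (eval-upP g l′ x)
      eval-upP (f ⊛ g) (l , l′) x = cong₂ ℚ._*_ (eval-upP f l x) (eval-upP g l′ x)

      ups : ∀ gs c → LocalChain D 1≤D gs c → List (M𝓡.GL N)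
      ups []       _       _                    = []
      ups (g ∷ gs) (s , c) ((l , l′) , (_ , lc)) = up g l l′ ∷ ups gs c lc

      length-ups : ∀ gs c lc → length (ups gs c lc) ≡ length gs
      length-ups []       _       _              = ≡.refl
      length-ups (g ∷ gs) (s , c) (_ , (_ , lc)) = cong suc (length-ups gs c lc)

      ups-∈ : ∀ gs c lc {x} → x ∈ ups gs c lc → ∃ λ (g : Mℚ.GL N) → g ∈ gs × (∀ i j → Mℚ.mat g i j ≡ proj₁ (M𝓡.mat x i j))
      ups-∈ (g ∷ gs) (s , c) ((l , l′) , (_ , lc)) (here e) =
        g , here ≡.refl , λ i j → cong (λ y → proj₁ (M𝓡.mat y i j)) (≡.sym e)
      ups-∈ (g ∷ gs) (s , c) (_ , (_ , lc)) (there x∈) =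
        let (h , h∈ , e) = ups-∈ gs c lc x∈ in h , there h∈ , e

      down-∈ : ∀ gs c lc {x} → x ∈ ups gs c lc → W gs (down x)
      down-∈ gs c lc {x} x∈ = let (h , h∈ , e) = ups-∈ gs c lc x∈ in Gen.resp {x = h} {y = down x} e (Gen.gen h∈)

      down-W : ∀ gs c lc {x} → G𝓡.W (ups gs c lc) x → W gs (down x)
      down-W gs c lc = G𝓡.W-least record
        { resp = λ e → Gen.resp e
        ; ε∈   = Gen.resp (λ i j → ≡.sym (downM-I i j)) Gen.one
        ; ∙∈   = λ {x} {y} w v → Gen.resp (λ i j → ≡.sym (downM-· (M𝓡.mat x) (M𝓡.mat y) i j)) (Gen.mul w v)
        ; ⁻¹∈  = λ w → Gen.resp (λ i j → ≡.refl) (Gen.inv w)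
        } (down-∈ gs c lc)

      opaque
        up-vanishes : ∀ gs c lc (f : Mℚ.MatPoly N) lf → (∀ x → W gs x → Mℚ.ev f (Mℚ.mat x) ≡ 0ℚ) →
          ∀ A → G𝓡.Image (ups gs c lc) A → proj₁ (M𝓡.ev (upP f lf) A) ≡ 0ℚ
        up-vanishes gs c lc f lf kills A (y , w , e) =
          ≡.trans (eval-upP f lf (λ (i , j) → A i j))
            (≡.trans (Mℚ.ev-cong f {downM A} {downM (M𝓡.mat y)} (λ i j → ≡.sym (e i j))) (kills (down y) (down-W gs c lc {y} w)))

        up-ev : ∀ (f : Mℚ.MatPoly N) lf g l l′ → proj₁ (M𝓡.ev (upP f lf) (M𝓡.mat (up g l l′))) ≡ Mℚ.ev f (Mℚ.mat g)
        up-ev f lf g l l′ = eval-upP f lf (λ (i , j) → upM l i j)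

        up-separated : ∀ g gs (s : Separated g gs) c l l′ (lf : LocalP D 1≤D (proj₁ s)) lc → ¬ G𝓡.C (ups gs c lc) (up g l l′)
        up-separated g gs (f , kills , f≢0) c l l′ lf lc closure =
          f≢0 (≡.trans (≡.sym (up-ev f lf g l l′)) (closure (upP f lf) (up-vanishes gs c lc f lf kills)))

      module _ (1≤N : 1 ≤ N) where
        private
          module CB = ChainBound 𝓡 (Localisation.isArithmetic D 1≤D) 1≤D N 1≤N

        up-chain : ∀ gs c lc → CB.Chain (ups gs c lc)
        up-chain []       _       _ = tt
        up-chain (g ∷ gs) (s , c) ((l , l′) , (lf , lc)) = up-separated g gs s c l l′ lf lc , up-chain gs c lc

        local-bound : ∀ gs c → LocalChain D 1≤D gs c → length gs < suc (N ℕ.* N) ℕ.* suc (stepBound N)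
        local-bound gs c lc = subst (_< suc (N ℕ.* N) ℕ.* suc (stepBound N)) (length-ups gs c lc)
          (CB.chain-bound (ups gs c lc) (up-chain gs c lc))

    chain-boundℚ : 1 ≤ N → ∀ gs → Chainℚ gs → length gs < suc (N ℕ.* N) ℕ.* suc (stepBound N)
    chain-boundℚ 1≤N gs c with eventually-localChain gs c
    ... | D , 1≤D , h = local-bound D 1≤D 1≤N gs c (h D 1≤D (divides 1 (≡.sym (ℕ.*-identityˡ D))))

-- Determinants through the exterior algebra.

module ExteriorAlgebras where

  open import Level using (0ℓ)
  open import Algebra.Bundles using (CommutativeRing)
  import Algebra.Properties.Ring
  import Relation.Binary.Reasoning.Setoid
  open import Data.Bool using (Bool; true; false)
  open import Data.Fin using (Fin; zero; suc; toℕ)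
  open import Data.Nat using (ℕ; zero; suc)
  open import Data.Product using (∃; _×_; _,_)
  open import Data.Vec using (Vec; []; _∷_; lookup; tabulate; foldr; map; zipWith; removeAt; insertAt; replicate)
  open import Relation.Binary.PropositionalEquality as ≡ using (_≡_)
  open Matrices using (module RingSolver)

  module ExteriorAlgebra (R : CommutativeRing 0ℓ 0ℓ) where
    open CommutativeRing R hiding (zero)
    open Algebra.Properties.Ring ring
    open RingSolver R
    open Relation.Binary.Reasoning.Setoid setoid

    -- Elements of the exterior algebra of Rⁿ, by their coordinates with respect to the products of basis vectors.
    Ext : ℕ → Set
    Ext n = Vec Bool n → Carrier

    infix 4 _≈ᴱ_
    _≈ᴱ_ : ∀ {n} → Ext n → Ext n → Set
    α ≈ᴱ β = ∀ s → α s ≈ β s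

    private
      m = - 1#

      m*m : m * m ≈ 1#
      m*m = trans (sym (-‿distribˡ-* 1# m)) (trans (-‿cong (*-identityˡ m)) (-‿involutive 1#))

      1+m : 1# + m ≈ 0#
      1+m = -‿inverseʳ 1#

      x+mx : ∀ x → x + m * x ≈ 0#
      x+mx x = trans (trans (+-congʳ (sym (*-identityˡ x))) (sym (distribʳ x 1# m))) (trans (*-congʳ 1+m) (zeroˡ x))

    -- Left multiplication by a vector. With e the first basis vector, write ω = f + e t where f and
    -- t do not involve e: the head `false` selects f, the head `true` selects t, and moving `r`
    -- past e costs the sign `m`. `interior` is contraction in the same coordinates.
    wedge : ∀ {n} → Vec Carrier n → Ext n → Ext n
    wedge []      ω []          = 0#
    wedge (x ∷ r) ω (false ∷ s) = wedge r (λ s → ω (false ∷ s)) s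
    wedge (x ∷ r) ω (true ∷ s)  = x * ω (false ∷ s) + m * wedge r (λ s → ω (true ∷ s)) s

    interior : ∀ {n} → Vec Carrier n → Ext n → Ext n
    interior []      ω []          = 0#
    interior (x ∷ v) ω (false ∷ s) = interior v (λ s → ω (false ∷ s)) s + x * ω (true ∷ s)
    interior (x ∷ v) ω (true ∷ s)  = m * interior v (λ s → ω (true ∷ s)) s

    dot : ∀ {n} → Vec Carrier n → Vec Carrier n → Carrier
    dot []      []      = 0#
    dot (x ∷ r) (y ∷ v) = x * y + dot r v

    wedge-cong : ∀ {n} (r : Vec Carrier n) {α β} → α ≈ᴱ β → wedge r α ≈ᴱ wedge r β
    wedge-cong []      h []          = refl
    wedge-cong (x ∷ r) h (false ∷ s) = wedge-cong r (λ s → h (false ∷ s)) s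
    wedge-cong (x ∷ r) h (true ∷ s)  = +-cong (*-congˡ (h (false ∷ s))) (*-congˡ (wedge-cong r (λ s → h (true ∷ s)) s))

    wedge-lin : ∀ {n} (r : Vec Carrier n) k l α β → wedge r (λ s → k * α s + l * β s) ≈ᴱ λ s → k * wedge r α s + l * wedge r β s
    wedge-lin [] k l α β [] = sym (trans (+-cong (zeroʳ k) (zeroʳ l)) (+-identityʳ 0#))
    wedge-lin (x ∷ r) k l α β (false ∷ s) = wedge-lin r k l (λ s → α (false ∷ s)) (λ s → β (false ∷ s)) s
    wedge-lin (x ∷ r) k l α β (true ∷ s) = trans (+-congˡ (*-congˡ (wedge-lin r k l (λ s → α (true ∷ s)) (λ s → β (true ∷ s)) s)))
      (solve 8 (λ x k l a b m u v → (x :* (k :* a :+ l :* b) :+ m :* (k :* u :+ l :* v)) := (k :* (x :* a :+ m :* u) :+ l :* (x :* b :+ m :* v))) refl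
        x k l (α (false ∷ s)) (β (false ∷ s)) m (wedge r (λ s → α (true ∷ s)) s) (wedge r (λ s → β (true ∷ s)) s))

    interior-lin : ∀ {n} (r : Vec Carrier n) k l α β → interior r (λ s → k * α s + l * β s) ≈ᴱ λ s → k * interior r α s + l * interior r β s
    interior-lin [] k l α β [] = sym (trans (+-cong (zeroʳ k) (zeroʳ l)) (+-identityʳ 0#))
    interior-lin (x ∷ r) k l α β (false ∷ s) = trans (+-congʳ (interior-lin r k l (λ s → α (false ∷ s)) (λ s → β (false ∷ s)) s))
      (solve 7 (λ x k l a b u v → ((k :* u :+ l :* v) :+ x :* (k :* a :+ l :* b)) := (k :* (u :+ x :* a) :+ l :* (v :+ x :* b))) refl
        x k l (α (true ∷ s)) (β (true ∷ s)) (interior r (λ s → α (false ∷ s)) s) (interior r (λ s → β (false ∷ s)) s))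
    interior-lin (x ∷ r) k l α β (true ∷ s) = trans (*-congˡ (interior-lin r k l (λ s → α (true ∷ s)) (λ s → β (true ∷ s)) s))
      (solve 5 (λ k l m u v → (m :* (k :* u :+ l :* v)) := (k :* (m :* u) :+ l :* (m :* v))) refl
        k l m (interior r (λ s → α (true ∷ s)) s) (interior r (λ s → β (true ∷ s)) s))

    wedge-0 : ∀ {n} (r : Vec Carrier n) {α} → (∀ s → α s ≈ 0#) → ∀ s → wedge r α s ≈ 0#
    wedge-0 []      h []          = refl
    wedge-0 (x ∷ r) h (false ∷ s) = wedge-0 r (λ s → h (false ∷ s)) s
    wedge-0 (x ∷ r) h (true ∷ s)  = trans (+-cong (trans (*-congˡ (h (false ∷ s))) (zeroʳ x)) (trans (*-congˡ (wedge-0 r (λ s → h (true ∷ s)) s)) (zeroʳ m))) (+-identityʳ 0#)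

    interior-0 : ∀ {n} (r : Vec Carrier n) {α} → (∀ s → α s ≈ 0#) → ∀ s → interior r α s ≈ 0#
    interior-0 []      h []          = refl
    interior-0 (x ∷ r) h (false ∷ s) = trans (+-cong (interior-0 r (λ s → h (false ∷ s)) s) (trans (*-congˡ (h (true ∷ s))) (zeroʳ x))) (+-identityʳ 0#)
    interior-0 (x ∷ r) h (true ∷ s)  = trans (*-congˡ (interior-0 r (λ s → h (true ∷ s)) s)) (zeroʳ m)

    antiderivation : ∀ {n} (v r : Vec Carrier n) ω s → interior v (wedge r ω) s + wedge r (interior v ω) s ≈ dot r v * ω s
    antiderivation [] [] ω [] = trans (+-identityʳ 0#) (sym (zeroˡ _))
    antiderivation (y ∷ v) (x ∷ r) ω (false ∷ s) = begin
      (interior v (wedge r f) s + y * (x * f s + m * wedge r t s)) + wedge r (λ s → interior v f s + y * t s) s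
        ≈⟨ +-congˡ (trans (wedge-cong r (λ s → +-congʳ (sym (*-identityˡ _))) s) (wedge-lin r 1# y (interior v f) t s)) ⟩
      (interior v (wedge r f) s + y * (x * f s + m * wedge r t s)) + (1# * wedge r (interior v f) s + y * wedge r t s)
        ≈⟨ +-congˡ (+-congʳ (*-identityˡ _)) ⟩
      (interior v (wedge r f) s + y * (x * f s + m * wedge r t s)) + (wedge r (interior v f) s + y * wedge r t s)
        ≈⟨ solve 7 (λ a b x y f m t → ((a :+ y :* (x :* f :+ m :* t)) :+ (b :+ y :* t)) := ((x :* y :* f :+ (a :+ b)) :+ y :* (t :+ m :* t))) refl
             (interior v (wedge r f) s) (wedge r (interior v f) s) x y (f s) m (wedge r t s) ⟩
      (x * y * f s + (interior v (wedge r f) s + wedge r (interior v f) s)) + y * (wedge r t s + m * wedge r t s)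
        ≈⟨ +-cong (+-congˡ (antiderivation v r f s)) (trans (*-congˡ (x+mx _)) (zeroʳ y)) ⟩
      (x * y * f s + dot r v * f s) + 0#  ≈⟨ trans (+-identityʳ _) (sym (distribʳ (f s) (x * y) (dot r v))) ⟩
      (x * y + dot r v) * f s             ∎
      where
      f = λ s → ω (false ∷ s)
      t = λ s → ω (true ∷ s)
    antiderivation (y ∷ v) (x ∷ r) ω (true ∷ s) = begin
      m * interior v (λ s → x * f s + m * wedge r t s) s + (x * (interior v f s + y * t s) + m * wedge r (λ s → m * interior v t s) s)
        ≈⟨ +-cong (*-congˡ (interior-lin v x m f (wedge r t) s)) (+-congˡ (*-congˡ
             (trans (wedge-cong r (λ s → sym (+-identityˡ _)) s) (trans (wedge-cong r (λ s → +-congʳ (sym (zeroˡ 0#))) s)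
               (trans (wedge-lin r 0# m (λ _ → 0#) (interior v t) s) (trans (+-congʳ (zeroˡ _)) (+-identityˡ _))))))) ⟩
      m * (x * interior v f s + m * interior v (wedge r t) s) + (x * (interior v f s + y * t s) + m * (m * wedge r (interior v t) s))
        ≈⟨ solve 7 (λ m x y a b c t → (m :* (x :* a :+ m :* b) :+ (x :* (a :+ y :* t) :+ m :* (m :* c))) := ((x :* (a :+ m :* a) :+ x :* y :* t) :+ m :* m :* (b :+ c))) refl
             m x y (interior v f s) (interior v (wedge r t) s) (wedge r (interior v t) s) (t s) ⟩
      (x * (interior v f s + m * interior v f s) + x * y * t s) + m * m * (interior v (wedge r t) s + wedge r (interior v t) s)
        ≈⟨ +-cong (trans (+-congʳ (trans (*-congˡ (x+mx _)) (zeroʳ x))) (+-identityˡ _)) (trans (*-cong m*m (antiderivation v r t s)) (*-identityˡ _)) ⟩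
      x * y * t s + dot r v * t s   ≈⟨ distribʳ (t s) (x * y) (dot r v) ⟨
      (x * y + dot r v) * t s       ∎
      where
      f = λ s → ω (false ∷ s)
      t = λ s → ω (true ∷ s)

    wedge-anticomm : ∀ {n} (u r : Vec Carrier n) ω s → wedge u (wedge r ω) s + wedge r (wedge u ω) s ≈ 0#
    wedge-anticomm [] [] ω [] = +-identityʳ 0#
    wedge-anticomm (y ∷ u) (x ∷ r) ω (false ∷ s) = wedge-anticomm u r (λ s → ω (false ∷ s)) s
    wedge-anticomm (y ∷ u) (x ∷ r) ω (true ∷ s) = begin
      (y * wedge r f s + m * wedge u (λ s → x * f s + m * wedge r t s) s) + (x * wedge u f s + m * wedge r (λ s → y * f s + m * wedge u t s) s)
        ≈⟨ +-cong (+-congˡ (*-congˡ (wedge-lin u x m f (wedge r t) s))) (+-congˡ (*-congˡ (wedge-lin r y m f (wedge u t) s))) ⟩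
      (y * wedge r f s + m * (x * wedge u f s + m * wedge u (wedge r t) s)) + (x * wedge u f s + m * (y * wedge r f s + m * wedge r (wedge u t) s))
        ≈⟨ solve 7 (λ x y m a b c d → ((y :* a :+ m :* (x :* b :+ m :* c)) :+ (x :* b :+ m :* (y :* a :+ m :* d))) := (((y :* a :+ m :* (y :* a)) :+ (x :* b :+ m :* (x :* b))) :+ m :* m :* (c :+ d))) refl
             x y m (wedge r f s) (wedge u f s) (wedge u (wedge r t) s) (wedge r (wedge u t) s) ⟩
      ((y * wedge r f s + m * (y * wedge r f s)) + (x * wedge u f s + m * (x * wedge u f s))) + m * m * (wedge u (wedge r t) s + wedge r (wedge u t) s)
        ≈⟨ +-cong (trans (+-cong (x+mx _) (x+mx _)) (+-identityʳ 0#)) (trans (*-congˡ (wedge-anticomm u r t s)) (zeroʳ _)) ⟩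
      0# + 0#  ≈⟨ +-identityʳ 0# ⟩
      0#       ∎
      where
      f = λ s → ω (false ∷ s)
      t = λ s → ω (true ∷ s)

    wedge-self : ∀ {n} (r : Vec Carrier n) ω s → wedge r (wedge r ω) s ≈ 0#
    wedge-self [] ω [] = refl
    wedge-self (x ∷ r) ω (false ∷ s) = wedge-self r (λ s → ω (false ∷ s)) s
    wedge-self (x ∷ r) ω (true ∷ s) = begin
      x * wedge r f s + m * wedge r (λ s → x * f s + m * wedge r t s) s  ≈⟨ +-congˡ (*-congˡ (wedge-lin r x m f (wedge r t) s)) ⟩
      x * wedge r f s + m * (x * wedge r f s + m * wedge r (wedge r t) s)
        ≈⟨ solve 4 (λ x m a b → (x :* a :+ m :* (x :* a :+ m :* b)) := ((x :* a :+ m :* (x :* a)) :+ m :* m :* b)) refl x m (wedge r f s) (wedge r (wedge r t) s) ⟩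
      (x * wedge r f s + m * (x * wedge r f s)) + m * m * wedge r (wedge r t) s
        ≈⟨ +-cong (x+mx _) (trans (*-congˡ (wedge-self r t s)) (zeroʳ _)) ⟩
      0# + 0#  ≈⟨ +-identityʳ 0# ⟩
      0#       ∎
      where
      f = λ s → ω (false ∷ s)
      t = λ s → ω (true ∷ s)

    unit : ∀ {n} → Ext n
    unit []          = 1#
    unit (false ∷ s) = unit s
    unit (true ∷ s)  = 0#

    blade : ∀ {n k} → Vec (Vec Carrier n) k → Ext n
    blade []         = unit
    blade (r ∷ rows) = wedge r (blade rows)

    full : ∀ n → Vec Bool n
    full n = replicate n true

    top : ∀ {n} → Ext n → Carrier
    top {n} ω = ω (full n)

    interior-unit : ∀ {n} (v : Vec Carrier n) s → interior v unit s ≈ 0#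
    interior-unit []      []          = refl
    interior-unit (x ∷ v) (false ∷ s) = trans (+-cong (interior-unit v s) (zeroʳ x)) (+-identityʳ 0#)
    interior-unit (x ∷ v) (true ∷ s)  = trans (*-congˡ (interior-0 v (λ _ → refl) s)) (zeroʳ m)

    interior-blade : ∀ {n k} (v : Vec Carrier n) (rows : Vec (Vec Carrier n) k) → (∀ i → dot (lookup rows i) v ≈ 0#) → ∀ s → interior v (blade rows) s ≈ 0#
    interior-blade v []         h s = interior-unit v s
    interior-blade v (r ∷ rows) h s = begin
      interior v (wedge r β) s                              ≈⟨ +-identityʳ _ ⟨
      interior v (wedge r β) s + 0#                         ≈⟨ +-congˡ (wedge-0 r (interior-blade v rows (λ i → h (suc i))) s) ⟨
      interior v (wedge r β) s + wedge r (interior v β) s   ≈⟨ antiderivation v r β s ⟩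
      dot r v * β s                                         ≈⟨ trans (*-congʳ (h zero)) (zeroˡ _) ⟩
      0#                                                    ∎
      where β = blade rows

    top-interior : ∀ {n} (v : Vec Carrier n) α → top (interior v α) ≈ 0#
    top-interior []      α = refl
    top-interior (x ∷ v) α = trans (*-congˡ (top-interior v (λ s → α (true ∷ s)))) (zeroʳ m)

    -- At the index set that omits only `l`, the coordinate of the contraction is plus or minus
    -- `lookup v l * top ω`.
    kernel⇒top : ∀ {n} (v : Vec Carrier n) l ω → (∀ s → interior v ω s ≈ 0#) → lookup v l * top ω ≈ 0#
    kernel⇒top {suc n} (x ∷ v) zero ω h = trans (sym (trans (+-congʳ (top-interior v (λ s → ω (false ∷ s)))) (+-identityˡ _))) (h (false ∷ full n))
    kernel⇒top (x ∷ v) (suc l) ω h = kernel⇒top v l (λ s → ω (true ∷ s)) λ s →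
      trans (sym (trans (sym (*-assoc m m _)) (trans (*-congʳ m*m) (*-identityˡ _)))) (trans (*-congˡ (h (true ∷ s))) (zeroʳ m))

    combine : ∀ {n k} → Vec Carrier k → Vec (Vec Carrier n) k → Vec Carrier n
    combine {n} []       []         = replicate n 0#
    combine     (w ∷ ws) (r ∷ rows) = zipWith (λ x y → w * x + y) r (combine ws rows)

    wedge-zero : ∀ {n} α s → wedge (replicate n 0#) α s ≈ 0#
    wedge-zero α []          = refl
    wedge-zero α (false ∷ s) = wedge-zero (λ s → α (false ∷ s)) s
    wedge-zero α (true ∷ s)  = trans (+-cong (zeroˡ _) (trans (*-congˡ (wedge-zero (λ s → α (true ∷ s)) s)) (zeroʳ m))) (+-identityʳ 0#)

    wedge-+ : ∀ {n} w (r u : Vec Carrier n) α s → wedge (zipWith (λ x y → w * x + y) r u) α s ≈ w * wedge r α s + wedge u α s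
    wedge-+ w [] [] α [] = sym (trans (+-identityʳ _) (zeroʳ w))
    wedge-+ w (x ∷ r) (y ∷ u) α (false ∷ s) = wedge-+ w r u (λ s → α (false ∷ s)) s
    wedge-+ w (x ∷ r) (y ∷ u) α (true ∷ s) = trans (+-congˡ (*-congˡ (wedge-+ w r u (λ s → α (true ∷ s)) s)))
      (solve 7 (λ w x y a m b c → ((w :* x :+ y) :* a :+ m :* (w :* b :+ c)) := (w :* (x :* a :+ m :* b) :+ (y :* a :+ m :* c))) refl
        w x y (α (false ∷ s)) m (wedge r (λ s → α (true ∷ s)) s) (wedge u (λ s → α (true ∷ s)) s))

    wedge-swap : ∀ {n} (u r : Vec Carrier n) ω s → wedge u (wedge r ω) s ≈ m * wedge r (wedge u ω) s
    wedge-swap u r ω s = begin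
      a               ≈⟨ +-identityʳ a ⟨
      a + 0#          ≈⟨ +-congˡ (x+mx b) ⟨
      a + (b + m * b) ≈⟨ +-assoc a b (m * b) ⟨
      (a + b) + m * b ≈⟨ +-congʳ (wedge-anticomm u r ω s) ⟩
      0# + m * b      ≈⟨ +-identityˡ _ ⟩
      m * b           ∎
      where
      a = wedge u (wedge r ω) s
      b = wedge r (wedge u ω) s

    combine∧blade : ∀ {n k} (w : Vec Carrier k) (rows : Vec (Vec Carrier n) k) s → wedge (combine w rows) (blade rows) s ≈ 0#
    combine∧blade []       []         s = wedge-zero unit s
    combine∧blade (w ∷ ws) (r ∷ rows) s = trans (wedge-+ w r (combine ws rows) (wedge r β) s)
      (trans (+-cong (trans (*-congˡ (wedge-self r β s)) (zeroʳ w))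
        (trans (wedge-swap (combine ws rows) r β s) (trans (*-congˡ (wedge-0 r (combine∧blade ws rows) s)) (zeroʳ m)))) (+-identityʳ 0#))
      where β = blade rows

    -- `β` is the product of the rows other than row `l`: every other term of the combination meets
    -- its own row again and vanishes. `ε` is the sign of moving row `l` from the front to its
    -- place.
    isolate : ∀ {n k} (w : Vec Carrier k) (rows : Vec (Vec Carrier n) k) l →
      ∃ λ (β : Ext n) → ∃ λ ε → ε * ε ≈ 1# × (∀ s → wedge (combine w rows) β s ≈ ε * (lookup w l * blade rows s))
    isolate (w ∷ ws) (r ∷ rows) zero = blade rows , 1# , *-identityˡ 1# , λ s →
      trans (wedge-+ w r (combine ws rows) (blade rows) s) (trans (trans (+-congˡ (combine∧blade ws rows s)) (+-identityʳ _)) (sym (*-identityˡ _)))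
    isolate (w ∷ ws) (r ∷ rows) (suc l) with isolate ws rows l
    ... | β , ε , εε , h = wedge r β , m * ε , trans (solve 2 (λ m e → ((m :* e) :* (m :* e)) := ((m :* m) :* (e :* e))) refl m ε) (trans (*-cong m*m εε) (*-identityˡ 1#)) , λ s → begin
      wedge (combine (w ∷ ws) (r ∷ rows)) (wedge r β) s             ≈⟨ wedge-+ w r (combine ws rows) (wedge r β) s ⟩
      w * wedge r (wedge r β) s + wedge (combine ws rows) (wedge r β) s
        ≈⟨ +-cong (trans (*-congˡ (wedge-self r β s)) (zeroʳ w)) (wedge-swap (combine ws rows) r β s) ⟩
      0# + m * wedge r (wedge (combine ws rows) β) s                ≈⟨ +-identityˡ _ ⟩
      m * wedge r (wedge (combine ws rows) β) s
        ≈⟨ *-congˡ (trans (wedge-cong r (λ s → trans (h s) (trans (sym (*-assoc ε (lookup ws l) (blade rows s)))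
             (trans (sym (+-identityʳ _)) (+-congˡ (sym (zeroˡ 0#)))))) s) (wedge-lin r (ε * lookup ws l) 0# (blade rows) (λ _ → 0#) s)) ⟩
      m * (ε * lookup ws l * wedge r (blade rows) s + 0# * wedge r (λ _ → 0#) s)  ≈⟨ *-congˡ (trans (+-congˡ (zeroˡ _)) (+-identityʳ _)) ⟩
      m * (ε * lookup ws l * wedge r (blade rows) s)                ≈⟨ solve 4 (λ m e l b → (m :* (e :* l :* b)) := ((m :* e) :* (l :* b))) refl m ε (lookup ws l) (wedge r (blade rows) s) ⟩
      (m * ε) * (lookup ws l * wedge r (blade rows) s)              ∎

    wedge-vanish : ∀ {n} (u : Vec Carrier n) → (∀ j → lookup u j ≈ 0#) → ∀ α s → wedge u α s ≈ 0#
    wedge-vanish []      h α []          = refl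
    wedge-vanish (x ∷ u) h α (false ∷ s) = wedge-vanish u (λ j → h (suc j)) (λ s → α (false ∷ s)) s
    wedge-vanish (x ∷ u) h α (true ∷ s)  = trans (+-cong (trans (*-congʳ (h zero)) (zeroˡ _))
      (trans (*-congˡ (wedge-vanish u (λ j → h (suc j)) (λ s → α (true ∷ s)) s)) (zeroʳ m))) (+-identityʳ 0#)

    leftKernel⇒top : ∀ {n k} (w : Vec Carrier k) (rows : Vec (Vec Carrier n) k) l → (∀ j → lookup (combine w rows) j ≈ 0#) →
      lookup w l * top (blade rows) ≈ 0#
    leftKernel⇒top {n} w rows l h with isolate w rows l
    ... | β , ε , εε , eq = begin
      x                ≈⟨ *-identityˡ x ⟨
      1# * x           ≈⟨ *-congʳ εε ⟨
      (ε * ε) * x      ≈⟨ *-assoc ε ε x ⟩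
      ε * (ε * x)      ≈⟨ *-congˡ (trans (sym (eq (full n))) (wedge-vanish (combine w rows) h β (full n))) ⟩
      ε * 0#           ≈⟨ zeroʳ ε ⟩
      0#               ∎
      where x = lookup w l * top (blade rows)

    sign : ℕ → Carrier
    sign zero          = 1#
    sign (suc zero)    = m
    sign (suc (suc k)) = sign k

    sumV : ∀ {k} → Vec Carrier k → Carrier
    sumV = foldr _ _+_ 0#

    det : ∀ {n} → Vec (Vec Carrier n) n → Carrier
    det {zero}  []         = 1#
    det {suc n} (r ∷ rows) = sumV (tabulate λ j → sign (toℕ j) * (lookup r j * det (map (λ row → removeAt row j) rows)))

    private
      sign-suc : ∀ k → sign (suc k) ≈ m * sign k
      sign-suc zero          = sym (*-identityʳ m)
      sign-suc (suc zero)    = sym m*m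
      sign-suc (suc (suc k)) = sign-suc k

      sumV-cong : ∀ {k} (f g : Fin k → Carrier) → (∀ j → f j ≈ g j) → sumV (tabulate f) ≈ sumV (tabulate g)
      sumV-cong {zero}  f g h = refl
      sumV-cong {suc k} f g h = +-cong (h zero) (sumV-cong (λ j → f (suc j)) (λ j → g (suc j)) λ j → h (suc j))

      sumV-* : ∀ {k} x (f : Fin k → Carrier) → x * sumV (tabulate f) ≈ sumV (tabulate λ j → x * f j)
      sumV-* {zero}  x f = zeroʳ x
      sumV-* {suc k} x f = trans (distribˡ x _ _) (+-congˡ (sumV-* x λ j → f (suc j)))

    restrict : ∀ {n} → Fin (suc n) → Ext (suc n) → Ext n
    restrict j ω s = ω (insertAt s j false)

    wedge-restrict : ∀ {n} (r : Vec Carrier (suc n)) j ω s → wedge r ω (insertAt s j false) ≈ wedge (removeAt r j) (restrict j ω) s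
    wedge-restrict (x ∷ r) zero ω s = refl
    wedge-restrict (x ∷ y ∷ r) (suc j) ω (false ∷ s) = wedge-restrict (y ∷ r) j (λ s → ω (false ∷ s)) s
    wedge-restrict (x ∷ y ∷ r) (suc j) ω (true ∷ s)  = +-congˡ (*-congˡ (wedge-restrict (y ∷ r) j (λ s → ω (true ∷ s)) s))

    unit-restrict : ∀ {n} (j : Fin (suc n)) s → unit (insertAt s j false) ≈ unit s
    unit-restrict zero    s           = refl
    unit-restrict (suc j) (false ∷ s) = unit-restrict j s
    unit-restrict (suc j) (true ∷ s)  = refl

    blade-restrict : ∀ {n k} j (rows : Vec (Vec Carrier (suc n)) k) s → restrict j (blade rows) s ≈ blade (map (λ row → removeAt row j) rows) s
    blade-restrict j []         s = unit-restrict j s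
    blade-restrict j (r ∷ rows) s = trans (wedge-restrict r j (blade rows) s) (wedge-cong (removeAt r j) (blade-restrict j rows) s)

    top-wedge : ∀ {n} (r : Vec Carrier (suc n)) ω → top (wedge r ω) ≈ sumV (tabulate λ j → sign (toℕ j) * (lookup r j * top (restrict j ω)))
    top-wedge {zero}  (x ∷ []) ω = +-cong (sym (*-identityˡ _)) (zeroʳ m)
    top-wedge {suc n} (x ∷ r)  ω = +-cong (sym (*-identityˡ _)) (begin
      m * top (wedge r t)   ≈⟨ *-congˡ (top-wedge r t) ⟩
      m * sumV (tabulate λ j → sign (toℕ j) * (lookup r j * top (restrict j t)))   ≈⟨ sumV-* m (λ j → sign (toℕ j) * (lookup r j * top (restrict j t))) ⟩
      sumV (tabulate λ j → m * (sign (toℕ j) * (lookup r j * top (restrict j t)))) ≈⟨ sumV-cong (λ j → m * (sign (toℕ j) * (lookup r j * top (restrict j t)))) (λ j → sign (suc (toℕ j)) * (lookup r j * top (restrict j t)))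
             (λ j → trans (sym (*-assoc m (sign (toℕ j)) _)) (*-congʳ (sym (sign-suc (toℕ j))))) ⟩
      sumV (tabulate λ j → sign (suc (toℕ j)) * (lookup r j * top (restrict j t))) ∎)
      where t = λ s → ω (true ∷ s)

    -- Expansion along the first row is multiplication by that row: the coordinates avoiding the
    -- `j`-th basis vector are those of the product of the shortened rows, whose top coordinate is
    -- the minor.
    det≈top : ∀ {n} (rows : Vec (Vec Carrier n) n) → det rows ≈ top (blade rows)
    det≈top {zero}  []         = refl
    det≈top {suc n} (r ∷ rows) = trans (sumV-cong (λ j → sign (toℕ j) * (lookup r j * det (map (λ row → removeAt row j) rows)))
        (λ j → sign (toℕ j) * (lookup r j * top (restrict j (blade rows)))) λ j → *-congˡ (*-congˡ
        (trans (det≈top (map (λ row → removeAt row j) rows)) (sym (blade-restrict j rows (full n))))))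
      (sym (top-wedge r (blade rows)))

    -- Over a field with nonzero determinant this leaves no kernel vector with a nonzero entry; with
    -- its left analogue it is the whole input to the construction of inverse matrices.
    rightKernel⇒det : ∀ {n} (rows : Vec (Vec Carrier n) n) v l → (∀ i → dot (lookup rows i) v ≈ 0#) → lookup v l * det rows ≈ 0#
    rightKernel⇒det rows v l h = trans (*-congˡ (det≈top rows)) (kernel⇒top v l (blade rows) (interior-blade v rows h))

    leftKernel⇒det : ∀ {n} (rows : Vec (Vec Carrier n) n) w l → (∀ j → lookup (combine w rows) j ≈ 0#) → lookup w l * det rows ≈ 0#
    leftKernel⇒det rows w l h = trans (*-congˡ (det≈top rows)) (leftKernel⇒top w rows l h)

-- Decidable subspaces, separating forms and saturation.

module EchelonForms where

  open import Level using (0ℓ)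
  open import Algebra.Bundles using (CommutativeRing)
  import Algebra.Properties.Ring
  import Relation.Binary.Reasoning.Setoid
  open import Data.List using (List; []; _∷_; length)
  open import Data.List.Membership.Propositional using (_∈_)
  open import Data.List.Relation.Unary.All as All using (All; []; _∷_)
  open import Data.List.Relation.Unary.Any using (here; there)
  open import Data.Nat as ℕ using (ℕ; zero; suc; _≤_; s≤s; z≤n)
  import Data.Nat.Properties as ℕ
  open import Data.Product using (Σ; ∃; _×_; _,_; proj₁; proj₂)
  open import Data.Sum using (_⊎_; inj₁; inj₂)
  open import Data.Unit using (⊤; tt)
  open import Relation.Binary.PropositionalEquality as ≡ using (_≡_)
  open import Relation.Nullary using (¬_; Dec; yes; no; contradiction)
  open import Relation.Nullary.Decidable using (_×-dec_)
  open Matrices using (HasInverses; module RingSolver)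

  module Subspaces (F : CommutativeRing 0ℓ 0ℓ)
    (_≟0 : ∀ x → Dec (CommutativeRing._≈_ F x (CommutativeRing.0# F))) (inverse : HasInverses F) (A : Set) where

    open CommutativeRing F hiding (zero)
    open Algebra.Properties.Ring ring
    open RingSolver F
    open Relation.Binary.Reasoning.Setoid setoid

    Vect : Set
    Vect = A → Carrier

    infix 4 _≈ᵛ_
    _≈ᵛ_ : Vect → Vect → Set
    u ≈ᵛ v = ∀ a → u a ≈ v a

    axpy : Carrier → Vect → Vect → Vect
    axpy k v u a = u a + k * v a

    reduce : A → Vect → Vect → Vect
    reduce x w v = axpy (- v x) w v

    -- Vectors are only looked at in the positions xs; piv w W is spanned by w, normalised to 1 at the first position, and W.
    data Sub : List A → Set where
      []   : Sub []
      skip : ∀ {x xs} → Sub xs → Sub (x ∷ xs)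
      piv  : ∀ {x xs} → Vect → Sub xs → Sub (x ∷ xs)

    mem : ∀ {xs} → Sub xs → Vect → Set
    mem []               v = ⊤
    mem (skip {x} W)     v = v x ≈ 0# × mem W v
    mem (piv {x} w W)    v = mem W (reduce x w v)

    mem? : ∀ {xs} (W : Sub xs) v → Dec (mem W v)
    mem? []            v = yes tt
    mem? (skip {x} W)  v = (v x ≟0) ×-dec mem? W v
    mem? (piv {x} w W) v = mem? W (reduce x w v)

    reduce-cong : ∀ x w {u v} → u ≈ᵛ v → reduce x w u ≈ᵛ reduce x w v
    reduce-cong x w h a = +-cong (h a) (*-congʳ (-‿cong (h x)))

    mem-cong : ∀ {xs} (W : Sub xs) {u v} → u ≈ᵛ v → mem W u → mem W v
    mem-cong []            h _       = tt
    mem-cong (skip {x} W)  h (z , m) = trans (sym (h x)) z , mem-cong W h m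
    mem-cong (piv {x} w W) h m       = mem-cong W (reduce-cong x w h) m

    reduce-axpy : ∀ x w k v u → reduce x w (axpy k v u) ≈ᵛ axpy k (reduce x w v) (reduce x w u)
    reduce-axpy x w k v u a = begin
      (u a + k * v a) + - (u x + k * v x) * w a
        ≈⟨ +-congˡ (*-congʳ (trans (sym (-‿+-comm (u x) (k * v x))) (+-congˡ (-‿distribʳ-* k (v x))))) ⟩
      (u a + k * v a) + (- u x + k * - v x) * w a
        ≈⟨ solve 6 (λ ua va ux vx k w → ((ua :+ k :* va) :+ (ux :+ k :* vx) :* w) := ((ua :+ ux :* w) :+ k :* (va :+ vx :* w))) refl (u a) (v a) (- u x) (- v x) k (w a) ⟩
      (u a + - u x * w a) + k * (v a + - v x * w a) ∎

    mem-axpy : ∀ {xs} (W : Sub xs) k {v u} → mem W v → mem W u → mem W (axpy k v u)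
    mem-axpy []            k _       _        = tt
    mem-axpy (skip {x} W)  k (z , m) (z′ , m′) = trans (+-cong z′ (trans (*-congˡ z) (zeroʳ k))) (+-identityʳ 0#) , mem-axpy W k m m′
    mem-axpy (piv {x} w W) k {v} {u} m m′     = mem-cong W (λ a → sym (reduce-axpy x w k v u a)) (mem-axpy W k m m′)

    -0*≈ : ∀ {y} → y ≈ 0# → ∀ z → - y * z ≈ 0#
    -0*≈ h z = trans (*-congʳ (trans (-‿cong h) -0#≈0#)) (zeroˡ z)

    reduce-0 : ∀ x w {v} → v x ≈ 0# → reduce x w v ≈ᵛ v
    reduce-0 x w {v} h a = trans (+-congˡ (-0*≈ h (w a))) (+-identityʳ (v a))

    mem-vanish : ∀ {xs} (W : Sub xs) {v} → (∀ {a} → a ∈ xs → v a ≈ 0#) → mem W v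
    mem-vanish []            h = tt
    mem-vanish (skip W)      h = h (here ≡.refl) , mem-vanish W λ a∈ → h (there a∈)
    mem-vanish (piv {x} w W) h = mem-vanish W λ a∈ → trans (reduce-0 x w (h (here ≡.refl)) _) (h (there a∈))

    dim : ∀ {xs} → Sub xs → ℕ
    dim []        = 0
    dim (skip W)  = dim W
    dim (piv _ W) = suc (dim W)

    dim≤length : ∀ {xs} (W : Sub xs) → dim W ≤ length xs
    dim≤length []        = z≤n
    dim≤length (skip W)  = ℕ.m≤n⇒m≤1+n (dim≤length W)
    dim≤length (piv _ W) = s≤s (dim≤length W)

    Form : Set
    Form = List (Carrier × A)

    app : Form → Vect → Carrier
    app []            u = 0#
    app ((q , a) ∷ φ) u = q * u a + app φ u

    app-axpy : ∀ φ k v u → app φ (axpy k v u) ≈ app φ u + k * app φ v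
    app-axpy []            k v u = sym (trans (+-congˡ (zeroʳ k)) (+-identityʳ 0#))
    app-axpy ((q , a) ∷ φ) k v u = trans (+-congˡ (app-axpy φ k v u))
      (solve 6 (λ q u k v f g → (q :* (u :+ k :* v) :+ (f :+ k :* g)) := ((q :* u :+ f) :+ k :* (q :* v :+ g))) refl q (u a) k (v a) (app φ u) (app φ v))

    -- By recursion over positions. At a pivot, the form `φ` found for the reduced vector gets the
    -- coefficient `- app φ w` at `x`; its value at `u` is then that of `φ` at `reduce x w u`, which
    -- decides membership of `u`.
    separate : ∀ {xs} (W : Sub xs) v → ¬ mem W v → Σ Form λ φ → (∀ u → mem W u → app φ u ≈ 0#) × ¬ app φ v ≈ 0#
    separate [] v ¬m = contradiction tt ¬m
    separate (skip {x} W) v ¬m with v x ≟0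
    ... | no v≉0 = (1# , x) ∷ [] , (λ u (z , _) → trans (single u) z) , λ h → v≉0 (trans (sym (single v)) h)
      where
      single : ∀ u → 1# * u x + 0# ≈ u x
      single u = trans (+-identityʳ _) (*-identityˡ (u x))
    ... | yes z with separate W v (λ m → ¬m (z , m))
    ...   | φ , kills , nz = φ , (λ u (_ , m) → kills u m) , nz
    separate (piv {x} w W) v ¬m with separate W (reduce x w v) ¬m
    ... | φ , kills , nz = (- app φ w , x) ∷ φ , (λ u m → trans (eq u) (kills (reduce x w u) m)) , λ h → nz (trans (sym (eq v)) h)
      where
      eq : ∀ u → - app φ w * u x + app φ u ≈ app φ (reduce x w u)
      eq u = trans (trans (+-comm _ _) (+-congˡ (trans (sym (-‿distribˡ-* (app φ w) (u x))) (trans (-‿cong (*-comm _ _)) (-‿distribˡ-* (u x) (app φ w))))))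
               (sym (app-axpy φ (- u x) w u))

    record Extension {xs} (W : Sub xs) (v : Vect) : Set where
      field
        W′      : Sub xs
        dim′    : dim W′ ≡ suc (dim W)
        ⊆       : ∀ {u} → mem W u → mem W′ u
        new     : mem W′ v
        minimal : ∀ {u} → mem W′ u → ∃ λ k → mem W (axpy k v u)

    insert : ∀ {xs} (W : Sub xs) v → ¬ mem W v → Extension W v
    insert [] v ¬m = contradiction tt ¬m
    insert (skip {x} W) v ¬m with v x ≟0
    ... | no v≉0 = record
      { W′ = piv w W ; dim′ = ≡.refl
      ; ⊆ = λ (z , m) → mem-cong W (λ a → sym (reduce-0 x w z a)) m
      ; new = mem-vanish W λ {a} _ → trans (+-congˡ (trans (sym (-‿distribˡ-* (v x) (w a))) (-‿cong (cancel a)))) (-‿inverseʳ (v a))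
      ; minimal = λ {u} m → - u x * i ,
          (trans (+-congˡ (trans (*-assoc _ i (v x)) (trans (*-congˡ (trans (*-comm i (v x)) vi)) (*-identityʳ _)))) (-‿inverseʳ (u x)) ,
           mem-cong W (λ a → +-congˡ (sym (*-assoc (- u x) i (v a)))) m)
      }
      where
      i = proj₁ (inverse (v x) v≉0)
      vi : v x * i ≈ 1#
      vi = proj₂ (inverse (v x) v≉0)
      w : Vect
      w a = i * v a
      cancel : ∀ a → v x * w a ≈ v a
      cancel a = trans (sym (*-assoc (v x) i (v a))) (trans (*-congʳ vi) (*-identityˡ (v a)))
    ... | yes z = record
      { W′ = skip E.W′ ; dim′ = E.dim′
      ; ⊆ = λ (z′ , m) → z′ , E.⊆ m
      ; new = z , E.new
      ; minimal = λ (z′ , m) → let (k , m′) = E.minimal m in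
          k , (trans (+-cong z′ (trans (*-congˡ z) (zeroʳ k))) (+-identityʳ 0#) , m′)
      }
      where module E = Extension (insert W v λ m → ¬m (z , m))
    insert (piv {x} w W) v ¬m = record
      { W′ = piv w E.W′ ; dim′ = ≡.cong suc E.dim′
      ; ⊆ = E.⊆
      ; new = E.new
      ; minimal = λ {u} m → let (k , m′) = E.minimal m in k , mem-cong W (λ a → sym (reduce-axpy x w k v u a)) m′
      }
      where module E = Extension (insert W (reduce x w v) ¬m)

    -- A predicate with no decision procedure, unlike `Sub`: it will be instantiated with the
    -- vanishing in `K` of a form with coefficients in `K`. `vanish` expresses that only the
    -- positions in `xs` count.
    record IsSubspace (xs : List A) (P : Vect → Set) : Set where
      field
        cong   : ∀ {u v} → u ≈ᵛ v → P u → P v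
        vanish : ∀ {u} → (∀ {a} → a ∈ xs → u a ≈ 0#) → P u
        lin    : ∀ k {v u} → P v → P u → P (axpy k v u)

    record Span {xs} (vs : List Vect) : Set₁ where
      field
        space : Sub xs
        spans : All (mem space) vs
        least : ∀ {P} → IsSubspace xs P → All P vs → ∀ {u} → mem space u → P u

    span-[] : ∀ {xs} → Span {xs} []
    span-[] {xs} = record { space = zeros xs ; spans = [] ; least = λ PS _ m → IsSubspace.vanish PS (zeros-vanish m) }
      where
      zeros : ∀ xs → Sub xs
      zeros []       = []
      zeros (x ∷ xs) = skip (zeros xs)
      zeros-vanish : ∀ {xs u} → mem (zeros xs) u → ∀ {a} → a ∈ xs → u a ≈ 0#
      zeros-vanish (z , m) (here ≡.refl) = z
      zeros-vanish (z , m) (there a∈)    = zeros-vanish m a∈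

    span-insert : ∀ {xs vs} (S : Span {xs} vs) v → ¬ mem (Span.space S) v →
                  Σ (Span {xs} (v ∷ vs)) λ S′ → dim (Span.space S′) ≡ suc (dim (Span.space S))
    span-insert S v ¬m = record
      { space = E.W′ ; spans = E.new ∷ All.map E.⊆ S.spans
      ; least = λ { PS (pv ∷ pvs) {u} m → let (k , m′) = E.minimal m in
          IsSubspace.cong PS (λ a → trans (+-assoc (u a) _ _) (trans (+-congˡ (trans (sym (distribʳ (v a) k (- k)))
            (trans (*-congʳ (-‿inverseʳ k)) (zeroˡ (v a))))) (+-identityʳ (u a)))) (IsSubspace.lin PS (- k) pv (S.least PS pvs m′)) }
      } , E.dim′
      where
      module S = Span S
      module E = Extension (insert S.space v ¬m)

    span : ∀ {xs} vs → Span {xs} vs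
    span [] = span-[]
    span (v ∷ vs) with mem? (Span.space (span vs)) v
    ... | yes m = record { space = Span.space (span vs) ; spans = m ∷ Span.spans (span vs) ; least = λ { PS (_ ∷ pvs) → Span.least (span vs) PS pvs } }
    ... | no ¬m = proj₁ (span-insert (span vs) v ¬m)

    module Saturation {xs : List A} {L : Set} (letters : List L) (T : L → Vect → Vect)
      (T-cong : ∀ g {u v} → u ≈ᵛ v → T g u ≈ᵛ T g v)
      (T-lin : ∀ g k v u → T g (axpy k v u) ≈ᵛ axpy k (T g v) (T g u))
      (T-vanish : ∀ g {u} → (∀ {a} → a ∈ xs → u a ≈ 0#) → ∀ {a} → a ∈ xs → T g u a ≈ 0#)
      (v₀ : Vect) where

      data Orbit : Vect → Set where
        origin : Orbit v₀
        step  : ∀ {g v} → g ∈ letters → Orbit v → Orbit (T g v)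

      record Invariant : Set₁ where
        field
          space  : Sub xs
          v₀∈    : mem space v₀
          stable : ∀ {g u} → g ∈ letters → mem space u → mem space (T g u)
          least  : ∀ {P} → IsSubspace xs P → (∀ {v} → Orbit v → P v) → ∀ {u} → mem space u → P u

      private
        -- Each `T g` is linear, so stability is tested on the spanning vectors only. A failed test
        -- exhibits a further orbit vector by which the span can be enlarged.
        find-escape : (W : Sub xs) (vs : List Vect) → All Orbit vs →
          (∃ λ u → Orbit u × ¬ mem W u) ⊎ (∀ {g} → g ∈ letters → All (λ v → mem W (T g v)) vs)
        find-escape W [] [] = inj₂ λ _ → []
        find-escape W (v ∷ vs) (o ∷ os) with find-escape W vs os
        ... | inj₁ e = inj₁ e
        ... | inj₂ h with go letters (λ g∈ → g∈)
          where
          go : ∀ ls → (∀ {g} → g ∈ ls → g ∈ letters) → (∃ λ u → Orbit u × ¬ mem W u) ⊎ (∀ {g} → g ∈ ls → mem W (T g v))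
          go [] sub = inj₂ λ ()
          go (g ∷ ls) sub with mem? W (T g v) | go ls (λ g∈ → sub (there g∈))
          ... | no ¬m | _      = inj₁ (T g v , step (sub (here ≡.refl)) o , ¬m)
          ... | yes m | inj₁ e = inj₁ e
          ... | yes m | inj₂ k = inj₂ λ { (here ≡.refl) → m ; (there g∈) → k g∈ }
        ...   | inj₁ e = inj₁ e
        ...   | inj₂ k = inj₂ λ g∈ → k g∈ ∷ h g∈

        -- Every escape raises the dimension by one, which pays for the unit of fuel spent; with no
        -- fuel left the dimension would exceed the number of positions.
        saturate-from : ∀ fuel {vs} (S : Span {xs} vs) → All Orbit vs → v₀ ∈ vs → length xs ≤ fuel ℕ.+ dim (Span.space S) → Invariant
        saturate-from fuel {vs} S os v₀∈vs enough with find-escape (Span.space S) vs os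
        ... | inj₂ h = record
          { space = S.space ; v₀∈ = All.lookup S.spans v₀∈vs
          ; stable = λ {g} g∈ → S.least {λ u → mem S.space (T g u)} record
              { cong = λ e → mem-cong S.space (T-cong g e)
              ; vanish = λ z → mem-vanish S.space (T-vanish g z)
              ; lin = λ k {v} {u} m m′ → mem-cong S.space (λ a → sym (T-lin g k v u a)) (mem-axpy S.space k m m′) } (h g∈)
          ; least = λ PS po → S.least PS (All.map po os) }
          where module S = Span S
        ... | inj₁ (u , o , ¬m) with span-insert S u ¬m
        saturate-from zero S os v₀∈ enough | inj₁ (u , o , ¬m) | S′ , d =
          contradiction (≡.subst (_≤ _) d (dim≤length (Span.space S′))) (ℕ.<⇒≱ (s≤s enough))
        saturate-from (suc fuel) S os v₀∈ enough | inj₁ (u , o , ¬m) | S′ , d =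
          saturate-from fuel S′ (o ∷ os) (there v₀∈)
            (≡.subst (length xs ≤_) (≡.sym (≡.trans (≡.cong (fuel ℕ.+_) d) (ℕ.+-suc fuel _))) enough)

      saturate : Invariant
      saturate = saturate-from (length xs) (span (v₀ ∷ [])) (origin ∷ []) (here ≡.refl) (ℕ.m≤m+n (length xs) _)

-- Inverse matrices from a nonzero determinant.

module Inverses where

  open import Level using (0ℓ)
  open import Algebra.Bundles using (CommutativeRing)
  import Algebra.Properties.Semiring.Sum
  import Relation.Binary.Reasoning.Setoid
  open import Data.Fin using (Fin; zero; suc; toℕ)
  open import Data.List as List using (List; []; _∷_; allFin)
  open import Data.List.Membership.Propositional.Properties using (∈-allFin; ∈-map⁺; ∈-map⁻)
  open import Data.List.Relation.Unary.All as All using (All)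
  open import Data.Nat using (ℕ; zero; suc)
  open import Data.Product using (∃; _×_; _,_; proj₁; proj₂)
  open import Data.Rational as ℚ using (ℚ; 0ℚ; 1ℚ)
  import Data.Rational.Properties as ℚ
  open import Data.Vec as Vec using (Vec; []; _∷_; lookup; tabulate)
  open import Data.Vec.Properties using (lookup∘tabulate; tabulate-cong; tabulate∘lookup; lookup-replicate; lookup-zipWith)
  open import Relation.Binary.PropositionalEquality as ≡ using (_≡_; cong; cong₂)
  open import Relation.Nullary using (¬_; Dec; yes; no; contradiction)
  import Defs
  open EchelonForms using (module Subspaces)
  open ExteriorAlgebras using (module ExteriorAlgebra)
  open Matrices
  open Localisations

  module InverseOverField (F : CommutativeRing 0ℓ 0ℓ)
    (_≟0 : ∀ x → Dec (CommutativeRing._≈_ F x (CommutativeRing.0# F))) (inverse : HasInverses F) where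

    open CommutativeRing F hiding (zero)
    open Algebra.Properties.Semiring.Sum semiring using (sum; sum-cong-≋; ∑-distrib-+; *-distribˡ-sum)
    open Mat F
    open ExteriorAlgebra F hiding (combine)
    open RingSolver F
    open Relation.Binary.Reasoning.Setoid setoid

    module _ {n : ℕ} where
      open Subspaces F _≟0 inverse (Fin n)

      coefficients : Form → Fin n → Carrier
      coefficients φ j = app φ (λ k → δ k j)

      app≈sum : ∀ φ u → app φ u ≈ sum λ j → coefficients φ j * u j
      app≈sum [] u = sym (sum-0 λ j → zeroˡ (u j))
      app≈sum ((q , a) ∷ φ) u = begin
        q * u a + app φ u                                                   ≈⟨ +-cong (*-congˡ (sym (sum-δˡ a u))) (app≈sum φ u) ⟩
        q * sum (λ j → δ a j * u j) + sum (λ j → coefficients φ j * u j)    ≈⟨ +-congʳ (*-distribˡ-sum q (λ j → δ a j * u j)) ⟩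
        sum (λ j → q * (δ a j * u j)) + sum (λ j → coefficients φ j * u j)  ≈⟨ ∑-distrib-+ (λ j → q * (δ a j * u j)) (λ j → coefficients φ j * u j) ⟨
        sum (λ j → q * (δ a j * u j) + coefficients φ j * u j)
          ≈⟨ sum-cong-≋ (λ j → solve 4 (λ q d u c → (q :* (d :* u) :+ c :* u) := ((q :* d :+ c) :* u)) refl q (δ a j) (u j) (coefficients φ j)) ⟩
        sum (λ j → coefficients ((q , a) ∷ φ) j * u j)                      ∎

      Combination : ∀ {k} → (Fin k → Vect) → Vect → Set
      Combination vs u = ∃ λ (a : _ → Carrier) → ∀ j → u j ≈ sum λ i → a i * vs i j

      combination-subspace : ∀ {k} (vs : Fin k → Vect) → IsSubspace (allFin n) (Combination vs)
      combination-subspace vs = record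
        { cong = λ uv (a , h) → a , λ j → trans (sym (uv j)) (h j)
        ; vanish = λ z → (λ _ → 0#) , λ j → trans (z (∈-allFin j)) (sym (sum-0 λ i → zeroˡ (vs i j)))
        ; lin = λ { k (a , h) (b , g) → (λ i → b i + k * a i) , λ j → trans (+-cong (g j) (*-congˡ (h j)))
            (trans (+-congˡ (*-distribˡ-sum k (λ i → a i * vs i j))) (trans (sym (∑-distrib-+ (λ i → b i * vs i j) (λ i → k * (a i * vs i j))))
              (sum-cong-≋ λ i → solve 4 (λ b v k a → (b :* v :+ k :* (a :* v)) := ((b :+ k :* a) :* v)) refl (b i) (vs i j) k (a i)))) }
        }

      -- Membership in the computed span is decidable: either `least` yields the coefficients, or
      -- `separate` yields the form that `none` excludes.
      combination-or-form : ∀ {k} (vs : Fin k → Vect) u →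
        (¬ ∃ λ c → (∀ i → sum (λ j → c j * vs i j) ≈ 0#) × ¬ sum (λ j → c j * u j) ≈ 0#) → Combination vs u
      combination-or-form {k} vs u none with mem? (Span.space S) u
        where S = span {allFin n} (List.map vs (allFin k))
      ... | yes m = Span.least S (combination-subspace vs) (All.tabulate λ v∈ → let (i , _ , e) = ∈-map⁻ vs v∈ in
                      (λ k → δ i k) , λ j → trans (reflexive (cong (λ w → w j) e)) (sym (sum-δˡ i λ i → vs i j))) m
        where S = span {allFin n} (List.map vs (allFin k))
      ... | no ¬m = let (φ , kills , nz) = separate (Span.space S) u ¬m in
          contradiction (coefficients φ , (λ i → trans (sym (app≈sum φ (vs i))) (kills (vs i) (All.lookup (Span.spans S) (∈-map⁺ vs (∈-allFin i)))))
                        , λ h → nz (trans (app≈sum φ u) h)) none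
        where S = span {allFin n} (List.map vs (allFin k))

    entries : ∀ {n} → Vec (Vec Carrier n) n → Mat n
    entries rows i j = lookup (lookup rows i) j

    dot≈sum : ∀ {n} (r : Vec Carrier n) c → dot r (tabulate c) ≈ sum λ j → c j * lookup r j
    dot≈sum []      c = refl
    dot≈sum (x ∷ r) c = +-cong (*-comm x (c zero)) (dot≈sum r λ j → c (suc j))

    lookup-combine : ∀ {n k} (c : Fin k → Carrier) (rows : Vec (Vec Carrier n) k) j →
      lookup (ExteriorAlgebra.combine F (tabulate c) rows) j ≈ sum λ i → c i * lookup (lookup rows i) j
    lookup-combine {n} c [] j = reflexive (lookup-replicate j 0#)
    lookup-combine c (r ∷ rows) j = trans (reflexive (lookup-zipWith _ j r _)) (+-congˡ (lookup-combine (λ i → c (suc i)) rows j))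

    private
      nonzero-entry : ∀ {n} (c : Fin n → Carrier) l → ¬ sum (λ j → c j * δ j l) ≈ 0# → ¬ lookup (tabulate c) l ≈ 0#
      nonzero-entry c l nz h = nz (trans (sum-δʳ l c) (trans (reflexive (≡.sym (lookup∘tabulate c l))) h))

      domain : ∀ {x y} → ¬ x ≈ 0# → x * y ≈ 0# → y ≈ 0#
      domain {x} {y} x≉0 h = let (i , xi) = inverse x x≉0 in
        trans (sym (*-identityˡ y)) (trans (*-congʳ (trans (sym xi) (*-comm x i))) (trans (*-assoc i x y) (trans (*-congˡ h) (zeroʳ i))))

    module _ {n : ℕ} (rows : Vec (Vec Carrier n) n) (det≉0 : ¬ det rows ≈ 0#) where
      private
        M = entries rows

        -- A form that kills the rows but not the unit vector at `l` is a kernel vector whose entry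
        -- at `l` is nonzero; `rightKernel⇒det` would make the determinant vanish.
        row-combination : ∀ l → Combination M (λ j → δ j l)
        row-combination l = combination-or-form M (λ j → δ j l) λ (c , kills , nz) →
          det≉0 (domain (nonzero-entry c l nz) (rightKernel⇒det rows (tabulate c) l λ i → trans (dot≈sum (lookup rows i) c) (kills i)))

        column-combination : ∀ l → Combination (λ j i → M i j) (λ i → δ i l)
        column-combination l = combination-or-form (λ j i → M i j) (λ i → δ i l) λ (c , kills , nz) →
          det≉0 (domain (nonzero-entry c l nz) (leftKernel⇒det rows (tabulate c) l λ j → trans (lookup-combine c rows j) (kills j)))

        δ-sym : ∀ {n} (i j : Fin n) → δ i j ≈ δ j i
        δ-sym zero    zero    = refl
        δ-sym zero    (suc j) = refl
        δ-sym (suc i) zero    = refl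
        δ-sym (suc i) (suc j) = δ-sym i j

        L : Mat n
        L i = proj₁ (row-combination i)

        L·M : L · M ≋ I
        L·M i j = trans (sym (proj₂ (row-combination i) j)) (δ-sym j i)

        R : Mat n
        R i j = proj₁ (column-combination j) i

        M·R : M · R ≋ I
        M·R i j = trans (sum-cong-≋ λ k → *-comm (M i k) (R k j)) (sym (proj₂ (column-combination j) i))

        L≋R : L ≋ R
        L≋R = ≋-trans (≋-sym (·-identityʳ L)) (≋-trans (·-cong (≋-refl {A = L}) (≋-sym M·R))
                (≋-trans (≋-sym (·-assoc L M R)) (≋-trans (·-cong L·M (≋-refl {A = R})) (·-identityˡ R))))

      matrix-inverse : GL n
      matrix-inverse = gl M L (≋-trans (·-cong (≋-refl {A = M}) L≋R) M·R) L·M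

  open InverseOverField ℚ-ring (λ q → q ℚ.≟ 0ℚ) inverseℚ using (matrix-inverse)

  entry : ∀ {n} → Defs.Mat n → Mℚ.Mat n
  entry M i j = lookup (lookup M i) j

  fromEntries : ∀ {n} → Mℚ.Mat n → Defs.Mat n
  fromEntries A = tabulate λ i → tabulate (A i)

  entry-fromEntries : ∀ {n} (A : Mℚ.Mat n) → entry (fromEntries A) Mℚ.≋ A
  entry-fromEntries A i j = ≡.trans (cong (λ r → lookup r j) (lookup∘tabulate (λ i → tabulate (A i)) i)) (lookup∘tabulate (A i) j)

  entry-injective : ∀ {n} {M N : Defs.Mat n} → entry M Mℚ.≋ entry N → M ≡ N
  entry-injective {M = M} {N} h = ≡.trans (≡.sym (η M)) (≡.trans (tabulate-cong λ i → tabulate-cong (h i)) (η N))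
    where
    η : ∀ {n} (M : Defs.Mat n) → fromEntries (entry M) ≡ M
    η M = ≡.trans (tabulate-cong λ i → tabulate∘lookup (lookup M i)) (tabulate∘lookup M)

  entry-idMat : ∀ {n} → entry (Defs.idMat {n}) Mℚ.≋ Mℚ.I
  entry-idMat zero zero = ≡.refl
  entry-idMat {suc n} zero (suc j) = lookup∘tabulate {n = n} _ j
  entry-idMat {suc n} (suc i) zero = cong (λ r → lookup r zero) (lookup∘tabulate {n = n} _ i)
  entry-idMat {suc n} (suc i) (suc j) = ≡.trans
    (≡.trans (cong (λ r → lookup r (suc j)) (lookup∘tabulate {n = n} _ i)) (lookup∘tabulate {n = n} _ j))
    (≡.trans (≡.sym (≡.trans (cong (λ r → lookup r j) (lookup∘tabulate {n = n} _ i)) (lookup∘tabulate {n = n} _ j))) (entry-idMat {n} i j))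

  module Sumℚ = Algebra.Properties.Semiring.Sum (CommutativeRing.semiring ℚ-ring)

  sumℚ-tabulate : ∀ {n} (f : Fin n → ℚ) → Defs.sumℚ (tabulate f) ≡ Sumℚ.sum f
  sumℚ-tabulate {zero}  f = ≡.refl
  sumℚ-tabulate {suc n} f = cong (f zero ℚ.+_) (sumℚ-tabulate λ i → f (suc i))

  entry-⊗ : ∀ {n} (M N : Defs.Mat n) → entry (M Defs.⊗ N) Mℚ.≋ entry M Mℚ.· entry N
  entry-⊗ M N i j = ≡.trans (entry-fromEntries (λ i j → Defs.sumℚ (tabulate λ k → entry M i k ℚ.* entry N k j)) i j)
    (sumℚ-tabulate λ k → entry M i k ℚ.* entry N k j)

  det≡ : ∀ {n} (M : Defs.Mat n) → Defs.det M ≡ ExteriorAlgebra.det ℚ-ring M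
  det≡ {zero}  []         = ≡.refl
  det≡ {suc n} (r ∷ rows) = cong Defs.sumℚ (tabulate-cong λ j → cong₂ ℚ._*_ (sign≡ (toℕ j)) (cong (lookup r j ℚ.*_) (det≡ (Vec.map (λ row → Vec.removeAt row j) rows))))
    where
    sign≡ : ∀ k → Defs.signℚ k ≡ ExteriorAlgebra.sign ℚ-ring k
    sign≡ zero          = ≡.refl
    sign≡ (suc zero)    = ≡.refl
    sign≡ (suc (suc k)) = sign≡ k

  det-inverse : ∀ {n} (M : Defs.Mat n) {y} → Defs.det M ℚ.* y ≡ 1ℚ →
    ∃ λ (N : Defs.Mat n) → M Defs.⊗ N ≡ Defs.idMat × N Defs.⊗ M ≡ Defs.idMat
  det-inverse {n} M {y} h = fromEntries (Mℚ.imat g) ,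
    entry-injective (Mℚ.≋-trans (entry-⊗ M (fromEntries (Mℚ.imat g))) (Mℚ.≋-trans (Mℚ.·-cong (Mℚ.≋-refl {A = entry M}) (entry-fromEntries (Mℚ.imat g)))
      (Mℚ.≋-trans (Mℚ.right g) (Mℚ.≋-sym entry-idMat)))) ,
    entry-injective (Mℚ.≋-trans (entry-⊗ (fromEntries (Mℚ.imat g)) M) (Mℚ.≋-trans (Mℚ.·-cong (entry-fromEntries (Mℚ.imat g)) (Mℚ.≋-refl {A = entry M}))
      (Mℚ.≋-trans (Mℚ.left g) (Mℚ.≋-sym entry-idMat))))
    where
    g : Mℚ.GL n
    g = matrix-inverse M λ z → contradiction (≡.trans (≡.sym h) (≡.trans (cong (ℚ._* y) (≡.trans (det≡ M) z)) (ℚ.*-zeroˡ y))) λ ()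

-- Monomial values, words, and vanishing over an extension.

module Monomials where

  open import Level using (0ℓ)
  open import Algebra.Bundles using (CommutativeRing; Group)
  import Algebra.Properties.Semiring.Sum
  import Relation.Binary.Reasoning.Setoid
  open import Data.Fin using (Fin; zero; suc)
  open import Data.List as List using (List; []; _∷_; _++_; length; allFin; cartesianProduct; cartesianProductWith)
  open import Data.List.Membership.Propositional using (_∈_)
  open import Data.List.Membership.Propositional.Properties
    using (∈-allFin; ∈-cartesianProduct⁺; ∈-cartesianProductWith⁺; ∈-cartesianProductWith⁻)
  open import Data.List.Relation.Unary.All as All using (All; []; _∷_)
  open import Data.List.Relation.Unary.Any using (here; there)
  open import Data.Nat as ℕ using (ℕ; zero; suc; _≤_; s≤s; z≤n)
  import Data.Nat.Properties as ℕ
  open import Data.Product using (∃; _×_; _,_; proj₁; proj₂)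
  open import Relation.Binary.PropositionalEquality as ≡ using (_≡_)
  open import Relation.Nullary using (Dec; yes; no; contradiction)
  open import Defs using (Poly; con; var; eval; _⊕_; _⊛_)
  open EchelonForms using (module Subspaces)
  open GeneratedSubgroups using (module Gen)
  open Matrices

  module MonomialSpans (F : CommutativeRing 0ℓ 0ℓ)
    (_≟0 : ∀ x → Dec (CommutativeRing._≈_ F x (CommutativeRing.0# F))) (inverse : HasInverses F) (N : ℕ) where

    open CommutativeRing F hiding (zero)
    open Algebra.Properties.Semiring.Sum semiring using (sum; sum-cong-≋; ∑-distrib-+; *-distribˡ-sum; *-distribʳ-sum)
    open Mat F
    open Gen F N
    open RingSolver F
    open Relation.Binary.Reasoning.Setoid setoid

    -- The order of the factors is kept, so one product may occur at several positions; in return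
    -- `translate` is a recursion on the list.
    Monomial : Set
    Monomial = List (Fin N × Fin N)

    open Subspaces F _≟0 inverse Monomial

    monomials : ℕ → List Monomial
    monomials zero    = [] ∷ []
    monomials (suc d) = [] ∷ cartesianProductWith _∷_ (cartesianProduct (allFin N) (allFin N)) (monomials d)

    ∈-monomials : ∀ d {μ} → length μ ≤ d → μ ∈ monomials d
    ∈-monomials zero    {[]}    _         = here ≡.refl
    ∈-monomials (suc d) {[]}    _         = here ≡.refl
    ∈-monomials (suc d) {(i , j) ∷ μ} (s≤s le) = there
      (∈-cartesianProductWith⁺ _∷_ (∈-cartesianProduct⁺ (∈-allFin i) (∈-allFin j)) (∈-monomials d le))

    ∈-monomials⁻ : ∀ d {μ} → μ ∈ monomials d → length μ ≤ d
    ∈-monomials⁻ zero    (here ≡.refl) = z≤n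
    ∈-monomials⁻ (suc d) (here ≡.refl) = z≤n
    ∈-monomials⁻ (suc d) (there μ∈) with ∈-cartesianProductWith⁻ _∷_ (cartesianProduct (allFin N) (allFin N)) (monomials d) μ∈
    ... | x , ν , _ , ν∈ , ≡.refl = s≤s (∈-monomials⁻ d ν∈)

    value : Mat N → Vect
    value X []            = 1#
    value X ((i , j) ∷ μ) = X i j * value X μ

    value-cong : ∀ {X Y} → X ≋ Y → value X ≈ᵛ value Y
    value-cong h []            = refl
    value-cong h ((i , j) ∷ μ) = *-cong (h i j) (value-cong h μ)

    -- The linear action of matrices for which translate g (value X) = value (g · X).
    translate : Mat N → Vect → Vect
    translate g v []            = v []
    translate g v ((i , j) ∷ μ) = sum λ k → g i k * translate g (λ ν → v ((k , j) ∷ ν)) μ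

    translate-cong : ∀ g {u v} → u ≈ᵛ v → translate g u ≈ᵛ translate g v
    translate-cong g h []            = h []
    translate-cong g h ((i , j) ∷ μ) = sum-cong-≋ λ k → *-congˡ (translate-cong g (λ ν → h ((k , j) ∷ ν)) μ)

    translate-lin : ∀ g k v u → translate g (axpy k v u) ≈ᵛ axpy k (translate g v) (translate g u)
    translate-lin g k v u []            = refl
    translate-lin g k v u ((i , j) ∷ μ) = begin
      sum (λ l → g i l * translate g (axpy k (at v l) (at u l)) μ)
        ≈⟨ sum-cong-≋ (λ l → trans (*-congˡ (translate-lin g k (at v l) (at u l) μ))
             (solve 4 (λ g a k b → (g :* (a :+ k :* b)) := (g :* a :+ k :* (g :* b))) refl (g i l) (translate g (at u l) μ) k (translate g (at v l) μ))) ⟩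
      sum (λ l → g i l * translate g (at u l) μ + k * (g i l * translate g (at v l) μ))
        ≈⟨ ∑-distrib-+ (λ l → g i l * translate g (at u l) μ) (λ l → k * (g i l * translate g (at v l) μ)) ⟩
      sum (λ l → g i l * translate g (at u l) μ) + sum (λ l → k * (g i l * translate g (at v l) μ))
        ≈⟨ +-congˡ (sym (*-distribˡ-sum k λ l → g i l * translate g (at v l) μ)) ⟩
      sum (λ l → g i l * translate g (at u l) μ) + k * sum (λ l → g i l * translate g (at v l) μ) ∎
      where
      at : Vect → Fin N → Vect
      at w l ν = w ((l , j) ∷ ν)

    translate-vanish : ∀ g d {u} → (∀ {μ} → length μ ≤ d → u μ ≈ 0#) → ∀ {μ} → length μ ≤ d → translate g u μ ≈ 0#
    translate-vanish g d       h {[]}          le       = h {[]} le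
    translate-vanish g (suc d) {u} h {(i , j) ∷ μ} (s≤s le) = sum-0 λ k →
      trans (*-congˡ (translate-vanish g d {λ ν → u ((k , j) ∷ ν)} (λ {ν} le′ → h {(k , j) ∷ ν} (s≤s le′)) {μ} le)) (zeroʳ (g i k))

    translate-value : ∀ g X q μ → translate g (λ ν → q * value X ν) μ ≈ q * value (g · X) μ
    translate-value g X q []            = refl
    translate-value g X q ((i , j) ∷ μ) = begin
      sum (λ k → g i k * translate g (λ ν → q * (X k j * value X ν)) μ)
        ≈⟨ sum-cong-≋ (λ k → *-congˡ (trans (translate-cong g (λ ν → sym (*-assoc q (X k j) (value X ν))) μ) (translate-value g X (q * X k j) μ))) ⟩
      sum (λ k → g i k * (q * X k j * value (g · X) μ))
        ≈⟨ sum-cong-≋ (λ k → solve 4 (λ g q x v → (g :* (q :* x :* v)) := (q :* (g :* x) :* v)) refl (g i k) q (X k j) (value (g · X) μ)) ⟩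
      sum (λ k → q * (g i k * X k j) * value (g · X) μ)
        ≈⟨ *-distribʳ-sum (value (g · X) μ) (λ k → q * (g i k * X k j)) ⟨
      sum (λ k → q * (g i k * X k j)) * value (g · X) μ
        ≈⟨ *-congʳ (*-distribˡ-sum q λ k → g i k * X k j) ⟨
      q * (g · X) i j * value (g · X) μ
        ≈⟨ *-assoc q _ _ ⟩
      q * ((g · X) i j * value (g · X) μ) ∎

    translate-value₁ : ∀ g X → translate g (value X) ≈ᵛ value (g · X)
    translate-value₁ g X μ = trans (translate-cong g (λ ν → sym (*-identityˡ (value X ν))) μ) (trans (translate-value g X 1# μ) (*-identityˡ _))

    monomialPoly : Monomial → MatPoly N
    monomialPoly []      = con 1#
    monomialPoly (x ∷ μ) = var x ⊛ monomialPoly μ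

    ev-monomialPoly : ∀ μ X → ev (monomialPoly μ) X ≈ value X μ
    ev-monomialPoly []            X = refl
    ev-monomialPoly ((i , j) ∷ μ) X = *-congˡ (ev-monomialPoly μ X)

    toPoly : Form → MatPoly N
    toPoly []            = con 0#
    toPoly ((q , μ) ∷ φ) = (con q ⊛ monomialPoly μ) ⊕ toPoly φ

    ev-toPoly : ∀ φ X → ev (toPoly φ) X ≈ app φ (value X)
    ev-toPoly []            X = refl
    ev-toPoly ((q , μ) ∷ φ) X = +-cong (*-congˡ (ev-monomialPoly μ X)) (ev-toPoly φ X)

    letters : List (GL N) → List (Mat N)
    letters []       = []
    letters (g ∷ gs) = mat g ∷ imat g ∷ letters gs

    -- Letters are multiplied on the left one at a time, which matches the steps of `Orbit` under
    -- `translate`. Inverses of generators are letters too, so no separate rule for inversion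
    -- occurs.
    data Word (gs : List (GL N)) : Mat N → Set where
      empty : Word gs I
      _∷_   : ∀ {a X} → a ∈ letters gs → Word gs X → Word gs (a · X)

    HasWord : List (GL N) → Mat N → Set
    HasWord gs A = ∃ λ X → Word gs X × X ≋ A

    word-· : ∀ {gs X} → Word gs X → ∀ {B} → HasWord gs B → HasWord gs (X · B)
    word-· empty {B} (Y , w , e) = Y , w , ≋-trans e (≋-sym (·-identityˡ B))
    word-· {gs} (_∷_ {a} {X} a∈ v) {B} h = let (Y , w , e) = word-· v h in
      a · Y , a∈ ∷ w , ≋-trans (·-cong (≋-refl {A = a}) e) (≋-sym (·-assoc a X B))

    hasWord-· : ∀ {gs A B} → HasWord gs A → HasWord gs B → HasWord gs (A · B)
    hasWord-· {B = B} (X , v , e) h = let (Y , w , e′) = word-· v h in Y , w , ≋-trans e′ (·-cong e (≋-refl {A = B}))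

    letter-word : ∀ {gs a} → a ∈ letters gs → HasWord gs a
    letter-word {a = a} a∈ = a · I , a∈ ∷ empty , ·-identityʳ a

    generator-letters : ∀ {gs g} → g ∈ gs → mat g ∈ letters gs × imat g ∈ letters gs
    generator-letters (here ≡.refl) = here ≡.refl , there (here ≡.refl)
    generator-letters (there g∈) = let (a , b) = generator-letters g∈ in there (there a) , there (there b)

    W⇒word : ∀ gs {x} → W gs x → HasWord gs (mat x)
    W⇒word gs w = proj₁ (W-least {P = λ x → HasWord gs (mat x) × HasWord gs (imat x)} record
      { resp = λ {x} {y} e ((X , v , h) , (Y , u , k)) → (X , v , ≋-trans h e) , (Y , u , ≋-trans k (⁻¹-cong {x} {y} e))
      ; ε∈   = (I , empty , ≋-refl) , (I , empty , ≋-refl)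
      ; ∙∈   = λ (a , a′) (b , b′) → hasWord-· a b , hasWord-· b′ a′
      ; ⁻¹∈  = λ (a , a′) → a′ , a
      } (λ g∈ → let (a , b) = generator-letters g∈ in letter-word a , letter-word b) w)
      where open Group (GL-group N) using (⁻¹-cong)

    module _ (gs : List (GL N)) (d : ℕ) where
      private
        translate-local : ∀ g {u} → (∀ {μ} → μ ∈ monomials d → u μ ≈ 0#) → ∀ {μ} → μ ∈ monomials d → translate g u μ ≈ 0#
        translate-local g {u} h {μ} μ∈ = translate-vanish g d {u} (λ {ν} le → h (∈-monomials d {ν} le)) {μ} (∈-monomials⁻ d μ∈)

        module S = Saturation {monomials d} (letters gs) translate translate-cong translate-lin translate-local (value I)
        module Inv = S.Invariant S.saturate

      word-value : ∀ {X} → Word gs X → mem Inv.space (value X)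
      word-value empty               = Inv.v₀∈
      word-value (_∷_ {a} {X} a∈ w) = mem-cong Inv.space (translate-value₁ a X) (Inv.stable a∈ (word-value w))

      orbit-value : ∀ {v} → S.Orbit v → ∃ λ X → Word gs X × value X ≈ᵛ v
      orbit-value S.origin = I , empty , λ _ → refl
      orbit-value (S.step {g} g∈ o) = let (X , w , e) = orbit-value o in
        g · X , g∈ ∷ w , λ μ → trans (sym (translate-value₁ g X μ)) (translate-cong g e μ)

      -- Constructively, the values at a point of the closure of ⟨gs⟩ are combinations of the values at words in gs.
      closure-principle : ∀ {P} → IsSubspace (monomials d) P → (∀ {X} → Word gs X → P (value X)) →
        ∀ A → Closure (Image gs) A → P (value A)
      closure-principle PS pw A cl with mem? Inv.space (value A)
      ... | yes m = Inv.least PS (λ o → let (X , w , e) = orbit-value o in IsSubspace.cong PS e (pw w)) m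
      ... | no ¬m = let (φ , kills , nz) = separate Inv.space (value A) ¬m in
        contradiction (trans (sym (ev-toPoly φ A)) (cl (toPoly φ) λ { B (y , wy , e) →
          trans (ev-cong (toPoly φ) (≋-sym e)) (trans (ev-toPoly φ (mat y)) (let (X , w , h) = W⇒word gs wy in
            kills (value (mat y)) (mem-cong Inv.space (value-cong h) (word-value w)))) })) nz

    module Coefficients (K : CommutativeRing 0ℓ 0ℓ) (ι : CommutativeRing.Carrier F → CommutativeRing.Carrier K)
      (ι-cong : ∀ {x y} → x ≈ y → CommutativeRing._≈_ K (ι x) (ι y))
      (ι-+ : ∀ x y → CommutativeRing._≈_ K (ι (x + y)) (CommutativeRing._+_ K (ι x) (ι y)))
      (ι-* : ∀ x y → CommutativeRing._≈_ K (ι (x * y)) (CommutativeRing._*_ K (ι x) (ι y)))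
      (ι-1 : CommutativeRing._≈_ K (ι 1#) (CommutativeRing.1# K))
      (ι-0 : CommutativeRing._≈_ K (ι 0#) (CommutativeRing.0# K)) where

      private
        module K = CommutativeRing K
        module KS = RingSolver K

      -- A polynomial over `K`, restricted to matrices over `F`, becomes a form with coefficients in
      -- `K` in their vector of monomial values.
      KForm : Set
      KForm = List (K.Carrier × Monomial)

      appᴷ : KForm → Vect → K.Carrier
      appᴷ []            u = K.0#
      appᴷ ((c , μ) ∷ φ) u = c K.* ι (u μ) K.+ appᴷ φ u

      appᴷ-++ : ∀ φ ψ u → appᴷ (φ ++ ψ) u K.≈ appᴷ φ u K.+ appᴷ ψ u
      appᴷ-++ []            ψ u = K.sym (K.+-identityˡ _)
      appᴷ-++ ((c , μ) ∷ φ) ψ u = K.trans (K.+-congˡ (appᴷ-++ φ ψ u)) (K.sym (K.+-assoc _ _ _))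

      value-++ : ∀ X μ ν → value X (μ ++ ν) ≈ value X μ * value X ν
      value-++ X []            ν = sym (*-identityˡ _)
      value-++ X ((i , j) ∷ μ) ν = trans (*-congˡ (value-++ X μ ν)) (sym (*-assoc _ _ _))

      scale : K.Carrier → Monomial → KForm → KForm
      scale c μ []            = []
      scale c μ ((b , ν) ∷ ψ) = (c K.* b , μ ++ ν) ∷ scale c μ ψ

      appᴷ-scale : ∀ c μ ψ X → appᴷ (scale c μ ψ) (value X) K.≈ c K.* ι (value X μ) K.* appᴷ ψ (value X)
      appᴷ-scale c μ []            X = K.sym (K.zeroʳ _)
      appᴷ-scale c μ ((b , ν) ∷ ψ) X = K.trans
        (K.+-cong (K.*-congˡ (K.trans (ι-cong (value-++ X μ ν)) (ι-* _ _))) (appᴷ-scale c μ ψ X))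
        (KS.solve 5 (λ c b m n s → (c KS.:* b KS.:* (m KS.:* n) KS.:+ c KS.:* m KS.:* s) KS.:= (c KS.:* m KS.:* (b KS.:* n KS.:+ s))) K.refl
          c b (ι (value X μ)) (ι (value X ν)) (appᴷ ψ (value X)))

      product : KForm → KForm → KForm
      product []            ψ = []
      product ((c , μ) ∷ φ) ψ = scale c μ ψ ++ product φ ψ

      appᴷ-product : ∀ φ ψ X → appᴷ (product φ ψ) (value X) K.≈ appᴷ φ (value X) K.* appᴷ ψ (value X)
      appᴷ-product []            ψ X = K.sym (K.zeroˡ _)
      appᴷ-product ((c , μ) ∷ φ) ψ X = K.trans (appᴷ-++ (scale c μ ψ) (product φ ψ) (value X))
        (K.trans (K.+-cong (appᴷ-scale c μ ψ X) (appᴷ-product φ ψ X)) (K.sym (K.distribʳ _ _ _)))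

      linearise : ∀ {V} → (V → Fin N × Fin N) → Poly K V → KForm
      linearise ix (con c) = (c , []) ∷ []
      linearise ix (var v) = (K.1# , ix v ∷ []) ∷ []
      linearise ix (f ⊕ g) = linearise ix f ++ linearise ix g
      linearise ix (f ⊛ g) = product (linearise ix f) (linearise ix g)

      appᴷ-linearise : ∀ {V} (ix : V → Fin N × Fin N) f X →
        eval K f (λ v → ι (X (proj₁ (ix v)) (proj₂ (ix v)))) K.≈ appᴷ (linearise ix f) (value X)
      appᴷ-linearise ix (con c) X = K.sym (K.trans (K.+-identityʳ _) (K.trans (K.*-congˡ ι-1) (K.*-identityʳ c)))
      appᴷ-linearise ix (var v) X = K.sym (K.trans (K.+-identityʳ _) (K.trans (K.*-identityˡ _) (ι-cong (*-identityʳ _))))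
      appᴷ-linearise ix (f ⊕ g) X = K.trans (K.+-cong (appᴷ-linearise ix f X) (appᴷ-linearise ix g X)) (K.sym (appᴷ-++ (linearise ix f) (linearise ix g) (value X)))
      appᴷ-linearise ix (f ⊛ g) X = K.trans (K.*-cong (appᴷ-linearise ix f X) (appᴷ-linearise ix g X)) (K.sym (appᴷ-product (linearise ix f) (linearise ix g) X))

      degree : KForm → ℕ
      degree []            = 0
      degree ((c , μ) ∷ φ) = length μ ℕ.⊔ degree φ

      appᴷ-subspace : ∀ d φ → degree φ ≤ d → IsSubspace (monomials d) λ u → appᴷ φ u K.≈ K.0#
      appᴷ-subspace d φ le = record
        { cong = λ e h → K.trans (K.sym (respects φ e)) h
        ; vanish = λ {u} z → vanishes φ le {u} λ {μ} le′ → z (∈-monomials d {μ} le′)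
        ; lin = λ k {v} {u} hv hu → K.trans (linear φ k v u) (K.trans (K.+-cong hu (K.trans (K.*-congˡ hv) (K.zeroʳ _))) (K.+-identityʳ _))
        }
        where
        respects : ∀ φ {u v} → u ≈ᵛ v → appᴷ φ u K.≈ appᴷ φ v
        respects []            e = K.refl
        respects ((c , μ) ∷ φ) e = K.+-cong (K.*-congˡ (ι-cong (e μ))) (respects φ e)
        vanishes : ∀ φ → degree φ ≤ d → ∀ {u} → (∀ {μ} → length μ ≤ d → u μ ≈ 0#) → appᴷ φ u K.≈ K.0#
        vanishes []            le z = K.refl
        vanishes ((c , μ) ∷ φ) le {u} z = K.trans (K.+-cong (K.trans (K.*-congˡ (K.trans (ι-cong (z {μ} (ℕ.m⊔n≤o⇒m≤o (length μ) (degree φ) le))) ι-0)) (K.zeroʳ c))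
          (vanishes φ (ℕ.m⊔n≤o⇒n≤o (length μ) (degree φ) le) {u} z)) (K.+-identityʳ _)
        linear : ∀ φ k v u → appᴷ φ (axpy k v u) K.≈ appᴷ φ u K.+ ι k K.* appᴷ φ v
        linear []            k v u = K.sym (K.trans (K.+-identityˡ _) (K.zeroʳ _))
        linear ((c , μ) ∷ φ) k v u = K.trans (K.+-cong (K.*-congˡ (K.trans (ι-+ _ _) (K.+-congˡ (ι-* k (v μ))))) (linear φ k v u))
          (KS.solve 6 (λ c u k v s t → (c KS.:* (u KS.:+ k KS.:* v) KS.:+ (s KS.:+ k KS.:* t)) KS.:= ((c KS.:* u KS.:+ s) KS.:+ k KS.:* (c KS.:* v KS.:+ t))) K.refl
            c (ι (u μ)) (ι k) (ι (v μ)) (appᴷ φ u) (appᴷ φ v))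

      -- As `ι` is a homomorphism, the vectors on which a form over `K` vanishes are a subspace over
      -- `F`. It contains the values at all words, hence by `closure-principle` those at `A`; only
      -- equality in `F` is ever decided.
      vanishes-on-closure : ∀ {V} (ix : V → Fin N × Fin N) f gs →
        (∀ {X} → Word gs X → eval K f (λ v → ι (X (proj₁ (ix v)) (proj₂ (ix v)))) K.≈ K.0#) →
        ∀ A → Closure (Image gs) A → eval K f (λ v → ι (A (proj₁ (ix v)) (proj₂ (ix v)))) K.≈ K.0#
      vanishes-on-closure ix f gs h A cl = K.trans (appᴷ-linearise ix f A)
        (closure-principle gs (degree φ) (appᴷ-subspace (degree φ) φ ℕ.≤-refl)
          (λ {X} w → K.trans (K.sym (appᴷ-linearise ix f X)) (h w)) A cl)
        where φ = linearise ix f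

-- From closures over K to the bound on the chain.

module ChainLength where

  open import Level using (0ℓ)
  open import Algebra.Bundles using (CommutativeRing; Group)
  import Algebra.Properties.Group
  import Algebra.Properties.Semiring.Sum
  open import Data.Fin as Fin using (Fin; zero; suc; toℕ; fromℕ<)
  open import Data.Fin.Properties using (toℕ-fromℕ<)
  open import Data.List using (List; []; _∷_; length)
  open import Data.List.Membership.Propositional using (_∈_)
  open import Data.List.Relation.Unary.Any using (here; there)
  open import Data.Nat as ℕ using (ℕ; zero; suc; _≤_; _<_; _^_; _!; s≤s; z≤n)
  import Data.Nat.Properties as ℕ
  open import Data.Nat.Tactic.RingSolver using (solve-∀)
  open import Data.Product using (Σ; ∃; _×_; _,_; proj₁; proj₂)
  open import Data.Rational as ℚ using (ℚ; 0ℚ; 1ℚ)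
  import Data.Rational.Properties as ℚ
  open import Data.Sum using (inj₁; inj₂)
  open import Data.Unit using (tt)
  open import Relation.Binary.PropositionalEquality as ≡ using (_≡_; cong; cong₂; subst)
  open import Relation.Nullary using (¬_)
  open import Relation.Nullary.Decidable using (decidable-stable)
  open import Defs
  open Arithmetic using (1≤^; 1≤-*; 1≤!)
  open Chains using (stepBound)
  open GeneratedSubgroups using (module Gen)
  open Inverses
  open Matrices using (module Mat)
  open Monomials using (module MonomialSpans)
  open Localisations using (module Mℚ; ℚ-ring; inverseℚ)
  open RationalChains using (W; Chainℚ; chain-boundℚ)

  module Points (n : ℕ) where
    open Gen ℚ-ring (suc n) hiding (W)
    open Algebra.Properties.Semiring.Sum (CommutativeRing.semiring ℚ-ring) using (sum)

    -- From here on y is just another diagonal entry: that it inverts det M is only used to find inverse matrices.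
    block : Pt n → Mℚ.Mat (suc n)
    block (M , y) zero    zero    = y
    block (M , y) zero    (suc j) = 0ℚ
    block (M , y) (suc i) zero    = 0ℚ
    block (M , y) (suc i) (suc j) = entry M i j

    block-· : ∀ M y N z → block (M ⊗ N , y ℚ.* z) Mℚ.≋ block (M , y) Mℚ.· block (N , z)
    block-· M y N z zero zero = ≡.sym (≡.trans (cong (y ℚ.* z ℚ.+_) (Mℚ.sum-0 {n} {λ k → 0ℚ ℚ.* 0ℚ} λ k → ≡.refl)) (ℚ.+-identityʳ _))
    block-· M y N z zero (suc j) = ≡.sym (≡.trans (cong₂ ℚ._+_ (ℚ.*-zeroʳ y) (Mℚ.sum-0 λ k → ℚ.*-zeroˡ (entry N k j))) ≡.refl)
    block-· M y N z (suc i) zero = ≡.sym (≡.trans (cong₂ ℚ._+_ (ℚ.*-zeroˡ z) (Mℚ.sum-0 λ k → ℚ.*-zeroʳ (entry M i k))) ≡.refl)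
    block-· M y N z (suc i) (suc j) = ≡.trans (entry-⊗ M N i j) (≡.sym (ℚ.+-identityˡ (sum λ k → entry M i k ℚ.* entry N k j)))

    block-I : block (idMat , 1ℚ) Mℚ.≋ Mℚ.I
    block-I zero    zero    = ≡.refl
    block-I zero    (suc j) = ≡.refl
    block-I (suc i) zero    = ≡.refl
    block-I (suc i) (suc j) = entry-idMat i j

    block-inverse : ∀ M y N z → M ⊗ N ≡ idMat → y ℚ.* z ≡ 1ℚ → block (M , y) Mℚ.· block (N , z) Mℚ.≋ Mℚ.I
    block-inverse M y N z e f = Mℚ.≋-trans (Mℚ.≋-sym (block-· M y N z))
      (subst (λ p → block p Mℚ.≋ Mℚ.I) (≡.sym (cong₂ _,_ e f)) block-I)

    module _ (S : Pt n → Set) (S⊆GL : ∀ p → S p → InGL p) where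

      record HasInverse (p : Pt n) : Set where
        constructor hasInverse
        field
          p⁻¹    : Pt n
          p⁻¹∈   : ⟨ S ⟩ p⁻¹
          rightᵖ : block p Mℚ.· block p⁻¹ Mℚ.≋ Mℚ.I
          leftᵖ  : block p⁻¹ Mℚ.· block p Mℚ.≋ Mℚ.I

      -- For `inv` only a left inverse relation is given; comparing it with the inverse obtained
      -- recursively for the original element supplies the other side.
      has-inverse : ∀ {p} → ⟨ S ⟩ p → HasInverse p
      has-inverse {M , y} (gen s) =
        let h = S⊆GL (M , y) s ; (N , MN , NM) = det-inverse M h ; zy = h ; yz = ≡.trans (ℚ.*-comm y (det M)) h in
        hasInverse (N , det M) (inv (gen s) NM zy) (block-inverse M y N (det M) MN yz) (block-inverse N (det M) M y NM zy)
      has-inverse one = hasInverse (idMat , 1ℚ) one idem idem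
        where
        idem : block (idMat , 1ℚ) Mℚ.· block (idMat , 1ℚ) Mℚ.≋ Mℚ.I
        idem = Mℚ.≋-trans (Mℚ.·-cong block-I block-I) (Mℚ.·-identityˡ Mℚ.I)
      has-inverse (mul {M} {y} {N} {z} a b) with has-inverse a | has-inverse b
      ... | hasInverse (M′ , y′) a′ ra la | hasInverse (N′ , z′) b′ rb lb =
        hasInverse (N′ ⊗ M′ , z′ ℚ.* y′) (mul b′ a′)
          (Mℚ.≋-trans (Mℚ.·-cong (block-· M y N z) (block-· N′ z′ M′ y′)) (Mℚ.right gh))
          (Mℚ.≋-trans (Mℚ.·-cong (block-· N′ z′ M′ y′) (block-· M y N z)) (Mℚ.left gh))
        where
        gh : Mℚ.GL (suc n)
        gh = Group._∙_ (Mℚ.GL-group (suc n)) (Mℚ.gl (block (M , y)) (block (M′ , y′)) ra la) (Mℚ.gl (block (N , z)) (block (N′ , z′)) rb lb)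
      has-inverse (inv {M} {y} {N} {z} a NM zy) with has-inverse a
      ... | hasInverse p′ a′ ra la = hasInverse (M , y) a NM≋ (Mℚ.≋-trans (Mℚ.·-cong (Mℚ.≋-refl {A = block (M , y)}) N≋) ra)
        where
        NM≋ : block (N , z) Mℚ.· block (M , y) Mℚ.≋ Mℚ.I
        NM≋ = block-inverse N z M y NM zy
        N≋ : block (N , z) Mℚ.≋ block p′
        N≋ = Mℚ.≋-trans (Mℚ.≋-sym (Mℚ.·-identityʳ (block (N , z)))) (Mℚ.≋-trans (Mℚ.·-cong (Mℚ.≋-refl {A = block (N , z)}) (Mℚ.≋-sym ra))
               (Mℚ.≋-trans (Mℚ.≋-sym (Mℚ.·-assoc (block (N , z)) (block (M , y)) (block p′)))
                 (Mℚ.≋-trans (Mℚ.·-cong NM≋ (Mℚ.≋-refl {A = block p′})) (Mℚ.·-identityˡ (block p′)))))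

      toGL : ∀ {p} → ⟨ S ⟩ p → Mℚ.GL (suc n)
      toGL {p} s = let h = has-inverse s in Mℚ.gl (block p) (block (HasInverse.p⁻¹ h)) (HasInverse.rightᵖ h) (HasInverse.leftᵖ h)

    Blocks : (Pt n → Set) → Mℚ.Mat (suc n) → Set
    Blocks S A = ∃ λ p → ⟨ S ⟩ p × block p Mℚ.≋ A

    Blocks-· : ∀ {S A B} → Blocks S A → Blocks S B → Blocks S (A Mℚ.· B)
    Blocks-· ((M , y) , s , e) ((N , z) , t , f) = (M ⊗ N , y ℚ.* z) , mul s t , Mℚ.≋-trans (block-· M y N z) (Mℚ.·-cong e f)

    Closureℚ : (Pt n → Set) → Mℚ.Mat (suc n) → Set
    Closureℚ S = Mℚ.Closure (Blocks S)

    Blocks⊆Closure : ∀ {S A} → Blocks S A → Closureℚ S A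
    Blocks⊆Closure b f h = h _ b

    -- `W` contains inverses, while a closure in terms of the entries is only shown to be
    -- multiplicative; the property is therefore carried for a matrix and its inverse together.
    Both : (Mℚ.Mat (suc n) → Set) → Mℚ.GL (suc n) → Set
    Both P g = P (Mℚ.mat g) × P (Mℚ.imat g)

    W⊆ : ∀ {P : Mℚ.Mat (suc n) → Set} → (∀ {A B} → A Mℚ.≋ B → P A → P B) → P Mℚ.I → (∀ {A B} → P A → P B → P (A Mℚ.· B)) →
         ∀ {gs} → (∀ {g} → g ∈ gs → Both P g) → ∀ {x} → W gs x → Both P x
    W⊆ P-resp P-I P-· = W-least record
      { resp = λ {x} {y} e (a , b) → P-resp e a , P-resp (Group.⁻¹-cong (Mℚ.GL-group (suc n)) {x} {y} e) b
      ; ε∈ = P-I , P-I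
      ; ∙∈ = λ (a , a′) (b , b′) → P-· a b , P-· b′ a′
      ; ⁻¹∈ = λ (a , a′) → a′ , a
      }

    I∈Blocks : ∀ {S} → Blocks S Mℚ.I
    I∈Blocks = (idMat , 1ℚ) , one , block-I

    W⊆Closure : ∀ {S gs} → (∀ {g} → g ∈ gs → Both (Closureℚ S) g) → ∀ {x} → W gs x → Both (Closureℚ S) x
    W⊆Closure = W⊆ Mℚ.Closure-resp (Blocks⊆Closure I∈Blocks) (Mℚ.Closure-· Blocks-·)

    bound : ℕ
    bound = suc (suc n ℕ.* suc n) ℕ.* suc (stepBound (suc n))

    module _ (S : Pt n → Set) (S⊆GL : ∀ p → S p → InGL p) where

      Dense : List (Mℚ.GL (suc n)) → Set
      Dense gs = (∀ {g} → g ∈ gs → Both (Blocks S) g) × (∀ {p} → ⟨ S ⟩ p → Mℚ.Closure (Image gs) (block p))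

      private
        Chained : ℕ → Set
        Chained l = ∃ λ gs → length gs ≡ l × Chainℚ gs × (∀ {g} → g ∈ gs → Both (Blocks S) g)

        toGL-blocks : ∀ {p} (s : ⟨ S ⟩ p) → Both (Blocks S) (toGL S S⊆GL s)
        toGL-blocks {p} s = (p , s , Mℚ.≋-refl) , (HasInverse.p⁻¹ h , HasInverse.p⁻¹∈ h , Mℚ.≋-refl)
          where h = has-inverse S S⊆GL s

        longer : ¬ (∃ Dense) → ∀ {l} → Chained l → ¬ ¬ Chained (suc l)
        longer none (gs , len , chain , gs∈) k = none (gs , gs∈ , λ {p} s f kills → decidable-stable (_ ℚ.≟ 0ℚ) λ nz →
          k (toGL S S⊆GL s ∷ gs , cong suc len , ((f , (λ x w → kills _ (x , w , Mℚ.≋-refl)) , nz) , chain) ,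
             λ { (here ≡.refl) → toGL-blocks s ; (there g∈) → gs∈ g∈ }))

        chained : ¬ (∃ Dense) → ∀ l → ¬ ¬ Chained l
        chained none zero    k = k ([] , ≡.refl , tt , λ ())
        chained none (suc l) k = chained none l λ c → longer none c k

      -- The chain bound plays the part of a Noetherian condition: as long as `gs` is not dense, a
      -- polynomial separates some element of `⟨ S ⟩` from `W gs`, and this element prolongs the
      -- chain until it is too long.
      dense : ¬ ¬ (∃ Dense)
      dense none = chained none bound λ (gs , len , chain , _) →
        ℕ.<⇒≱ (chain-boundℚ (s≤s z≤n) gs chain) (ℕ.≤-reflexive (≡.sym len))

    module OverK (K : CommutativeRing 0ℓ 0ℓ) (AK : IsAlgebraicClosureOfℚ K) where
      private
        module K = CommutativeRing K
        module AK = IsAlgebraicClosureOfℚ AK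
        open Algebra.Properties.Group (K.+-group) using (∙-cancelˡ)
        ι = AK.ι

        ι-cong : ∀ {x y} → x ≡ y → ι x K.≈ ι y
        ι-cong e = K.reflexive (cong ι e)

        ι-0 : ι 0ℚ K.≈ K.0#
        ι-0 = ∙-cancelˡ (ι 0ℚ) _ _ (K.trans (K.sym (AK.ι-+ 0ℚ 0ℚ)) (K.sym (K.+-identityʳ (ι 0ℚ))))

        ι-injective : ∀ q → ι q K.≈ K.0# → q ≡ 0ℚ
        ι-injective q h = decidable-stable (q ℚ.≟ 0ℚ) λ q≢0 → let (r , qr) = inverseℚ q q≢0 in
          AK.1≉0 (K.trans (K.sym AK.ι-1) (K.trans (ι-cong (≡.sym qr)) (K.trans (AK.ι-* q r) (K.trans (K.*-congʳ h) (K.zeroˡ _)))))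

        index : Var K n → Fin (suc n) × Fin (suc n)
        index (inj₁ (i , j)) = suc i , suc j
        index (inj₂ tt)      = zero , zero

        embed≈ : ∀ p v → embed K ι p v K.≈ ι (block p (proj₁ (index v)) (proj₂ (index v)))
        embed≈ p (inj₁ (i , j)) = K.refl
        embed≈ p (inj₂ tt)      = K.refl

        open MonomialSpans ℚ-ring (λ q → q ℚ.≟ 0ℚ) inverseℚ (suc n) using (module Coefficients; Word)
        open Coefficients K ι ι-cong AK.ι-+ AK.ι-* AK.ι-1 ι-0 using (vanishes-on-closure)
        open Mat K using (eval-cong)

        coordinate : Fin (suc n) × Fin (suc n) → Poly K (Var K n)
        coordinate (zero  , zero)  = var (inj₂ tt)
        coordinate (zero  , suc j) = con K.0#
        coordinate (suc i , zero)  = con K.0#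
        coordinate (suc i , suc j) = var (inj₁ (i , j))

        eval-coordinate : ∀ p x → eval K (coordinate x) (embed K ι p) K.≈ ι (block p (proj₁ x) (proj₂ x))
        eval-coordinate p (zero  , zero)  = K.refl
        eval-coordinate p (zero  , suc j) = K.sym ι-0
        eval-coordinate p (suc i , zero)  = K.sym ι-0
        eval-coordinate p (suc i , suc j) = K.refl

        toK : Mℚ.MatPoly (suc n) → Poly K (Var K n)
        toK (con c) = con (ι c)
        toK (var x) = coordinate x
        toK (f ⊕ g) = toK f ⊕ toK g
        toK (f ⊛ g) = toK f ⊛ toK g

        eval-toK : ∀ f p → eval K (toK f) (embed K ι p) K.≈ ι (Mℚ.ev f (block p))
        eval-toK (con c) p = K.refl
        eval-toK (var x) p = eval-coordinate p x
        eval-toK (f ⊕ g) p = K.trans (K.+-cong (eval-toK f p) (eval-toK g p)) (K.sym (AK.ι-+ _ _))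
        eval-toK (f ⊛ g) p = K.trans (K.*-cong (eval-toK f p) (eval-toK g p)) (K.sym (AK.ι-* _ _))

      Closureᴷ : (Pt n → Set) → (Var K n → K.Carrier) → Set
      Closureᴷ S = ZariskiClosure K ι ⟨ S ⟩

      -- The K-inclusion is tested at a rational point with a polynomial of rational coefficients;
      -- `toK` lifts the polynomial and `ι-injective` brings the vanishing back.
      descend : ∀ {S S′} → (∀ x → Closureᴷ S x → Closureᴷ S′ x) → ∀ {A} → Blocks S A → Closureℚ S′ A
      descend sub (p , s , e) = Mℚ.Closure-resp e λ f kills → ι-injective _ (K.trans (K.sym (eval-toK f p))
        (sub (embed K ι p) (λ g h → h p s) (toK f) λ q t → K.trans (eval-toK f q) (K.trans (ι-cong (kills (block q) (q , t , Mℚ.≋-refl))) ι-0)))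

      -- A polynomial over `K` vanishing on `⟨ S ⟩` vanishes at the words in `gs`, hence at the
      -- rational points of their closure. By density and `sub` these include `⟨ S′ ⟩`, so the
      -- polynomial may be applied to `cl`.
      ascend : ∀ {S S′} (S⊆GL : ∀ p → S p → InGL p) → ∃ (Dense S S⊆GL) → (∀ {p} → ⟨ S′ ⟩ p → Closureℚ S (block p)) →
               ∀ x → Closureᴷ S′ x → Closureᴷ S x
      ascend {S} {S′} S⊆GL (gs , gs∈ , dense) sub x cl f h = cl f λ p s →
        K.trans (eval-cong f (embed≈ p)) (vanishes-on-closure index f gs
          (λ {X} w → word-vanishes X (word-block w))
          (block p) (Mℚ.Closure-mono {P = Blocks S} {Q = Image gs} (λ (q , t , e) → Mℚ.Closure-resp e (dense t)) (sub s)))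
        where
        open MonomialSpans ℚ-ring (λ q → q ℚ.≟ 0ℚ) inverseℚ (suc n) using (letters; empty; _∷_)
        letter-block : ∀ hs → (∀ {g} → g ∈ hs → Both (Blocks S) g) → ∀ {a} → a ∈ letters hs → Blocks S a
        letter-block (g ∷ hs) hs∈ (here ≡.refl)         = proj₁ (hs∈ (here ≡.refl))
        letter-block (g ∷ hs) hs∈ (there (here ≡.refl)) = proj₂ (hs∈ (here ≡.refl))
        letter-block (g ∷ hs) hs∈ (there (there a∈))    = letter-block hs (λ g∈ → hs∈ (there g∈)) a∈
        word-block : ∀ {X} → Word gs X → Blocks S X
        word-block empty    = I∈Blocks
        word-block (a∈ ∷ w) = Blocks-· (letter-block gs gs∈ a∈) (word-block w)
        word-vanishes : ∀ X → Blocks S X → eval K f (λ v → ι (X (proj₁ (index v)) (proj₂ (index v)))) K.≈ K.0#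
        word-vanishes X (q , t , e) = K.trans (eval-cong f λ v → K.trans (ι-cong (≡.sym (e _ _))) (K.sym (embed≈ q v))) (h q t)

      module _ {ℓ : ℕ} (S : Fin ℓ → Pt n → Set) (S⊆GL : ∀ i p → S i p → InGL p)
        (ascending : ∀ i j → suc (toℕ i) ≡ toℕ j →
          (∀ x → Closureᴷ (S i) x → Closureᴷ (S j) x) × ¬ (∀ x → Closureᴷ (S j) x → Closureᴷ (S i) x)) where

        private
          Witness : Fin ℓ → Fin ℓ → Set
          Witness i j = ∃ λ p → ⟨ S j ⟩ p × Σ (Mℚ.MatPoly (suc n)) λ f →
            (∀ A → Blocks (S i) A → Mℚ.ev f A ≡ 0ℚ) × ¬ Mℚ.ev f (block p) ≡ 0ℚ

          -- Without a witness every element of `⟨ S j ⟩` would lie in the rational closure of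
          -- `⟨ S i ⟩`, equality in ℚ being decidable, and `ascend` would give the inclusion that
          -- strictness excludes.
          witness : ∀ i j → suc (toℕ i) ≡ toℕ j → ¬ ¬ Witness i j
          witness i j e none = dense (S i) (S⊆GL i) λ d → proj₂ (ascending i j e)
            (ascend (S⊆GL i) d λ {p} s f kills → decidable-stable (Mℚ.ev f (block p) ℚ.≟ 0ℚ) λ nz → none (p , s , f , kills , nz))

          Built : ℕ → Fin ℓ → Set
          Built l i = ∃ λ gs → length gs ≡ l × Chainℚ gs × (∀ {g} → g ∈ gs → Both (Closureℚ (S i)) g)

          -- The polynomial of the witness vanishes on `⟨ S i ⟩`, thus on its rational closure,
          -- which contains `W gs`. The older generators move up to `S j` through `descend`.
          grow : ∀ {l} i j → suc (toℕ i) ≡ toℕ j → Built l i → Witness i j → Built (suc l) j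
          grow i j e (gs , len , chain , gs∈) (p , s , f , kills , nz) =
            g ∷ gs , cong suc len , ((f , (λ x w → proj₁ (W⊆Closure gs∈ w) f kills) , nz) , chain) ,
            λ { (here ≡.refl) → Blocks⊆Closure (p , s , Mℚ.≋-refl) , Blocks⊆Closure (HasInverse.p⁻¹ h , HasInverse.p⁻¹∈ h , Mℚ.≋-refl)
              ; (there g∈) → upward (proj₁ (gs∈ g∈)) , upward (proj₂ (gs∈ g∈)) }
            where
            g = toGL (S j) (S⊆GL j) s
            h = has-inverse (S j) (S⊆GL j) s
            upward : ∀ {A} → Closureℚ (S i) A → Closureℚ (S j) A
            upward = Mℚ.Closure-mono (descend (proj₁ (ascending i j e)))

          build : ∀ l (l<ℓ : l < ℓ) → ¬ ¬ Built l (fromℕ< l<ℓ)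
          build zero    l<ℓ k = k ([] , ≡.refl , tt , λ ())
          build (suc l) l<ℓ k = build l l<ℓ′ λ b → witness (fromℕ< l<ℓ′) (fromℕ< l<ℓ) e λ w → k (grow _ _ e b w)
            where
            l<ℓ′ = ℕ.<⇒≤ l<ℓ
            e : suc (toℕ (fromℕ< l<ℓ′)) ≡ toℕ (fromℕ< l<ℓ)
            e = ≡.trans (cong suc (toℕ-fromℕ< l<ℓ′)) (≡.sym (toℕ-fromℕ< l<ℓ))

        chain-length : ℓ ≤ bound
        -- Index `l` carries a chain of `l` generators, so index `bound` would carry one of length
        -- `bound`, where `chain-boundℚ` is strict.
        chain-length = ℕ.≮⇒≥ λ bound<ℓ → build bound bound<ℓ λ (gs , len , chain , _) →
          ℕ.<⇒≱ (chain-boundℚ (s≤s z≤n) gs chain) (ℕ.≤-reflexive (≡.sym len))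

  n<2^n : ∀ n → n < 2 ^ n
  n<2^n zero    = s≤s z≤n
  n<2^n (suc n) = ℕ.+-mono-≤ (1≤^ {2} (s≤s z≤n) n) (ℕ.≤-trans (n<2^n n) (ℕ.m≤m+n (2 ^ n) 0))

  n!≤2^n*n : ∀ n → n ! ≤ 2 ^ (n ℕ.* n)
  n!≤2^n*n n = ℕ.≤-trans (n!≤n^n n) (subst (n ^ n ≤_) (ℕ.^-*-assoc 2 n n) (ℕ.^-monoˡ-≤ n (ℕ.<⇒≤ (n<2^n n))))
    where
    n!≤n^n : ∀ n → n ! ≤ n ^ n
    n!≤n^n zero    = ℕ.≤-refl
    n!≤n^n (suc n) = ℕ.*-monoʳ-≤ (suc n) (ℕ.≤-trans (n!≤n^n n) (ℕ.^-monoˡ-≤ n (ℕ.n≤1+n n)))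

  -- Coefficients, constant term first, of (2N + 1) + (2 + N² + N) with N = n + 1: the exponents of
  -- 2 that bound the two factors of `Points.bound`.
  boundPoly : List ℕ
  boundPoly = 7 ∷ 5 ∷ 1 ∷ []

  bound≤ : ∀ n → Points.bound n ≤ 2 ^ evalℕPoly boundPoly n
  bound≤ n = ℕ.≤-trans (ℕ.*-mono-≤ first second) (ℕ.≤-reflexive (≡.trans (≡.sym (ℕ.^-distribˡ-+-* 2 (suc (N ℕ.+ N)) (2 ℕ.+ (N ℕ.* N ℕ.+ N)))) (cong (2 ^_) (lem n))))
    where
    N = suc n
    N≤ : N ≤ 2 ^ N
    N≤ = ℕ.<⇒≤ (n<2^n N)
    double : ∀ {a b} → 1 ≤ b → a ≤ 2 ^ b → suc a ≤ 2 ^ suc b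
    double {a} {b} _ h = ℕ.+-mono-≤ (1≤^ {2} (s≤s z≤n) b) (ℕ.≤-trans h (ℕ.m≤m+n (2 ^ b) 0))
    first : suc (N ℕ.* N) ≤ 2 ^ suc (N ℕ.+ N)
    first = double {b = N ℕ.+ N} (s≤s z≤n) (subst (N ℕ.* N ≤_) (≡.sym (ℕ.^-distribˡ-+-* 2 N N)) (ℕ.*-mono-≤ N≤ N≤))
    N!N = N ! ℕ.* N
    N!N≤ : N!N ≤ 2 ^ (N ℕ.* N ℕ.+ N)
    N!N≤ = subst (N!N ≤_) (≡.sym (ℕ.^-distribˡ-+-* 2 (N ℕ.* N) N)) (ℕ.*-mono-≤ (n!≤2^n*n N) N≤)
    second : suc (3 ℕ.* N!N) ≤ 2 ^ (2 ℕ.+ (N ℕ.* N ℕ.+ N))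
    second = ℕ.≤-trans (ℕ.+-monoˡ-≤ (3 ℕ.* N!N) (1≤-* {N !} (1≤! N) (s≤s z≤n)))
      (ℕ.≤-trans (ℕ.*-monoʳ-≤ 4 N!N≤) (ℕ.≤-reflexive (≡.sym (ℕ.^-distribˡ-+-* 2 2 (N ℕ.* N ℕ.+ N)))))
    lem : ∀ n → suc (suc n ℕ.+ suc n) ℕ.+ (2 ℕ.+ (suc n ℕ.* suc n ℕ.+ suc n)) ≡ 7 ℕ.+ n ℕ.* (5 ℕ.+ n ℕ.* (1 ℕ.+ n ℕ.* 0))
    lem = solve-∀

  exp-inflationary : ∀ k x → x ≤ exp k x
  exp-inflationary zero    x = ℕ.≤-refl
  exp-inflationary (suc k) x = ℕ.≤-trans (exp-inflationary k x) (ℕ.<⇒≤ (n<2^n (exp k x)))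

  bound≤exp⁴ : ∀ n → Points.bound n ≤ exp 4 (evalℕPoly boundPoly n)
  bound≤exp⁴ n = ℕ.≤-trans (bound≤ n) (ℕ.^-monoʳ-≤ 2 (exp-inflationary 3 (evalℕPoly boundPoly n)))

open import Defs
open import Level using (0ℓ)
open import Data.Nat using (ℕ; suc; _≤_; _<_)
open import Data.Nat.Properties using (≤-trans)
open import Data.Fin using (Fin; toℕ)
open import Data.List using (List)
open import Data.Product using (Σ; _×_; _,_)
open import Relation.Nullary using (¬_)
open import Relation.Binary.PropositionalEquality using (_≡_)
open import Algebra.Bundles using (CommutativeRing)

theorem12 : Σ (List ℕ) λ poly →
    (K : CommutativeRing 0ℓ 0ℓ) → (AK : IsAlgebraicClosureOfℚ K) →
    (n ℓ : ℕ) → (S : Fin ℓ → Pt n → Set) →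
    (∀ i p → S i p → InGL p) →
    (∀ (i j : Fin ℓ) → suc (toℕ i) ≡ toℕ j →
    (∀ x → ZariskiClosure K (IsAlgebraicClosureOfℚ.ι AK) ⟨ S i ⟩ x → ZariskiClosure K (IsAlgebraicClosureOfℚ.ι AK) ⟨ S j ⟩ x)
    × ¬ (∀ x → ZariskiClosure K (IsAlgebraicClosureOfℚ.ι AK) ⟨ S j ⟩ x → ZariskiClosure K (IsAlgebraicClosureOfℚ.ι AK) ⟨ S i ⟩ x)) →
    ℓ ≤ exp 4 (evalℕPoly poly n)
theorem12 = ChainLength.boundPoly , λ K AK n ℓ S S⊆GL ascending →
  ≤-trans (ChainLength.Points.OverK.chain-length n K AK S S⊆GL ascending) (ChainLength.bound≤exp⁴ n)
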